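{- Let $n$ be a positive odd integer. Then \[ \sum_{k=0}^{n-1}(-1)^k [4k+1]\frac{(q;q^2)_k^5}{(q^2;q^2)_k^5}\, q^{k^2+k} \equiv [n]\,q^{(1-n)/2} \sum_{k=0}^{(n-1)/2} \frac{(q;q^2)_k^3}{(q^2;q^2)_k^3}\, q^{2k} \pmod{[n]\Phi_n(q)^2}, \] and \[ \sum_{k=0}^{(n-1)/2}(-1)^k [4k+1]\frac{(q;q^2)_k^5}{(q^2;q^2)_k^5}\, q^{k^2+k} \equiv [n]\,q^{(1-n)/2} \sum_{k=0}^{(n-1)/2} \frac{(q;q^2)_k^3}{(q^2;q^2)_k^3}\, q^{2k} \pmod{[n]\Phi_n(q)^2}. \]
   Context: Here $q$ is an indeterminate. For $x$ and a base $p$ (a power of $q$), $(x;p)_k=\prod_{j=0}^{k-1}(1-xp^j)$ for integers $k\ge 0$. The $q$-integer is $[n]=1+q+\cdots+q^{n-1}$, and $\Phi_n(q)$ is the $n$-th cyclotomic polynomial. For rational functions $A(q),B(q)$ and a polynomial $P(q)$, $A(q)\equiv B(q)\pmod{P(q)}$ means that the numerator of the reduced form of $A(q)-B(q)$ is divisible by $P(q)$ in $\mathbb{Z}[q]$. -}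

module Defs where

open import Data.Nat as ℕ using (ℕ; zero; suc; _∸_)
open import Data.Nat.Divisibility using (_∣?_)
open import Data.Integer as ℤ using (ℤ; +_; -[1+_])
open import Data.List using (List; []; _∷_; _++_; replicate; length; reverse; dropWhile; foldr; zip; map; last; applyUpTo; upTo)
open import Data.List.Relation.Unary.All using (All)
open import Data.Maybe using (Maybe; just; nothing)
open import Data.Product using (Σ; _×_; ∃)
open import Data.Sum using (_⊎_)
open import Data.Bool using (if_then_else_)
open import Relation.Nullary using (¬_; does)
open import Relation.Binary.PropositionalEquality using (_≡_)

-- Polynomials in ℤ[q]: coefficient lists, lowest degree first.

Poly : Set
Poly = List ℤ

infixl 6 _+ₚ_ _-ₚ_
infixl 7 _*ₚ_ _·ₚ_
infixr 8 _^ₚ_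

_+ₚ_ : Poly → Poly → Poly
[] +ₚ q = q
(a ∷ p) +ₚ [] = a ∷ p
(a ∷ p) +ₚ (b ∷ q) = (a ℤ.+ b) ∷ (p +ₚ q)

-ₚ_ : Poly → Poly
-ₚ p = map ℤ.-_ p

_-ₚ_ : Poly → Poly → Poly
p -ₚ q = p +ₚ (-ₚ q)

_·ₚ_ : ℤ → Poly → Poly
a ·ₚ p = map (a ℤ.*_) p

_*ₚ_ : Poly → Poly → Poly
[] *ₚ q = []
(a ∷ p) *ₚ q = (a ·ₚ q) +ₚ (+ 0 ∷ (p *ₚ q))

1ₚ : Poly
1ₚ = + 1 ∷ []

0ₚ : Poly
0ₚ = []

X^ : ℕ → Poly
X^ k = replicate k (+ 0) ++ (+ 1 ∷ [])

_^ₚ_ : Poly → ℕ → Poly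
p ^ₚ zero = 1ₚ
p ^ₚ suc m = p *ₚ (p ^ₚ m)

-- equality of polynomials (up to trailing zero coefficients)
IsZeroₚ : Poly → Set
IsZeroₚ p = All (_≡ + 0) p

infix 4 _≈ₚ_ _∣ₚ_
_≈ₚ_ : Poly → Poly → Set
p ≈ₚ q = IsZeroₚ (p -ₚ q)

_∣ₚ_ : Poly → Poly → Set
g ∣ₚ p = ∃ λ c → c *ₚ g ≈ₚ p

IsUnitₚ : Poly → Set
IsUnitₚ g = (g ≈ₚ 1ₚ) ⊎ (g ≈ₚ (-[1+ 0 ] ∷ []))

CoprimeN : Poly → Poly → Set
CoprimeN N D = ∀ g → g ∣ₚ N → g ∣ₚ D → IsUnitₚ g

strip : Poly → Poly
strip p = reverse (dropWhile (λ x → x ℤ.≟ + 0) (reverse p))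

lastCoeff : Poly → ℤ
lastCoeff p with last p
... | just a = a
... | nothing = + 0

-- quotient of p by monic d, with fuel
quotₚ : ℕ → Poly → Poly → Poly
quotₚ zero p d = []
quotₚ (suc f) p d =
  let p' = strip p
      d' = strip d
  in if does (length p' ℕ.<? length d')
     then []
     else (let t = replicate (length p' ∸ length d') (+ 0) ++ (lastCoeff p' ∷ [])
           in t +ₚ quotₚ f (p' -ₚ t *ₚ d') d')

-- cyclotomic polynomials: Φ_{m} = (q^m - 1) / ∏_{d ∣ m, d < m} Φ_d
newCyc : ℕ → List Poly → Poly
newCyc m prev =
  let prodDiv = foldr (λ pd acc → if does (Data.Product.proj₂ pd ∣? suc m)
                                   then Data.Product.proj₁ pd *ₚ acc else acc)
                      1ₚ (zip prev (applyUpTo suc m))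
  in quotₚ (suc (suc m)) (X^ (suc m) -ₚ 1ₚ) prodDiv

-- cycList m = [Φ_1, …, Φ_m]
cycList : ℕ → List Poly
cycList zero = []
cycList (suc m) = cycList m ++ (newCyc m (cycList m) ∷ [])

-- Φ n (Φ 0 := 1 is a dummy value, never used)
Φ : ℕ → Poly
Φ zero = 1ₚ
Φ (suc m) = newCyc m (cycList m)

[_]ₚ : ℕ → Poly
[ n ]ₚ = foldr (λ i acc → X^ i +ₚ acc) 0ₚ (upTo n)

qPoch : ℕ → ℕ → ℕ → Poly
qPoch a b k = foldr (λ j acc → (1ₚ -ₚ X^ (a ℕ.+ b ℕ.* j)) *ₚ acc) 1ₚ (upTo k)

record RatF : Set where
  constructor _/ᵣ_
  field
    num : Poly
    den : Poly
open RatF public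

infixl 6 _+ᵣ_
infixl 7 _*ᵣ_

_+ᵣ_ : RatF → RatF → RatF
(a /ᵣ b) +ᵣ (c /ᵣ d) = (a *ₚ d +ₚ c *ₚ b) /ᵣ (b *ₚ d)

_*ᵣ_ : RatF → RatF → RatF
(a /ᵣ b) *ᵣ (c /ᵣ d) = (a *ₚ c) /ᵣ (b *ₚ d)

polyᵣ : Poly → RatF
polyᵣ p = p /ᵣ 1ₚ

sumᵣ : ℕ → (ℕ → RatF) → RatF
sumᵣ m f = foldr (λ k acc → f k +ᵣ acc) (0ₚ /ᵣ 1ₚ) (upTo m)

-- A ≡ B (mod P): the numerator of the reduced form of A - B is divisible by P.
-- (N / D) is a reduced form of A - B: D ≠ 0, N, D coprime, N/D = A - B.
infix 4 _≡ᵣ_[mod_]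
_≡ᵣ_[mod_] : RatF → RatF → Poly → Set
A ≡ᵣ B [mod P ] =
  Σ Poly λ N → Σ Poly λ D →
    ¬ IsZeroₚ D × CoprimeN N D ×
    (N *ₚ den A *ₚ den B ≈ₚ D *ₚ (num A *ₚ den B -ₚ num B *ₚ den A)) ×
    P ∣ₚ N

signₚ : ℕ → Poly
signₚ k = if does (k ℕ.% 2 ℕ.≟ 0) then 1ₚ else (-[1+ 0 ] ∷ [])

lhsTerm : ℕ → RatF
lhsTerm k = (signₚ k *ₚ [ 4 ℕ.* k ℕ.+ 1 ]ₚ *ₚ (qPoch 1 2 k ^ₚ 5) *ₚ X^ (k ℕ.* k ℕ.+ k))
            /ᵣ (qPoch 2 2 k ^ₚ 5)

rhsTerm : ℕ → RatF
rhsTerm k = ((qPoch 1 2 k ^ₚ 3) *ₚ X^ (2 ℕ.* k)) /ᵣ (qPoch 2 2 k ^ₚ 3)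

rhs : ℕ → RatF
rhs n = polyᵣ [ n ]ₚ *ᵣ (1ₚ /ᵣ X^ ((n ∸ 1) ℕ./ 2)) *ᵣ sumᵣ (suc ((n ∸ 1) ℕ./ 2)) rhsTerm

private
  test6 : Φ 6 ≡ (+ 1 ∷ -[1+ 0 ] ∷ + 1 ∷ [])
  test6 = Relation.Binary.PropositionalEquality.refl
  test9 : Φ 9 ≡ (+ 1 ∷ + 0 ∷ + 0 ∷ + 1 ∷ + 0 ∷ + 0 ∷ + 1 ∷ [])
  test9 = Relation.Binary.PropositionalEquality.refl
  test1 : Φ 1 ≡ (-[1+ 0 ] ∷ + 1 ∷ [])
  test1 = Relation.Binary.PropositionalEquality.refl

{-# OPTIONS --safe #-}

-- Put n = 2N + 1 and C_k = (q;q²)_k / (q²;q²)_k. In a ring where (1 − qⁿ)³ = 0 and the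
-- elements 1 − qⁱ with 0 < i < n are regular, there is an equality
--   Σ_{k≤N} (−1)ᵏ [4k+1] C_k⁵ q^(k²+k) = [n] q^(−N) Σ_{j≤N} C_j³ q^(2j).
-- To see it, expand (−1)ᵏ q^(k²+k) C_k by the terminating q-Chu–Vandermonde sum and
-- interchange the summations. The inner sum I_j satisfies a first-order recurrence in j,
-- because the corresponding combination of its terms telescopes in k with boundary term a
-- multiple of (1 − qⁿ)³, and I_N is a single term.
-- Modulo Φ_n³ this is the asserted congruence, the terms with N < k < n being zero there.
-- Modulo Φ_d with d ∣ n and d > 1, the sequence C_k is a constant times C_{k mod d} on each
-- block of d consecutive indices, so the same equality with d in place of n makes every
-- block contribute a multiple of [d], that is, zero. The Φ_d are monic and pairwise
-- comaximal over ℚ, so these divisibilities combine to one by [n]Φ_n².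
-- Since (q;q²)_k / (q²;q²)_k is the Gaussian binomial [2k, k] divided by (−q;q)_k², all
-- denominators divide q^N (−q;q)_{n−1}¹⁰, which for odd n is comaximal with qⁿ − 1 over ℚ.
-- Hence reducing the fraction to lowest terms, possible in ℤ[q] by Gauss's lemma, does not
-- disturb divisibility of the numerator by [n]Φ_n².
module Submission where

open import Defs
open import Data.Nat using (ℕ; suc; _∸_; _/_; _%_)
open import Data.Product using (_×_)
open import Relation.Binary.PropositionalEquality using (_≡_)

open import Algebra.Bundles using (CommutativeRing)
import Algebra.Properties.CommutativeSemiring.Exp as Exp
import Algebra.Properties.Group as GroupProperties
import Algebra.Properties.Ring as RingProperties
import Algebra.Properties.Semiring.Mult.TCOptimised as Mult
import Algebra.Solver.Ring as RingSolver
open import Algebra.Solver.Ring.AlmostCommutativeRing using (fromCommutativeRing; _-Raw-AlmostCommutative⟶_)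
open import Data.Bool using (if_then_else_; true; false)
open import Data.Empty using (⊥-elim)
open import Data.Integer as ℤ using (ℤ; +_; -[1+_])
import Data.Integer.Divisibility.Signed as ℤ∣
import Data.Integer.Properties as ℤ
import Data.Integer.Tactic.RingSolver as ℤ-Solver
open import Data.List using ([]; _∷_; _++_; _∷ʳ_; length; foldr; zip; applyUpTo; reverse; dropWhile; replicate)
import Data.List.Properties as List
open import Data.List.Relation.Unary.All using (All; []; _∷_)
open import Data.Maybe using (Maybe; just; nothing)
open import Data.Nat as ℕ using (zero; _<_; _≤_; s≤s; z≤n)
import Data.Nat.Divisibility as ℕ
open import Data.Nat.Divisibility using (_∣?_; divides)
import Data.Nat.DivMod as ℕ
open import Data.Nat.GCD using (gcd; gcd[m,n]∣m; gcd[m,n]∣n; module Bézout; gcd-GCD; gcd[m,n]≡0⇒n≡0)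
open import Data.Nat.Induction using (<-rec)
open import Data.Nat.ListAction using (product)
open import Data.Nat.Primality using (Prime; prime⇒nonZero; euclidsLemma)
open import Data.Nat.Primality.Factorisation using (factorise; PrimeFactorisation)
import Data.Nat.Properties as ℕ
open import Data.Nat.Tactic.RingSolver using (solve-∀)
open import Data.Product using (_,_; ∃; ∃₂; proj₁; proj₂)
import Data.Sign as Sign
open import Data.Sum as Sum using (_⊎_; inj₁; inj₂; [_,_]′)
open import Level using (Level; _⊔_; 0ℓ)
open import Relation.Binary.Bundles using (Setoid)
open import Relation.Binary.Definitions using (tri<; tri≈; tri>)
open import Relation.Binary.PropositionalEquality as ≡ using (_≢_)
open import Relation.Nullary using (¬_; yes; no; does)
open import Relation.Nullary.Decidable using (dec-true; dec-false)

-- The ring ℤ[q]/(Φₙ³) has zero divisors, and 1 - qⁱ need not be a unit in it. So identities are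
-- multiplied through by their denominators, which are afterwards cancelled as regular elements; the
-- C_k enter only as a sequence `b` with their recurrence. Modulo Φ_d that recurrence loses its
-- leading coefficient at the end of a block and says nothing about the next one. Both sides of the
-- identity are homogeneous of degree 5 in `b`, so every block may carry a constant of its own. The
-- exponent 3 has its origin in the fourth power of C_k that is left after the expansion: its
-- recurrence puts four factors 1 - q^(2k+1) into the telescoping certificate, and the kernel of the
-- Chu-Vandermonde sum absorbs one of them. Comaximality of cyclotomic polynomials holds in general
-- only up to an integer constant. Such constants can be removed because ℤ[q]/(f) has no torsion
-- when f is monic. The factor Φ_1 = q - 1 of qⁿ - 1 is missing from [n]; it is supplied by
-- multiplying with q - 1 and cancelled at the end.

-- Integer constants in a commutative ring, and a ring solver that uses them

module IntegerCoefficients {c ℓ : Level} (R : CommutativeRing c ℓ) where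
  open CommutativeRing R hiding (zero)
  open Mult semiring using (×-homo-+; ×1-homo-*; 1+×) renaming (_×_ to infixl 8 _·_)
  open RingProperties ring using (-‿distribˡ-*; -‿distribʳ-*; -0#≈0#; -‿+-comm; -‿involutive)
  open import Relation.Binary.Reasoning.Setoid setoid

  -- The optimised multiple makes `⟦ + 1 ⟧ℤ` compute to `1#`, so constants in solver equations agree
  -- with the ring's own unit.
  ⟦_⟧ℤ : ℤ → Carrier
  ⟦ + n ⟧ℤ = n · 1#
  ⟦ -[1+ n ] ⟧ℤ = - (suc n · 1#)

  private
    cancel : ∀ a b → a ≈ (b + a) - b
    cancel a b = begin
      a              ≈⟨ +-identityʳ a ⟨
      a + 0#         ≈⟨ +-congˡ (-‿inverseʳ b) ⟨
      a + (b - b)    ≈⟨ +-assoc a b (- b) ⟨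
      (a + b) - b    ≈⟨ +-congʳ (+-comm a b) ⟩
      (b + a) - b    ∎

    shift : ∀ a b c → b - c ≈ (a + b) - (a + c)
    shift a b c = begin
      b - c                        ≈⟨ +-congʳ (cancel b a) ⟩
      ((a + b) - a) - c            ≈⟨ +-assoc _ _ _ ⟩
      (a + b) + (- a - c)          ≈⟨ +-congˡ (-‿+-comm a c) ⟩
      (a + b) - (a + c)            ∎

  ⟦⟧ℤ-neg : ∀ i → ⟦ ℤ.- i ⟧ℤ ≈ - ⟦ i ⟧ℤ
  ⟦⟧ℤ-neg (+ zero) = sym -0#≈0#
  ⟦⟧ℤ-neg (+ suc n) = refl
  ⟦⟧ℤ-neg -[1+ n ] = sym (-‿involutive _)

  private
    ⟦⟧ℤ-⊖ : ∀ m n → ⟦ m ℤ.⊖ n ⟧ℤ ≈ m · 1# - n · 1#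
    ⟦⟧ℤ-⊖ m zero = sym (trans (+-congˡ -0#≈0#) (+-identityʳ _))
    ⟦⟧ℤ-⊖ zero (suc n) = sym (+-identityˡ _)
    ⟦⟧ℤ-⊖ (suc m) (suc n) = begin
      ⟦ suc m ℤ.⊖ suc n ⟧ℤ               ≡⟨ ≡.cong ⟦_⟧ℤ (ℤ.[1+m]⊖[1+n]≡m⊖n m n) ⟩
      ⟦ m ℤ.⊖ n ⟧ℤ                       ≈⟨ ⟦⟧ℤ-⊖ m n ⟩
      m · 1# - n · 1#                    ≈⟨ shift 1# _ _ ⟩
      (1# + m · 1#) - (1# + n · 1#)      ≈⟨ +-cong (1+× m 1#) (-‿cong (1+× n 1#)) ⟨
      suc m · 1# - suc n · 1#            ∎

  ⟦⟧ℤ-+ : ∀ i j → ⟦ i ℤ.+ j ⟧ℤ ≈ ⟦ i ⟧ℤ + ⟦ j ⟧ℤ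
  ⟦⟧ℤ-+ (+ m) (+ n) = ×-homo-+ 1# m n
  ⟦⟧ℤ-+ (+ m) -[1+ n ] = ⟦⟧ℤ-⊖ m (suc n)
  ⟦⟧ℤ-+ -[1+ m ] (+ n) = trans (⟦⟧ℤ-⊖ n (suc m)) (+-comm _ _)
  ⟦⟧ℤ-+ -[1+ m ] -[1+ n ] = begin
    - (suc (suc (m ℕ.+ n)) · 1#)        ≡⟨ ≡.cong (λ k → - (k · 1#)) (≡.cong suc (≡.sym (ℕ.+-suc m n))) ⟩
    - ((suc m ℕ.+ suc n) · 1#)          ≈⟨ -‿cong (×-homo-+ 1# (suc m) (suc n)) ⟩
    - (suc m · 1# + suc n · 1#)         ≈⟨ -‿+-comm _ _ ⟨
    - (suc m · 1#) - (suc n · 1#)       ∎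

  ⟦⟧ℤ-* : ∀ i j → ⟦ i ℤ.* j ⟧ℤ ≈ ⟦ i ⟧ℤ * ⟦ j ⟧ℤ
  ⟦⟧ℤ-* (+ m) (+ n) = trans (reflexive (≡.cong ⟦_⟧ℤ (ℤ.+◃n≡+n (m ℕ.* n)))) (×1-homo-* m n)
  ⟦⟧ℤ-* (+ m) -[1+ n ] = begin
    ⟦ Sign.- ℤ.◃ (m ℕ.* suc n) ⟧ℤ    ≡⟨ ≡.cong ⟦_⟧ℤ (ℤ.-◃n≡-n (m ℕ.* suc n)) ⟩
    ⟦ ℤ.- (+ (m ℕ.* suc n)) ⟧ℤ       ≈⟨ ⟦⟧ℤ-neg (+ (m ℕ.* suc n)) ⟩
    - ((m ℕ.* suc n) · 1#)           ≈⟨ -‿cong (×1-homo-* m (suc n)) ⟩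
    - (m · 1# * (suc n · 1#))        ≈⟨ -‿distribʳ-* _ _ ⟩
    m · 1# * - (suc n · 1#)          ∎
  ⟦⟧ℤ-* -[1+ m ] (+ n) = begin
    ⟦ Sign.- ℤ.◃ (suc m ℕ.* n) ⟧ℤ    ≡⟨ ≡.cong ⟦_⟧ℤ (ℤ.-◃n≡-n (suc m ℕ.* n)) ⟩
    ⟦ ℤ.- (+ (suc m ℕ.* n)) ⟧ℤ       ≈⟨ ⟦⟧ℤ-neg (+ (suc m ℕ.* n)) ⟩
    - ((suc m ℕ.* n) · 1#)           ≈⟨ -‿cong (×1-homo-* (suc m) n) ⟩
    - (suc m · 1# * (n · 1#))        ≈⟨ -‿distribˡ-* _ _ ⟩
    - (suc m · 1#) * (n · 1#)        ∎
  ⟦⟧ℤ-* -[1+ m ] -[1+ n ] = begin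
    (suc m ℕ.* suc n) · 1#           ≈⟨ ×1-homo-* (suc m) (suc n) ⟩
    suc m · 1# * (suc n · 1#)        ≈⟨ -‿involutive _ ⟨
    - - (suc m · 1# * (suc n · 1#))  ≈⟨ -‿cong (-‿distribˡ-* _ _) ⟩
    - (- (suc m · 1#) * (suc n · 1#)) ≈⟨ -‿distribʳ-* _ _ ⟩
    - (suc m · 1#) * - (suc n · 1#)  ∎

  private
    morphism : ℤ.+-*-rawRing -Raw-AlmostCommutative⟶ fromCommutativeRing R
    morphism = record
      { ⟦_⟧ = ⟦_⟧ℤ ; +-homo = ⟦⟧ℤ-+ ; *-homo = ⟦⟧ℤ-* ; -‿homo = ⟦⟧ℤ-neg ; 0-homo = refl ; 1-homo = refl }

    _≟ℤ_ : ∀ i j → Maybe (⟦ i ⟧ℤ ≈ ⟦ j ⟧ℤ)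
    i ≟ℤ j with i ℤ.≟ j
    ... | yes i≡j = just (reflexive (≡.cong ⟦_⟧ℤ i≡j))
    ... | no  _   = nothing

  open RingSolver ℤ.+-*-rawRing (fromCommutativeRing R) morphism _≟ℤ_ public
    using (solve; con; _:=_; _:+_; _:*_; _:-_; :-_; _:^_)

  pattern 1ᶜ = con (+ 1)

-- Finite sums, finite products and regular elements

module FiniteSums {c ℓ : Level} (R : CommutativeRing c ℓ) where
  open CommutativeRing R hiding (zero)
  open Exp commutativeSemiring public using (_^_; ^-homo-*; ^-distrib-*; ^-congˡ; ^-congʳ; ^-assocʳ)
  open RingProperties ring public using (x[y-z]≈xy-xz; -0#≈0#; -‿distribˡ-*)
  open GroupProperties +-group public using () renaming (x≈y⇒x∙y⁻¹≈ε to x≈y⇒x-y≈0; x∙y⁻¹≈ε⇒x≈y to x-y≈0⇒x≈y)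
  open IntegerCoefficients R public
  open import Relation.Binary.Reasoning.Setoid setoid

  ∑ : ℕ → (ℕ → Carrier) → Carrier
  ∑ zero f = 0#
  ∑ (suc n) f = ∑ n f + f n

  ∏ : ℕ → (ℕ → Carrier) → Carrier
  ∏ zero f = 1#
  ∏ (suc n) f = ∏ n f * f n

  ∑-cong : ∀ n {f g} → (∀ k → k < n → f k ≈ g k) → ∑ n f ≈ ∑ n g
  ∑-cong zero f≈g = refl
  ∑-cong (suc n) f≈g = +-cong (∑-cong n λ k k<n → f≈g k (ℕ.m<n⇒m<1+n k<n)) (f≈g n ℕ.≤-refl)

  ∑-zero : ∀ n {f} → (∀ k → k < n → f k ≈ 0#) → ∑ n f ≈ 0#
  ∑-zero zero f≈0 = refl
  ∑-zero (suc n) f≈0 =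
    trans (+-cong (∑-zero n λ k k<n → f≈0 k (ℕ.m<n⇒m<1+n k<n)) (f≈0 n ℕ.≤-refl)) (+-identityˡ 0#)

  ∑-+ : ∀ n f g → ∑ n (λ k → f k + g k) ≈ ∑ n f + ∑ n g
  ∑-+ zero f g = sym (+-identityˡ 0#)
  ∑-+ (suc n) f g = begin
    ∑ n (λ k → f k + g k) + (f n + g n)  ≈⟨ +-congʳ (∑-+ n f g) ⟩
    (∑ n f + ∑ n g) + (f n + g n)        ≈⟨ solve 4 (λ a b c d → (a :+ b) :+ (c :+ d) := (a :+ c) :+ (b :+ d)) refl _ _ _ _ ⟩
    (∑ n f + f n) + (∑ n g + g n)        ∎

  ∑-*ˡ : ∀ n a f → a * ∑ n f ≈ ∑ n (λ k → a * f k)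
  ∑-*ˡ zero a f = zeroʳ a
  ∑-*ˡ (suc n) a f = trans (distribˡ a _ _) (+-congʳ (∑-*ˡ n a f))

  ∑-swap : ∀ m n (f : ℕ → ℕ → Carrier) → ∑ m (λ i → ∑ n (f i)) ≈ ∑ n (λ j → ∑ m (λ i → f i j))
  ∑-swap zero n f = sym (∑-zero n λ _ _ → refl)
  ∑-swap (suc m) n f = trans (+-congʳ (∑-swap m n f)) (sym (∑-+ n _ (f m)))

  ∑-telescope : ∀ n (f : ℕ → Carrier) → ∑ n (λ k → f (suc k) - f k) ≈ f n - f 0
  ∑-telescope zero f = sym (-‿inverseʳ (f 0))
  ∑-telescope (suc n) f = trans (+-congʳ (∑-telescope n f))
    (solve 3 (λ a b c → (a :- b) :+ (c :- a) := c :- b) refl (f n) (f 0) (f (suc n)))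

  ∑-split : ∀ m n f → ∑ (m ℕ.+ n) f ≈ ∑ m f + ∑ n (λ k → f (m ℕ.+ k))
  ∑-split m zero f rewrite ℕ.+-identityʳ m = sym (+-identityʳ _)
  ∑-split m (suc n) f rewrite ℕ.+-suc m n = trans (+-congʳ (∑-split m n f)) (+-assoc _ _ _)

  ∑-head : ∀ n f → ∑ (suc n) f ≈ f 0 + ∑ n (λ k → f (suc k))
  ∑-head n f = trans (∑-split 1 n f) (+-congʳ (+-identityˡ (f 0)))

  ∏-cong : ∀ n {f g} → (∀ k → k < n → f k ≈ g k) → ∏ n f ≈ ∏ n g
  ∏-cong zero f≈g = refl
  ∏-cong (suc n) f≈g = *-cong (∏-cong n λ k k<n → f≈g k (ℕ.m<n⇒m<1+n k<n)) (f≈g n ℕ.≤-refl)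

  ∏-zero : ∀ n {f} k → k < n → f k ≈ 0# → ∏ n f ≈ 0#
  ∏-zero (suc n) k k<1+n fk≈0 with ℕ.m≤n⇒m<n∨m≡n (ℕ.s≤s⁻¹ k<1+n)
  ... | inj₁ k<n    = trans (*-congʳ (∏-zero n k k<n fk≈0)) (zeroˡ _)
  ... | inj₂ ≡.refl = trans (*-congˡ fk≈0) (zeroʳ _)

  ∏-* : ∀ n f g → ∏ n (λ k → f k * g k) ≈ ∏ n f * ∏ n g
  ∏-* zero f g = sym (*-identityˡ 1#)
  ∏-* (suc n) f g = trans (*-congʳ (∏-* n f g))
    (solve 4 (λ a b c d → (a :* b) :* (c :* d) := (a :* c) :* (b :* d)) refl _ _ _ _)

  ∏-split : ∀ m n f → ∏ (m ℕ.+ n) f ≈ ∏ m f * ∏ n (λ k → f (m ℕ.+ k))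
  ∏-split m zero f rewrite ℕ.+-identityʳ m = sym (*-identityʳ _)
  ∏-split m (suc n) f rewrite ℕ.+-suc m n = trans (*-congʳ (∏-split m n f)) (*-assoc _ _ _)

  ∏-head : ∀ n f → ∏ (suc n) f ≈ f 0 * ∏ n (λ k → f (suc k))
  ∏-head n f = trans (∏-split 1 n f) (*-congʳ (*-identityˡ (f 0)))

  ∏-reverse : ∀ n f → ∏ n f ≈ ∏ n (λ k → f (n ∸ suc k))
  ∏-reverse zero f = refl
  ∏-reverse (suc n) f = begin
    ∏ n f * f n                            ≈⟨ *-congʳ (∏-reverse n f) ⟩
    ∏ n (λ k → f (n ∸ suc k)) * f n        ≈⟨ *-comm _ _ ⟩
    f n * ∏ n (λ k → f (n ∸ suc k))        ≈⟨ ∏-head n (λ k → f (n ∸ k)) ⟨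
    ∏ (suc n) (λ k → f (n ∸ k))            ∎

  -- The factors agree only modulo the annihilator of `x`. A single `x` is enough for all of them,
  -- since it can be handed from one factor to the next.
  ∏-congˡ-* : ∀ x n {f g} → (∀ k → k < n → x * f k ≈ x * g k) → x * ∏ n f ≈ x * ∏ n g
  ∏-congˡ-* x zero xf≈xg = refl
  ∏-congˡ-* x (suc n) {f} {g} xf≈xg = begin
    x * (∏ n f * f n)   ≈⟨ *-assoc x _ _ ⟨
    x * ∏ n f * f n     ≈⟨ *-congʳ (∏-congˡ-* x n λ k k<n → xf≈xg k (ℕ.m<n⇒m<1+n k<n)) ⟩
    x * ∏ n g * f n     ≈⟨ solve 3 (λ x a b → x :* a :* b := a :* (x :* b)) refl x _ _ ⟩
    ∏ n g * (x * f n)   ≈⟨ *-congˡ (xf≈xg n ℕ.≤-refl) ⟩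
    ∏ n g * (x * g n)   ≈⟨ solve 3 (λ x a b → a :* (x :* b) := x :* (a :* b)) refl x _ _ ⟩
    x * (∏ n g * g n)   ∎

  -- Takes the place of invertibility, which fails for most of the denominators modulo a power of a
  -- cyclotomic polynomial over ℤ.
  Regular : Carrier → Set (c ⊔ ℓ)
  Regular x = ∀ y → x * y ≈ 0# → y ≈ 0#

  Regular-* : ∀ {x y} → Regular x → Regular y → Regular (x * y)
  Regular-* {x} {y} rx ry z xyz≈0 = ry z (rx (y * z) (trans (sym (*-assoc x y z)) xyz≈0))

  Regular-1 : Regular 1#
  Regular-1 y 1y≈0 = trans (sym (*-identityˡ y)) 1y≈0

  Regular-^ : ∀ {x} n → Regular x → Regular (x ^ n)
  Regular-^ zero rx = Regular-1
  Regular-^ (suc n) rx = Regular-* rx (Regular-^ n rx)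

  Regular-∏ : ∀ n {f} → (∀ k → k < n → Regular (f k)) → Regular (∏ n f)
  Regular-∏ zero rf = Regular-1
  Regular-∏ (suc n) rf = Regular-* (Regular-∏ n λ k k<n → rf k (ℕ.m<n⇒m<1+n k<n)) (rf n ℕ.≤-refl)

  Regular-resp : ∀ {x y} → x ≈ y → Regular x → Regular y
  Regular-resp x≈y rx z yz≈0 = rx z (trans (*-congʳ x≈y) yz≈0)

  Regular-cancel : ∀ {x} → Regular x → ∀ {y z} → x * y ≈ x * z → y ≈ z
  Regular-cancel {x} rx {y} {z} xy≈xz =
    x-y≈0⇒x≈y _ _ (rx (y - z) (trans (x[y-z]≈xy-xz x y z) (x≈y⇒x-y≈0 xy≈xz)))

  *-annihilates : ∀ {x y} → y ≈ 0# → x * y ≈ 0#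
  *-annihilates y≈0 = trans (*-congˡ y≈0) (zeroʳ _)

-- The quintuple sum in a ring where (1 − qⁿ)³ vanishes

module QuintupleSum {c ℓ : Level} (R : CommutativeRing c ℓ) where
  open CommutativeRing R hiding (zero)
  open FiniteSums R
  open import Relation.Binary.Reasoning.Setoid setoid

  geom : Carrier → ℕ → Carrier
  geom q m = ∑ m (q ^_)

  geom-closed : ∀ q m → (1# - q) * geom q m ≈ 1# - q ^ m
  geom-closed q zero = trans (zeroʳ _) (sym (-‿inverseʳ 1#))
  geom-closed q (suc m) = begin
    (1# - q) * (geom q m + q ^ m)             ≈⟨ distribˡ _ _ _ ⟩
    (1# - q) * geom q m + (1# - q) * q ^ m    ≈⟨ +-congʳ (geom-closed q m) ⟩
    (1# - q ^ m) + (1# - q) * q ^ m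
      ≈⟨ solve 2 (λ q x → (1ᶜ :- x) :+ (1ᶜ :- q) :* x := 1ᶜ :- q :* x) refl q (q ^ m) ⟩
    1# - q ^ suc m                            ∎

  -- τ q k = (−1)ᵏ q^(k²+k)
  τ : Carrier → ℕ → Carrier
  τ q zero = 1#
  τ q (suc k) = - ((q * q) ^ suc k * τ q k)

  -- These are 1 - q^(2i+1) and 1 - q^(2i+2), whose quotient is C_(i+1) / C_i.
  oddFactor evenFactor : Carrier → ℕ → Carrier
  oddFactor q i = 1# - q * (q * q) ^ i
  evenFactor q i = 1# - (q * q) ^ suc i

  -- b stands for a multiple b₀ C_k of the ratios C_k = (q;q²)_k/(q²;q²)_k, known only through
  -- their recurrence; the identity for the C_k is multiplied by q^N b₀⁵ to clear denominators.
  summand : Carrier → (ℕ → Carrier) → ℕ → Carrier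
  summand q b k = τ q k * geom q (4 ℕ.* k ℕ.+ 1) * b k ^ 5

  cubicSum : Carrier → ℕ → (ℕ → Carrier) → Carrier
  cubicSum q N b = geom q (suc (N ℕ.+ N)) * (b 0 * b 0) * ∑ (suc N) (λ k → b k ^ 3 * (q * q) ^ k)

  -- The bound `m` stays free because the two congruences differ only in it: `suc (N ℕ.+ N)` for the
  -- full sum, `suc N` for the half sum.
  defect : Carrier → ℕ → (ℕ → Carrier) → ℕ → Carrier
  defect q N b m = q ^ N * ∑ m (summand q b) - cubicSum q N b

  module _ (q q' : Carrier) where

    Q Q' : Carrier
    Q = q * q
    Q' = q' * q'

    n d : ℕ → Carrier
    n = oddFactor q
    d = evenFactor q

    -- T k j = (q^(2k+1);q²)_j (q^(−2k);q²)_j, where q' is the inverse of q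
    F G T : ℕ → ℕ → Carrier
    F k j = ∏ j (λ i → 1# - q * (Q ^ k * Q ^ i))
    G k j = ∏ j (λ i → 1# - Q ^ i * Q' ^ k)
    T k j = F k j * G k j

    P : ℕ → Carrier
    P j = ∏ j n

    w : ℕ → Carrier
    w k = geom q (4 ℕ.* k ℕ.+ 1)

    w-closed : ∀ k → (1# - q) * w k ≈ 1# - q * (Q ^ k * Q ^ k)
    w-closed k = begin
      (1# - q) * w k              ≈⟨ geom-closed q (4 ℕ.* k ℕ.+ 1) ⟩
      1# - q ^ (4 ℕ.* k ℕ.+ 1)    ≈⟨ +-congˡ (-‿cong exponent) ⟩
      1# - q * (Q ^ k * Q ^ k)    ∎
      where
      exponent : q ^ (4 ℕ.* k ℕ.+ 1) ≈ q * (Q ^ k * Q ^ k)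
      exponent = begin
        q ^ (4 ℕ.* k ℕ.+ 1)              ≈⟨ ^-homo-* q (4 ℕ.* k) 1 ⟩
        q ^ (4 ℕ.* k) * q ^ 1            ≈⟨ *-congʳ (^-assocʳ q 4 k) ⟨
        (q ^ 4) ^ k * q ^ 1              ≈⟨ *-congʳ (^-congˡ k (solve 1 (λ q → q :^ 4 := (q :* q) :* (q :* q)) refl q)) ⟩
        (Q * Q) ^ k * q ^ 1              ≈⟨ *-congʳ (^-distrib-* Q Q k) ⟩
        (Q ^ k * Q ^ k) * q ^ 1          ≈⟨ solve 2 (λ q x → x :* (q :^ 1) := q :* x) refl q _ ⟩
        q * (Q ^ k * Q ^ k)              ∎

    -- Raising `k` removes the first factor of `F` and, by `G-head`, adds one in front of `G`;
    -- together they compare `T (suc k)` with `T k`.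
    F-head : ∀ k j → F k (suc j) ≈ n k * F (suc k) j
    F-head k j = trans (∏-head j _) (*-cong
      (solve 2 (λ q y → 1ᶜ :- q :* (y :* 1ᶜ) := 1ᶜ :- q :* y) refl q (Q ^ k))
      (∏-cong j λ i _ → solve 3 (λ q y x → 1ᶜ :- q :* (y :* (q :* q :* x)) := 1ᶜ :- q :* (q :* q :* y :* x))
        refl q (Q ^ k) (Q ^ i)))

    module _ (qq'≈1 : q * q' ≈ 1#) where

      Q^Q'^≈1 : ∀ k → Q ^ k * Q' ^ k ≈ 1#
      Q^Q'^≈1 zero = *-identityˡ 1#
      Q^Q'^≈1 (suc k) = begin
        (q * q) * Q ^ k * ((q' * q') * Q' ^ k)
          ≈⟨ solve 4 (λ q p a b → (q :* q) :* a :* ((p :* p) :* b) := (q :* p) :* ((q :* p) :* (a :* b))) refl q q' _ _ ⟩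
        (q * q') * ((q * q') * (Q ^ k * Q' ^ k))  ≈⟨ *-cong qq'≈1 (*-cong qq'≈1 (Q^Q'^≈1 k)) ⟩
        1# * (1# * 1#)                            ≈⟨ solve 0 (1ᶜ :* (1ᶜ :* 1ᶜ) := 1ᶜ) refl ⟩
        1#                                        ∎

      QQ'≈1 : Q * Q' ≈ 1#
      QQ'≈1 = trans (*-cong (sym (*-identityʳ Q)) (sym (*-identityʳ Q'))) (Q^Q'^≈1 1)

      -- The ring solver cannot use a relation z z' = 1. It proves instead an identity containing
      -- that relation times an explicit cofactor `r`, and the extra summand is dropped here.
      modulo : ∀ {z z' x y} r → z * z' ≈ 1# → x ≈ y + r * (z * z' - 1#) → x ≈ y
      modulo {z} {z'} {x} {y} r zz'≈1 x≈ = begin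
        x                           ≈⟨ x≈ ⟩
        y + r * (z * z' - 1#)       ≈⟨ +-congˡ (*-annihilates (x≈y⇒x-y≈0 zz'≈1)) ⟩
        y + 0#                      ≈⟨ +-identityʳ y ⟩
        y                           ∎

      G-head : ∀ k j → G (suc k) (suc j) ≈ (1# - Q' ^ suc k) * G k j
      G-head k j = trans (∏-head j _) (*-cong
        (solve 1 (λ x → 1ᶜ :- 1ᶜ :* x := 1ᶜ :- x) refl _)
        (∏-cong j λ i _ → modulo (- (Q ^ i * Q' ^ k)) QQ'≈1
          (solve 4 (λ s s' x x' → 1ᶜ :- (s :* x) :* (s' :* x') := (1ᶜ :- x :* x') :+ (:- (x :* x')) :* (s :* s' :- 1ᶜ))
             refl Q Q' (Q ^ i) (Q' ^ k))))

      1-Q'≈ : ∀ k → 1# - Q' ^ suc k ≈ - (Q' ^ suc k * d k)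
      1-Q'≈ k = modulo (- 1#) (Q^Q'^≈1 (suc k))
        (solve 2 (λ x x' → 1ᶜ :- x' := (:- (x' :* (1ᶜ :- x))) :+ (:- 1ᶜ) :* (x :* x' :- 1ᶜ)) refl (Q ^ suc k) (Q' ^ suc k))

      -- The factor with index `k` is 1 - Q^k Q'^k. This is what terminates the Chu-Vandermonde sum.
      G-zero : ∀ k j → k < j → G k j ≈ 0#
      G-zero k j k<j = ∏-zero j k k<j (trans (+-congˡ (-‿cong (Q^Q'^≈1 k))) (-‿inverseʳ 1#))

      T-zero : ∀ k j → k < j → T k j ≈ 0#
      T-zero k j k<j = *-annihilates (G-zero k j k<j)

      -- Both sides are `F k (suc j) * G (suc k) (suc j)`: the left by `F-head` and the last factor
      -- of `G`, the right by `G-head` and the last factor of `F`.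
      T-shift : ∀ k j → n k * (T (suc k) j * (1# - Q ^ j * Q' ^ suc k))
                        ≈ - (Q' ^ suc k * d k * (1# - q * (Q ^ k * Q ^ j)) * T k j)
      T-shift k j = begin
        n k * (F (suc k) j * G (suc k) j * (1# - Q ^ j * Q' ^ suc k))
          ≈⟨ solve 4 (λ a b c d → a :* (b :* c :* d) := (a :* b) :* (c :* d)) refl _ _ _ _ ⟩
        (n k * F (suc k) j) * G (suc k) (suc j)
          ≈⟨ *-cong (sym (F-head k j)) (trans (G-head k j) (*-congʳ (1-Q'≈ k))) ⟩
        F k (suc j) * (- (Q' ^ suc k * d k) * G k j)
          ≈⟨ solve 5 (λ f e x d g → (f :* e) :* ((:- (x :* d)) :* g) := :- (x :* d :* e :* (f :* g))) refl (F k j) _ _ _ (G k j) ⟩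
        - (Q' ^ suc k * d k * (1# - q * (Q ^ k * Q ^ j)) * T k j) ∎

      module _ (N : ℕ) where

        -- This is (q²;q²)_N / (q²;q²)_j and `Y` is (q²;q²)_N, so multiplication by `E j` replaces
        -- division by (q²;q²)_j.
        E : ℕ → Carrier
        E j = ∏ (N ∸ j) (λ i → d (j ℕ.+ i))

        Y : Carrier
        Y = E 0

        E-head : ∀ j → j < N → E j ≈ d j * E (suc j)
        E-head j j<N = begin
          ∏ (N ∸ j) (λ i → d (j ℕ.+ i))                        ≡⟨ ≡.cong (λ m → ∏ m (λ i → d (j ℕ.+ i))) (ℕ.+-∸-assoc 1 j<N) ⟩
          ∏ (suc (N ∸ suc j)) (λ i → d (j ℕ.+ i))              ≈⟨ ∏-head (N ∸ suc j) (λ i → d (j ℕ.+ i)) ⟩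
          d (j ℕ.+ 0) * ∏ (N ∸ suc j) (λ i → d (j ℕ.+ suc i))
            ≈⟨ *-cong (reflexive (≡.cong d (ℕ.+-identityʳ j))) (∏-cong (N ∸ suc j) λ i _ → reflexive (≡.cong d (ℕ.+-suc j i))) ⟩
          d j * E (suc j)                                      ∎

        E-N : E N ≈ 1#
        E-N = reflexive (≡.cong (λ m → ∏ m (λ i → d (N ℕ.+ i))) (ℕ.n∸n≡0 N))

        -- (q²;q²)_N² times the terminating q-Chu–Vandermonde sum whose value is τ q k (q;q²)_k/(q²;q²)_k
        U : ℕ → Carrier
        U k = ∑ (suc N) (λ j → T k j * (E j * E j) * Q ^ j)

        -- telescoping certificate for the recurrence of U in k
        K : ℕ → ℕ → Carrier
        K k zero = 0#
        K k (suc j) = (1# - q * Q * (Q ^ k * Q ^ k)) * (F (suc k) j * G k j) * (E j * E j)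

        K-step : ∀ k j → j < suc N →
                 (d k * T (suc k) j + Q ^ suc k * n k * T k j) * (E j * E j) * Q ^ j ≈ K k (suc j) - K k j
        K-step k zero _ = solve 3
          (λ q y e → ((1ᶜ :- q :* q :* y) :* (1ᶜ :* 1ᶜ) :+ (q :* q :* y) :* (1ᶜ :- q :* y) :* (1ᶜ :* 1ᶜ)) :* (e :* e) :* 1ᶜ
             := (1ᶜ :- q :* (q :* q) :* (y :* y)) :* (1ᶜ :* 1ᶜ) :* (e :* e) :- con (+ 0))
          refl q (Q ^ k) (E 0)
        K-step k (suc i) 1+i<1+N = begin
          (d k * T (suc k) (suc i) + Q ^ suc k * n k * T k (suc i)) * (E' * E') * Q ^ suc i
            -- All inverse powers are expressed through z = Q'^(k+1), so the single relation (Q y) z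
            -- = 1 is enough for the next step.
            ≈⟨ *-congʳ (*-congʳ (+-cong (*-congˡ (*-congˡ (G-head k i))) (*-congˡ (*-cong (F-head k i) (*-congˡ (+-congˡ (-‿cong (*-congˡ y'≈)))))))) ⟩
          (d k * ((f * (1# - q * (Q * y * x))) * ((1# - z) * g)) + Q * y * n k * ((n k * f) * (g * (1# - x * (Q * z))))) * (E' * E') * (Q * x)
            ≈⟨ modulo (f * g * (E' * E') * (Q * x * n k * (1# - Q * x))) (Q^Q'^≈1 (suc k)) (solve 7
                (λ q y x z f g e → let Q = q :* q ; n = 1ᶜ :- q :* y ; d = 1ᶜ :- Q :* y in
                   (d :* ((f :* (1ᶜ :- q :* (Q :* y :* x))) :* ((1ᶜ :- z) :* g)) :+ Q :* y :* n :* ((n :* f) :* (g :* (1ᶜ :- x :* (Q :* z))))) :* (e :* e) :* (Q :* x)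
                   := ((1ᶜ :- q :* Q :* (y :* y)) :* ((f :* (1ᶜ :- q :* (Q :* y :* x))) :* (g :* (1ᶜ :- x :* (Q :* z)))) :* (e :* e)
                       :- (1ᶜ :- q :* Q :* (y :* y)) :* (f :* g) :* (((1ᶜ :- Q :* x) :* e) :* ((1ᶜ :- Q :* x) :* e)))
                      :+ (f :* g :* (e :* e) :* (Q :* x :* n :* (1ᶜ :- Q :* x))) :* ((Q :* y) :* z :- 1ᶜ))
                refl q y x z f g E') ⟩
          (1# - q * Q * (y * y)) * ((f * (1# - q * (Q * y * x))) * (g * (1# - x * (Q * z)))) * (E' * E')
            - (1# - q * Q * (y * y)) * (f * g) * ((d i * E') * (d i * E'))
            ≈⟨ +-cong (*-congʳ (*-congˡ (*-congˡ (*-congˡ (+-congˡ (-‿cong (*-congˡ (sym y'≈))))))))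
                      (-‿cong (*-congˡ (*-cong (sym E≈) (sym E≈)))) ⟩
          K k (suc (suc i)) - K k (suc i) ∎
          where
          y = Q ^ k ; x = Q ^ i ; z = Q' ^ suc k ; f = F (suc k) i ; g = G k i ; E' = E (suc i)
          E≈ : E i ≈ d i * E'
          E≈ = E-head i (ℕ.s<s⁻¹ 1+i<1+N)
          y'≈ : Q' ^ k ≈ Q * z
          y'≈ = sym (trans (sym (*-assoc Q Q' _)) (trans (*-congʳ QQ'≈1) (*-identityˡ _)))

        -- Creative telescoping in `j`. The boundary term `K k (suc N)` contains `G k N`, which
        -- vanishes for k < N, so the cut of the summation at `N` leaves no trace.
        U-step : ∀ k → k < N → d k * U (suc k) ≈ - (Q ^ suc k * n k * U k)
        U-step k k<N = x-y≈0⇒x≈y _ _ (begin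
          d k * U (suc k) - - (Q ^ suc k * n k * U k)
            ≈⟨ solve 4 (λ a b c e → a :* b :- (:- (c :* e)) := a :* b :+ c :* e) refl (d k) (U (suc k)) (Q ^ suc k * n k) (U k) ⟩
          d k * U (suc k) + Q ^ suc k * n k * U k
            ≈⟨ +-cong (∑-*ˡ (suc N) _ _) (∑-*ˡ (suc N) _ _) ⟩
          ∑ (suc N) (λ j → d k * (T (suc k) j * (E j * E j) * Q ^ j)) + ∑ (suc N) (λ j → Q ^ suc k * n k * (T k j * (E j * E j) * Q ^ j))
            ≈⟨ ∑-+ (suc N) _ _ ⟨
          ∑ (suc N) (λ j → d k * (T (suc k) j * (E j * E j) * Q ^ j) + Q ^ suc k * n k * (T k j * (E j * E j) * Q ^ j))
            ≈⟨ ∑-cong (suc N) (λ j j<1+N → trans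
                 (solve 6 (λ a t c u e x → a :* (t :* e :* x) :+ c :* (u :* e :* x) := (a :* t :+ c :* u) :* e :* x) refl
                   (d k) (T (suc k) j) (Q ^ suc k * n k) (T k j) (E j * E j) (Q ^ j))
                 (K-step k j j<1+N)) ⟩
          ∑ (suc N) (λ j → K k (suc j) - K k j)    ≈⟨ ∑-telescope (suc N) (K k) ⟩
          K k (suc N) - 0#                         ≈⟨ +-cong (trans (*-congʳ (*-annihilates (*-annihilates (G-zero k N k<N)))) (zeroˡ _)) -0#≈0# ⟩
          0# + 0#                                  ≈⟨ +-identityˡ 0# ⟩
          0#                                       ∎)

        U-0 : U 0 ≈ Y * Y
        U-0 = begin
          U 0                                                              ≈⟨ ∑-head N _ ⟩
          (1# * 1#) * (Y * Y) * 1# + ∑ N (λ j → T 0 (suc j) * (E (suc j) * E (suc j)) * Q ^ suc j)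
            ≈⟨ +-cong (solve 1 (λ y → (1ᶜ :* 1ᶜ) :* y :* 1ᶜ := y) refl (Y * Y))
                 (∑-zero N λ j _ → trans (*-congʳ (trans (*-congʳ (T-zero 0 (suc j) (s≤s z≤n))) (zeroˡ _))) (zeroˡ _)) ⟩
          Y * Y + 0#                                                       ≈⟨ +-identityʳ _ ⟩
          Y * Y                                                            ∎

        module _ (b : ℕ → Carrier) (b-rec : ∀ k → k < N → d k * b (suc k) ≈ n k * b k)
                 (d-regular : ∀ k → k < N → Regular (d k)) where

          -- Both sides satisfy the same first-order recurrence in `k`, agree at 0, and `d k` can be
          -- cancelled.
          chuVandermonde : ∀ k → k ≤ N → b k * τ q k * (Y * Y) ≈ b 0 * U k
          chuVandermonde zero _ = *-cong (*-identityʳ (b 0)) (sym U-0)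
          chuVandermonde (suc k) k<N = Regular-cancel (d-regular k k<N) (begin
            d k * (b (suc k) * - (Q ^ suc k * τ q k) * (Y * Y))
              ≈⟨ solve 5 (λ d b x t y → d :* (b :* (:- (x :* t)) :* y) := :- (x :* (d :* b) :* t :* y)) refl _ _ _ _ _ ⟩
            - (Q ^ suc k * (d k * b (suc k)) * τ q k * (Y * Y))   ≈⟨ -‿cong (*-congʳ (*-congʳ (*-congˡ (b-rec k k<N)))) ⟩
            - (Q ^ suc k * (n k * b k) * τ q k * (Y * Y))
              ≈⟨ solve 5 (λ d b x t y → :- (x :* (d :* b) :* t :* y) := :- (x :* d :* (b :* t :* y))) refl _ _ _ _ _ ⟩
            - (Q ^ suc k * n k * (b k * τ q k * (Y * Y)))         ≈⟨ -‿cong (*-congˡ (chuVandermonde k (ℕ.<⇒≤ k<N))) ⟩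
            - (Q ^ suc k * n k * (b 0 * U k))
              ≈⟨ solve 3 (λ x b u → :- (x :* (b :* u)) := b :* (:- (x :* u))) refl _ _ _ ⟩
            b 0 * - (Q ^ suc k * n k * U k)                       ≈⟨ *-congˡ (U-step k k<N) ⟨
            b 0 * (d k * U (suc k))
              ≈⟨ solve 3 (λ d b u → b :* (d :* u) := d :* (b :* u)) refl _ _ _ ⟩
            d k * (b 0 * U (suc k))                               ∎)

          -- The division-free form of b_j = b_0 (q;q²)_j / (q²;q²)_j.
          PEb : ∀ j → j ≤ N → P j * E j * b 0 ≈ Y * b j
          PEb zero _ = *-congʳ (*-identityˡ Y)
          PEb (suc j) j<N = Regular-cancel (d-regular j j<N) (begin
            d j * (P j * n j * E (suc j) * b 0)
              ≈⟨ solve 5 (λ d p n e b → d :* (p :* n :* e :* b) := n :* (p :* (d :* e) :* b)) refl _ _ _ _ _ ⟩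
            n j * (P j * (d j * E (suc j)) * b 0)  ≈⟨ *-congˡ (*-congʳ (*-congˡ (E-head j j<N))) ⟨
            n j * (P j * E j * b 0)                ≈⟨ *-congˡ (PEb j (ℕ.<⇒≤ j<N)) ⟩
            n j * (Y * b j)                        ≈⟨ solve 3 (λ n y b → n :* (y :* b) := y :* (n :* b)) refl _ _ _ ⟩
            Y * (n j * b j)                        ≈⟨ *-congˡ (b-rec j j<N) ⟨
            Y * (d j * b (suc j))                  ≈⟨ solve 3 (λ n y b → y :* (n :* b) := n :* (y :* b)) refl _ _ _ ⟩
            d j * (Y * b (suc j))                  ∎)

          I : ℕ → Carrier
          I j = ∑ (suc N) (λ k → w k * b k ^ 4 * T k j)

          -- telescoping certificate for the recurrence of I in j
          H : ℕ → ℕ → Carrier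
          H j zero = 0#
          H j (suc k) = - (Q ^ j * Q' ^ k * b k ^ 4 * n k ^ 3 * (1# - q * (Q ^ k * Q ^ j)) * T k j)

          -- The definition of `H j (suc k)` refers to index `k`, so that its value at `suc N`
          -- exhibits `n N ^ 3` and does not involve `b (suc N)`. The form here refers to the
          -- argument of `H` itself, which makes `H-step` an identity in one index. Passing from b
          -- (suc k) ^ 4 to b k ^ 4 yields four factors `n k`, one of which `T-shift` consumes. At k
          -- = 0 the factor (1 - Q⁰)³ is zero.
          H-value : ∀ j k → k ≤ N → H j k ≈ Q * Q ^ j * b k ^ 4 * (1# - Q ^ k) ^ 3 * (1# - Q ^ j * Q' ^ k) * T k j
          H-value j zero _ = solve 5 (λ a b c d e → con (+ 0) := a :* b :* c :* (1ᶜ :- 1ᶜ) :^ 3 :* d :* e) refl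
            Q (Q ^ j) (b 0 ^ 4) (1# - Q ^ j * Q' ^ 0) (T 0 j)
          H-value j (suc k) k<N = sym (begin
            Q * x * B ^ 4 * D ^ 3 * γ * T₁
              ≈⟨ solve 6 (λ Q x B D c t → Q :* x :* B :^ 4 :* D :^ 3 :* c :* t := Q :* x :* (D :* B) :^ 3 :* B :* (t :* c)) refl Q x B D γ T₁ ⟩
            Q * x * (D * B) ^ 3 * B * (T₁ * γ)
              ≈⟨ *-congʳ (*-congʳ (*-congˡ (^-congˡ 3 (b-rec k k<N)))) ⟩
            Q * x * (M * β) ^ 3 * B * (T₁ * γ)
              ≈⟨ solve 6 (λ Q x B M β u → Q :* x :* (M :* β) :^ 3 :* B :* u := Q :* x :* (M :^ 2 :* β :^ 3) :* B :* (M :* u)) refl Q x B M β (T₁ * γ) ⟩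
            Q * x * (M ^ 2 * β ^ 3) * B * (M * (T₁ * γ))
              ≈⟨ *-congˡ (T-shift k j) ⟩
            Q * x * (M ^ 2 * β ^ 3) * B * - ((Q' * y') * D * e * T₀)
              ≈⟨ solve 10 (λ Q x M β B Q' y' D e t → Q :* x :* (M :^ 2 :* β :^ 3) :* B :* (:- ((Q' :* y') :* D :* e :* t))
                                                   := (Q :* Q') :* (:- (x :* y' :* (D :* B) :* (M :^ 2 :* β :^ 3) :* e :* t)))
                   refl Q x M β B Q' y' D e T₀ ⟩
            (Q * Q') * - (x * y' * (D * B) * (M ^ 2 * β ^ 3) * e * T₀)
              ≈⟨ *-cong QQ'≈1 (-‿cong (*-congʳ (*-congʳ (*-congʳ (*-congˡ (b-rec k k<N)))))) ⟩
            1# * - (x * y' * (M * β) * (M ^ 2 * β ^ 3) * e * T₀)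
              ≈⟨ solve 6 (λ x y' M β e t → 1ᶜ :* (:- (x :* y' :* (M :* β) :* (M :^ 2 :* β :^ 3) :* e :* t)) := :- (x :* y' :* β :^ 4 :* M :^ 3 :* e :* t))
                   refl x y' M β e T₀ ⟩
            - (x * y' * β ^ 4 * M ^ 3 * e * T₀) ∎)
            where
            x = Q ^ j ; y' = Q' ^ k ; B = b (suc k) ; β = b k ; D = d k ; M = n k
            γ = 1# - Q ^ j * Q' ^ suc k ; e = 1# - q * (Q ^ k * Q ^ j) ; T₀ = T k j ; T₁ = T (suc k) j

          -- The factor 1 - q turns `w k` into 1 - q^(4k+1). Up to the common factor
          -- `b k ^ 4 * T k j` there remains a polynomial identity in q, x, y and y' modulo y y' =
          -- 1.
          H-step : ∀ j k → k ≤ N →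
                   (1# - q) * (d j * (w k * b k ^ 4 * T k (suc j)) - n j ^ 3 * (w k * b k ^ 4 * T k j)) ≈ H j (suc k) - H j k
          H-step j k k≤N = begin
            (1# - q) * (d j * (w k * B * T k (suc j)) - n j ^ 3 * (w k * B * T k j))
              ≈⟨ solve 9 (λ s d w B f e g c n → s :* (d :* (w :* B :* ((f :* e) :* (g :* c))) :- n :* (w :* B :* (f :* g)))
                                           := (s :* w) :* (B :* (f :* g) :* (d :* e :* c :- n)))
                   refl (1# - q) (d j) (w k) B (F k j) (1# - q * (y * x)) (G k j) (1# - x * y') (n j ^ 3) ⟩
            ((1# - q) * w k) * (B * T k j * (d j * (1# - q * (y * x)) * (1# - x * y') - n j ^ 3))
              ≈⟨ *-congʳ (w-closed k) ⟩
            (1# - q * (y * y)) * (B * T k j * (d j * (1# - q * (y * x)) * (1# - x * y') - n j ^ 3))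
              ≈⟨ modulo (- (B * T k j * x * cofactor)) (Q^Q'^≈1 k) (solve 6
                   (λ q x y z B t → let Q = q :* q ; r = con (+ 3) :* Q :* y :- con (+ 3) :* q :- q :* Q :* (y :* y) in
                      (1ᶜ :- q :* (y :* y)) :* (B :* t :* ((1ᶜ :- Q :* x) :* (1ᶜ :- q :* (y :* x)) :* (1ᶜ :- x :* z) :- (1ᶜ :- q :* x) :^ 3))
                      := ((:- (x :* z :* B :* (1ᶜ :- q :* y) :^ 3 :* (1ᶜ :- q :* (y :* x)) :* t))
                          :- (Q :* x :* B :* (1ᶜ :- y) :^ 3 :* (1ᶜ :- x :* z) :* t))
                         :+ (:- (B :* t :* x :* ((1ᶜ :- Q :* x) :* (Q :* x :* (y :* y) :- q :* x :- q :* y)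
                             :- (r :- q :* x :- q :* x :* y :* r) :+ Q :* x :* (con (+ 3) :* y :- con (+ 3) :- y :* y)))) :* (y :* z :- 1ᶜ))
                   refl q x y y' B (T k j)) ⟩
            - (x * y' * B * n k ^ 3 * (1# - q * (y * x)) * T k j) - Q * x * B * (1# - y) ^ 3 * (1# - x * y') * T k j
              ≈⟨ +-congˡ (-‿cong (H-value j k k≤N)) ⟨
            H j (suc k) - H j k ∎
            where
            x = Q ^ j ; y = Q ^ k ; y' = Q' ^ k ; B = b k ^ 4
            -- Chosen so that (1 - q y)³ = 1 + y r; in the same way (1 - y)³ = 1 + y (3y - 3 - y²),
            -- which explains the last bracket of `cofactor`.
            r = ⟦ + 3 ⟧ℤ * Q * y - ⟦ + 3 ⟧ℤ * q - q * Q * (y * y)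
            cofactor = (1# - Q * x) * (Q * x * (y * y) - q * x - q * y)
                       - (r - q * x - q * x * y * r) + Q * x * (⟦ + 3 ⟧ℤ * y - ⟦ + 3 ⟧ℤ - y * y)

          module _ (n-regular : ∀ k → k < N → Regular (n k)) (1-q-regular : Regular (1# - q))
                   (nN³≈0 : n N ^ 3 ≈ 0#) where

            I-step : ∀ j → d j * I (suc j) ≈ n j ^ 3 * I j
            I-step j = x-y≈0⇒x≈y _ _ (1-q-regular _ (begin
              (1# - q) * (d j * I (suc j) - n j ^ 3 * I j)
                ≈⟨ *-congˡ (+-cong (∑-*ˡ (suc N) _ _) (trans (-‿distribˡ-* _ _) (∑-*ˡ (suc N) _ _))) ⟩
              (1# - q) * (∑ (suc N) (λ k → d j * (w k * b k ^ 4 * T k (suc j))) + ∑ (suc N) (λ k → - n j ^ 3 * (w k * b k ^ 4 * T k j)))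
                ≈⟨ *-congˡ (∑-+ (suc N) _ _) ⟨
              (1# - q) * ∑ (suc N) (λ k → d j * (w k * b k ^ 4 * T k (suc j)) + - n j ^ 3 * (w k * b k ^ 4 * T k j))
                ≈⟨ ∑-*ˡ (suc N) _ _ ⟩
              ∑ (suc N) (λ k → (1# - q) * (d j * (w k * b k ^ 4 * T k (suc j)) + - n j ^ 3 * (w k * b k ^ 4 * T k j)))
                ≈⟨ ∑-cong (suc N) (λ k k<1+N → trans (*-congˡ (+-congˡ (sym (-‿distribˡ-* _ _)))) (H-step j k (ℕ.s≤s⁻¹ k<1+N))) ⟩
              ∑ (suc N) (λ k → H j (suc k) - H j k)   ≈⟨ ∑-telescope (suc N) (H j) ⟩
              H j (suc N) - 0#
                ≈⟨ +-cong (trans (-‿cong (trans (*-congʳ (trans (*-congʳ (*-annihilates nN³≈0)) (zeroˡ _))) (zeroˡ _))) -0#≈0#) -0#≈0# ⟩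
              0# + 0#                                 ≈⟨ +-identityˡ 0# ⟩
              0#                                      ∎))

            Y-regular : Regular Y
            Y-regular = Regular-∏ N d-regular

            p : Carrier
            p = q * Q ^ N

            Q^[N∸1+i]≈ : ∀ i → i < N → Q ^ (N ∸ suc i) ≈ Q ^ N * Q' ^ suc i
            Q^[N∸1+i]≈ i i<N = begin
              Q ^ (N ∸ suc i)                                ≈⟨ *-identityʳ _ ⟨
              Q ^ (N ∸ suc i) * 1#                           ≈⟨ *-congˡ (Q^Q'^≈1 (suc i)) ⟨
              Q ^ (N ∸ suc i) * (Q ^ suc i * Q' ^ suc i)     ≈⟨ *-assoc _ _ _ ⟨
              Q ^ (N ∸ suc i) * Q ^ suc i * Q' ^ suc i       ≈⟨ *-congʳ (^-homo-* Q (N ∸ suc i) (suc i)) ⟨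
              Q ^ (N ∸ suc i ℕ.+ suc i) * Q' ^ suc i         ≡⟨ ≡.cong (λ m → Q ^ m * Q' ^ suc i) (ℕ.m∸n+n≡m i<N) ⟩
              Q ^ N * Q' ^ suc i                             ∎

            -- With c = 2(i + 1) the reversed factors are 1 - q^(n-c). They are to be paired with
            -- the factors 1 - q^(n+c) of `F (suc N) N`.
            P-reverse : P N ≈ ∏ N (λ i → 1# - p * Q' ^ suc i)
            P-reverse = trans (∏-reverse N n)
              (∏-cong N λ i i<N → +-congˡ (-‿cong (trans (*-congˡ (Q^[N∸1+i]≈ i i<N)) (sym (*-assoc _ _ _)))))

            G-reverse : G N N ≈ ∏ N (λ i → 1# - Q' ^ suc i)
            G-reverse = trans (∏-reverse N _) (∏-cong N λ i i<N → +-congˡ (-‿cong (begin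
              Q ^ (N ∸ suc i) * Q' ^ N            ≈⟨ *-congʳ (Q^[N∸1+i]≈ i i<N) ⟩
              Q ^ N * Q' ^ suc i * Q' ^ N
                ≈⟨ solve 3 (λ a b c → a :* b :* c := (a :* c) :* b) refl _ _ _ ⟩
              Q ^ N * Q' ^ N * Q' ^ suc i         ≈⟨ *-congʳ (Q^Q'^≈1 N) ⟩
              1# * Q' ^ suc i                     ≈⟨ *-identityˡ _ ⟩
              Q' ^ suc i                          ∎)))

            -- (1 − q^(c+n))(1 − q^(c−n)) ≡ (1 − q^c)² modulo (1 − q^n)²
            paired-factor : ∀ i → n N * ((1# - p * Q' ^ suc i) * (1# - q * (Q ^ suc N * Q ^ i)) * (1# - Q' ^ suc i))
                                  ≈ n N * (p * (Q' ^ suc i * Q' ^ suc i) * (d i * (d i * d i)))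
            paired-factor i = begin
              n N * ((1# - p * v') * (1# - q * (Q ^ suc N * Q ^ i)) * (1# - v'))
                ≈⟨ *-congˡ (*-cong (*-congˡ (+-congˡ (-‿cong
                     (solve 4 (λ q Q y x → q :* ((Q :* y) :* x) := q :* y :* (Q :* x)) refl q Q (Q ^ N) (Q ^ i))))) (1-Q'≈ i)) ⟩
              n N * ((1# - p * v') * (1# - p * v) * - (v' * d i))
                ≈⟨ modulo (- ((1# - p) * (p * p - ⟦ + 2 ⟧ℤ * p + p * v) * v' * (1# - v))) (Q^Q'^≈1 (suc i))
                     (solve 3 (λ p v v' →
                        (1ᶜ :- p) :* ((1ᶜ :- p :* v') :* (1ᶜ :- p :* v) :* (:- (v' :* (1ᶜ :- v))))
                        := ((1ᶜ :- p) :* (p :* (v' :* v') :* ((1ᶜ :- v) :* ((1ᶜ :- v) :* (1ᶜ :- v))))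
                             :- (1ᶜ :- p) :^ 3 :* (v' :* (1ᶜ :- v)))
                           :+ (:- ((1ᶜ :- p) :* (p :* p :- con (+ 2) :* p :+ p :* v) :* v' :* (1ᶜ :- v))) :* (v :* v' :- 1ᶜ)) refl p v v') ⟩
              n N * (p * (v' * v') * (d i * (d i * d i))) - n N ^ 3 * (v' * d i)
                ≈⟨ +-congˡ (trans (-‿cong (trans (*-congʳ nN³≈0) (zeroˡ _))) -0#≈0#) ⟩
              n N * (p * (v' * v') * (d i * (d i * d i))) + 0#
                ≈⟨ +-identityʳ _ ⟩
              n N * (p * (v' * v') * (d i * (d i * d i))) ∎
              where v = Q ^ suc i ; v' = Q' ^ suc i

            ∏pQ' : ∀ m → ∏ m (λ i → p * (Q' ^ suc i * Q' ^ suc i)) ≈ (p * Q' ^ suc m) ^ m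
            ∏pQ' zero = refl
            ∏pQ' (suc m) = begin
              ∏ m (λ i → p * (Q' ^ suc i * Q' ^ suc i)) * (p * (v * v))  ≈⟨ *-congʳ (∏pQ' m) ⟩
              (p * v) ^ m * (p * (v * v))
                ≈⟨ solve 3 (λ z p v → z :* (p :* (v :* v)) := (p :* v :* z) :* v) refl ((p * v) ^ m) p v ⟩
              (p * v) ^ suc m * v                                        ≈⟨ ^-distrib-* (p * v) Q' (suc m) ⟨
              (p * v * Q') ^ suc m
                ≈⟨ ^-congˡ (suc m) (solve 3 (λ p v s → p :* v :* s := p :* (s :* v)) refl p v Q') ⟩
              (p * (Q' * v)) ^ suc m                                     ∎
              where v = Q' ^ suc m

            -- This is the base of the power in `∏pQ'` at m = N. The resulting `q' ^ N` is where the
            -- factor q^((1-n)/2) of the theorem comes from.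
            pQ'^≈q' : p * Q' ^ suc N ≈ q'
            pQ'^≈q' = begin
              q * Q ^ N * (q' * q' * Q' ^ N)
                ≈⟨ solve 4 (λ q q' x x' → q :* x :* (q' :* q' :* x') := (q :* q') :* (x :* x') :* q') refl q q' (Q ^ N) (Q' ^ N) ⟩
              (q * q') * (Q ^ N * Q' ^ N) * q'  ≈⟨ *-congʳ (*-cong qq'≈1 (Q^Q'^≈1 N)) ⟩
              1# * 1# * q'                      ≈⟨ solve 1 (λ x → 1ᶜ :* 1ᶜ :* x := x) refl q' ⟩
              q'                                ∎

            -- The factor 1 - q^(4N+1) completes `F N N` to `F N (suc N)`, from which `F-head`
            -- extracts `n N`. In the presence of this factor the paired factors need to agree only
            -- modulo (1 - qⁿ)², and `∏-congˡ-*` replaces them all.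
            last-term : (1# - q * (Q ^ N * Q ^ N)) * (P N * T N N) ≈ n N * (q' ^ N * (Y * (Y * Y)))
            last-term = begin
              (1# - q * (Q ^ N * Q ^ N)) * (P N * (F N N * G N N))
                ≈⟨ solve 4 (λ a b c e → a :* (b :* (c :* e)) := b :* (c :* a) :* e) refl _ _ _ _ ⟩
              P N * F N (suc N) * G N N                       ≈⟨ *-congʳ (*-congˡ (F-head N N)) ⟩
              P N * (n N * F (suc N) N) * G N N
                ≈⟨ solve 4 (λ a b c e → a :* (b :* c) :* e := b :* (a :* c :* e)) refl _ _ _ _ ⟩
              n N * (P N * F (suc N) N * G N N)               ≈⟨ *-congˡ (*-cong (*-congʳ P-reverse) G-reverse) ⟩
              n N * (∏ N (λ i → 1# - p * Q' ^ suc i) * ∏ N (λ i → 1# - q * (Q ^ suc N * Q ^ i)) * ∏ N (λ i → 1# - Q' ^ suc i))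
                ≈⟨ *-congˡ (trans (∏-* N _ _) (*-congʳ (∏-* N _ _))) ⟨
              n N * ∏ N (λ i → (1# - p * Q' ^ suc i) * (1# - q * (Q ^ suc N * Q ^ i)) * (1# - Q' ^ suc i))
                ≈⟨ ∏-congˡ-* (n N) N (λ i _ → paired-factor i) ⟩
              n N * ∏ N (λ i → p * (Q' ^ suc i * Q' ^ suc i) * (d i * (d i * d i)))
                ≈⟨ *-congˡ (trans (∏-* N _ _) (*-cong (∏pQ' N) (trans (∏-* N _ _) (*-congˡ (∏-* N _ _))))) ⟩
              n N * ((p * Q' ^ suc N) ^ N * (Y * (Y * Y)))    ≈⟨ *-congˡ (*-congʳ (^-congˡ N pQ'^≈q')) ⟩
              n N * (q' ^ N * (Y * (Y * Y)))                  ∎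

            [n] : Carrier
            [n] = geom q (suc (N ℕ.+ N))

            [n]-closed : (1# - q) * [n] ≈ n N
            [n]-closed = trans (geom-closed q (suc (N ℕ.+ N)))
              (+-congˡ (-‿cong (*-congˡ (trans (^-homo-* q N N) (sym (^-distrib-* q q N))))))

            -- Only the term k = N survives. Three of its four factors `b N` are traded for
            -- `P N * b 0` at the cost of Y³; one `P N` goes into `last-term`, which returns Y³, and
            -- the other two remain.
            I-N : I N ≈ [n] * q' ^ N * b 0 ^ 3 * (b N * (P N * P N))
            I-N = trans (trans (+-congʳ (∑-zero N λ k k<N → *-annihilates (T-zero k N k<N))) (+-identityˡ _))
              (Regular-cancel (Regular-* 1-q-regular (Regular-^ 3 Y-regular)) (begin
                (1# - q) * Y ^ 3 * (w N * b N ^ 4 * T N N)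
                  ≈⟨ solve 5 (λ s y w b t → s :* y :^ 3 :* (w :* b :^ 4 :* t) := (s :* w) :* (y :* b) :^ 3 :* b :* t) refl _ _ _ _ _ ⟩
                ((1# - q) * w N) * (Y * b N) ^ 3 * b N * T N N
                  ≈⟨ *-congʳ (*-congʳ (*-cong (w-closed N) (^-congˡ 3 (sym (PEb N ℕ.≤-refl))))) ⟩
                (1# - q * (Q ^ N * Q ^ N)) * (P N * E N * b 0) ^ 3 * b N * T N N
                  ≈⟨ *-congʳ (*-congʳ (*-congˡ (^-congˡ 3 (*-congʳ (trans (*-congˡ E-N) (*-identityʳ _)))))) ⟩
                (1# - q * (Q ^ N * Q ^ N)) * (P N * b 0) ^ 3 * b N * T N N
                  ≈⟨ solve 5 (λ e p b c t → e :* (p :* b) :^ 3 :* c :* t := e :* (p :* t) :* (b :^ 3 :* (c :* (p :* p)))) refl _ _ _ _ _ ⟩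
                (1# - q * (Q ^ N * Q ^ N)) * (P N * T N N) * (b 0 ^ 3 * (b N * (P N * P N)))
                  ≈⟨ *-congʳ (trans last-term (*-congʳ (sym [n]-closed))) ⟩
                (1# - q) * [n] * (q' ^ N * (Y * (Y * Y))) * (b 0 ^ 3 * (b N * (P N * P N)))
                  ≈⟨ solve 6 (λ s m x y b r → s :* m :* (x :* (y :* (y :* y))) :* (b :* r) := s :* y :^ 3 :* (m :* x :* b :* r)) refl _ _ _ _ _ _ ⟩
                (1# - q) * Y ^ 3 * ([n] * q' ^ N * b 0 ^ 3 * (b N * (P N * P N))) ∎))

            -- The recurrence `I-step` is run downwards from `N`, cancelling `n j ^ 3` each time;
            -- `m` is the distance to `N`.
            I-closed : ∀ m j → j ℕ.+ m ≡ N → I j ≈ [n] * q' ^ N * b 0 ^ 3 * (b j * (P j * P j))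
            I-closed zero j j+0≡N rewrite ≡.trans (≡.sym (ℕ.+-identityʳ j)) j+0≡N = I-N
            I-closed (suc m) j j+1+m≡N = Regular-cancel (Regular-^ 3 (n-regular j j<N)) (begin
              n j ^ 3 * I j                                    ≈⟨ I-step j ⟨
              d j * I (suc j)                                  ≈⟨ *-congˡ (I-closed m (suc j) (≡.trans (≡.sym (ℕ.+-suc j m)) j+1+m≡N)) ⟩
              d j * (Ω * (b (suc j) * ((P j * n j) * (P j * n j))))
                ≈⟨ solve 5 (λ d o b p n → d :* (o :* (b :* ((p :* n) :* (p :* n)))) := o :* (d :* b) :* (p :* p :* (n :* n))) refl _ _ _ _ _ ⟩
              Ω * (d j * b (suc j)) * (P j * P j * (n j * n j))  ≈⟨ *-congʳ (*-congˡ (b-rec j j<N)) ⟩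
              Ω * (n j * b j) * (P j * P j * (n j * n j))
                ≈⟨ solve 4 (λ o n b p → o :* (n :* b) :* (p :* p :* (n :* n)) := n :^ 3 :* (o :* (b :* (p :* p)))) refl _ _ _ _ ⟩
              n j ^ 3 * (Ω * (b j * (P j * P j)))              ∎)
              where
              Ω = [n] * q' ^ N * b 0 ^ 3
              j<N : j < N
              j<N = ≡.subst (j <_) j+1+m≡N (ℕ.m<m+n j (s≤s z≤n))

            quintuple-sum : q ^ N * ∑ (suc N) (summand q b) ≈ [n] * (b 0 * b 0) * ∑ (suc N) (λ k → b k ^ 3 * Q ^ k)
            quintuple-sum = Regular-cancel (Regular-* Y-regular Y-regular) (begin
              Y * Y * (q ^ N * ∑ (suc N) (summand q b))
                ≈⟨ solve 3 (λ y x s → y :* (x :* s) := x :* (y :* s)) refl _ _ _ ⟩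
              q ^ N * (Y * Y * ∑ (suc N) (summand q b))
                ≈⟨ *-congˡ (trans (∑-*ˡ (suc N) _ _) (∑-cong (suc N) λ k k<1+N → expand k (ℕ.s≤s⁻¹ k<1+N))) ⟩
              q ^ N * ∑ (suc N) (λ k → ∑ (suc N) (λ j → b 0 * ((E j * E j) * Q ^ j) * (w k * b k ^ 4 * T k j)))
                ≈⟨ *-congˡ (∑-swap (suc N) (suc N) _) ⟩
              q ^ N * ∑ (suc N) (λ j → ∑ (suc N) (λ k → b 0 * ((E j * E j) * Q ^ j) * (w k * b k ^ 4 * T k j)))
                ≈⟨ *-congˡ (∑-cong (suc N) λ j j<1+N → trans (sym (∑-*ˡ (suc N) _ _)) (collect j (ℕ.s≤s⁻¹ j<1+N))) ⟩
              q ^ N * ∑ (suc N) (λ j → Y * Y * q' ^ N * ([n] * (b 0 * b 0)) * (b j ^ 3 * Q ^ j))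
                ≈⟨ *-congˡ (∑-*ˡ (suc N) _ _) ⟨
              q ^ N * (Y * Y * q' ^ N * ([n] * (b 0 * b 0)) * ∑ (suc N) (λ j → b j ^ 3 * Q ^ j))
                ≈⟨ solve 5 (λ x y z m s → x :* (y :* z :* m :* s) := (x :* z) :* (y :* (m :* s))) refl _ _ _ _ _ ⟩
              (q ^ N * q' ^ N) * (Y * Y * ([n] * (b 0 * b 0) * ∑ (suc N) (λ j → b j ^ 3 * Q ^ j)))
                ≈⟨ *-congʳ (trans (sym (^-distrib-* q q' N)) (trans (^-congˡ N qq'≈1) (1^ N))) ⟩
              1# * (Y * Y * ([n] * (b 0 * b 0) * ∑ (suc N) (λ j → b j ^ 3 * Q ^ j)))   ≈⟨ *-identityˡ _ ⟩
              Y * Y * ([n] * (b 0 * b 0) * ∑ (suc N) (λ j → b j ^ 3 * Q ^ j))          ∎)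
              where
              1^ : ∀ m → 1# ^ m ≈ 1#
              1^ zero = refl
              1^ (suc m) = trans (*-identityˡ _) (1^ m)

              expand : ∀ k → k ≤ N → Y * Y * summand q b k ≈ ∑ (suc N) (λ j → b 0 * ((E j * E j) * Q ^ j) * (w k * b k ^ 4 * T k j))
              expand k k≤N = begin
                Y * Y * (τ q k * w k * b k ^ 5)
                  ≈⟨ solve 4 (λ y t w b → y :* (t :* w :* b :^ 5) := w :* b :^ 4 :* (b :* t :* y)) refl (Y * Y) (τ q k) (w k) (b k) ⟩
                w k * b k ^ 4 * (b k * τ q k * (Y * Y))   ≈⟨ *-congˡ (chuVandermonde k k≤N) ⟩
                w k * b k ^ 4 * (b 0 * U k)               ≈⟨ *-assoc _ _ _ ⟨
                w k * b k ^ 4 * b 0 * U k                 ≈⟨ ∑-*ˡ (suc N) _ _ ⟩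
                ∑ (suc N) (λ j → w k * b k ^ 4 * b 0 * (T k j * (E j * E j) * Q ^ j))
                  ≈⟨ ∑-cong (suc N) (λ j _ → solve 5 (λ w b t e x → w :* b :* (t :* e :* x) := b :* (e :* x) :* (w :* t)) refl
                       (w k * b k ^ 4) (b 0) (T k j) (E j * E j) (Q ^ j)) ⟩
                ∑ (suc N) (λ j → b 0 * ((E j * E j) * Q ^ j) * (w k * b k ^ 4 * T k j)) ∎

              collect : ∀ j → j ≤ N → b 0 * ((E j * E j) * Q ^ j) * I j ≈ Y * Y * q' ^ N * ([n] * (b 0 * b 0)) * (b j ^ 3 * Q ^ j)
              collect j j≤N = begin
                b 0 * ((E j * E j) * Q ^ j) * I j
                  ≈⟨ *-congˡ (I-closed (N ∸ j) j (ℕ.m+[n∸m]≡n j≤N)) ⟩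
                b 0 * ((E j * E j) * Q ^ j) * ([n] * q' ^ N * b 0 ^ 3 * (b j * (P j * P j)))
                  -- Of the four factors `b 0`, two complete the square of `P j * E j * b 0`, which
                  -- `PEb` turns into `Y * b j`; the other two are those of `cubicSum`.
                  ≈⟨ solve 7 (λ b e x m z c p → b :* ((e :* e) :* x) :* (m :* z :* b :^ 3 :* (c :* (p :* p)))
                                             := z :* (m :* (b :* b)) :* (c :* ((p :* e :* b) :* (p :* e :* b)) :* x)) refl
                       (b 0) (E j) (Q ^ j) [n] (q' ^ N) (b j) (P j) ⟩
                q' ^ N * ([n] * (b 0 * b 0)) * (b j * ((P j * E j * b 0) * (P j * E j * b 0)) * Q ^ j)
                  ≈⟨ *-congˡ (*-congʳ (*-congˡ (*-cong (PEb j j≤N) (PEb j j≤N)))) ⟩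
                q' ^ N * ([n] * (b 0 * b 0)) * (b j * ((Y * b j) * (Y * b j)) * Q ^ j)
                  ≈⟨ solve 5 (λ z m b y x → z :* m :* (b :* ((y :* b) :* (y :* b)) :* x) := y :* y :* z :* m :* (b :^ 3 :* x)) refl _ _ _ _ _ ⟩
                Y * Y * q' ^ N * ([n] * (b 0 * b 0)) * (b j ^ 3 * Q ^ j) ∎

-- Divisibility, comaximality and quotient rings

module Divisors {c ℓ : Level} (R : CommutativeRing c ℓ) where
  open CommutativeRing R hiding (zero)
  open FiniteSums R
  open QuintupleSum R
  open import Relation.Binary.Reasoning.Setoid setoid

  infix 4 _∣_
  infixr 4 _,_
  record _∣_ (f x : Carrier) : Set (c ⊔ ℓ) where
    constructor _,_
    field
      quotient : Carrier
      equality : quotient * f ≈ x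

  ∣-resp : ∀ {f x y} → x ≈ y → f ∣ x → f ∣ y
  ∣-resp x≈y (u , uf≈x) = u , trans uf≈x x≈y

  ∣-respˡ : ∀ {f g x} → f ≈ g → f ∣ x → g ∣ x
  ∣-respˡ f≈g (u , uf≈x) = u , trans (*-congˡ (sym f≈g)) uf≈x

  ∣-refl : ∀ {f} → f ∣ f
  ∣-refl = 1# , *-identityˡ _

  ∣-trans : ∀ {f g x} → f ∣ g → g ∣ x → f ∣ x
  ∣-trans {f} (u , uf≈g) (v , vg≈x) = v * u , trans (*-assoc v u f) (trans (*-congˡ uf≈g) vg≈x)

  ∣-0 : ∀ {f} → f ∣ 0#
  ∣-0 = 0# , zeroˡ _

  ∣-+ : ∀ {f x y} → f ∣ x → f ∣ y → f ∣ x + y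
  ∣-+ {f} (u , uf≈x) (v , vf≈y) = u + v , trans (distribʳ f u v) (+-cong uf≈x vf≈y)

  ∣-neg : ∀ {f x} → f ∣ x → f ∣ - x
  ∣-neg (u , uf≈x) = - u , trans (sym (-‿distribˡ-* _ _)) (-‿cong uf≈x)

  ∣-*ˡ : ∀ {f x} y → f ∣ x → f ∣ y * x
  ∣-*ˡ {f} y (u , uf≈x) = y * u , trans (*-assoc y u f) (*-congˡ uf≈x)

  ∣-*ʳ : ∀ {f x} y → f ∣ x → f ∣ x * y
  ∣-*ʳ y f∣x = ∣-resp (*-comm y _) (∣-*ˡ y f∣x)

  ∣-factorʳ : ∀ f g → g ∣ f * g
  ∣-factorʳ f g = f , refl

  ∣-factorˡ : ∀ f g → f ∣ f * g
  ∣-factorˡ f g = g , *-comm g f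

  ∣-pres-* : ∀ {f g x y} → f ∣ x → g ∣ y → f * g ∣ x * y
  ∣-pres-* {f} {g} (u , uf≈x) (v , vg≈y) = u * v ,
    trans (solve 4 (λ u v f g → u :* v :* (f :* g) := (u :* f) :* (v :* g)) refl u v f g) (*-cong uf≈x vg≈y)

  ∣-∏ : ∀ n {f g} → (∀ k → k < n → f k ∣ g k) → ∏ n f ∣ ∏ n g
  ∣-∏ zero f∣g = ∣-refl
  ∣-∏ (suc n) f∣g = ∣-pres-* (∣-∏ n λ k k<n → f∣g k (ℕ.m<n⇒m<1+n k<n)) (f∣g n ℕ.≤-refl)

  ∏-prefix-∣ : ∀ {m n} f → m ≤ n → ∏ m f ∣ ∏ n f
  ∏-prefix-∣ {n = zero} f z≤n = ∣-refl
  ∏-prefix-∣ {n = suc n} f m≤1+n with ℕ.m≤n⇒m<n∨m≡n m≤1+n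
  ... | inj₁ m<1+n  = ∣-trans (∏-prefix-∣ f (ℕ.s≤s⁻¹ m<1+n)) (∣-factorˡ _ _)
  ... | inj₂ ≡.refl = ∣-refl

  -- The quotient by `f` has no ℤ-torsion. This removes the integer constants that comaximality over
  -- ℚ introduces.
  Saturated : Carrier → Set (c ⊔ ℓ)
  Saturated f = ∀ k x → k ≢ + 0 → f ∣ ⟦ k ⟧ℤ * x → f ∣ x

  -- comaximality over the rationals
  record Comaximal (f g : Carrier) : Set (c ⊔ ℓ) where
    constructor comaximal
    field
      {constant} : ℤ
      {u v} : Carrier
      nonzero : constant ≢ + 0
      identity : u * f + v * g ≈ ⟦ constant ⟧ℤ

  Comaximal-sym : ∀ {f g} → Comaximal f g → Comaximal g f
  Comaximal-sym (comaximal nz eq) = comaximal nz (trans (+-comm _ _) eq)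

  Comaximal-1 : ∀ f → Comaximal f 1#
  Comaximal-1 f = comaximal {constant = + 1} {0#} {1#} (λ ()) (solve 1 (λ f → con (+ 0) :* f :+ 1ᶜ :* 1ᶜ := 1ᶜ) refl f)

  Comaximal-* : ∀ {f g h} → Comaximal f g → Comaximal f h → Comaximal f (g * h)
  Comaximal-* {f} {g} {h} (comaximal {a} {u} {v} a≢0 p) (comaximal {b} {u'} {v'} b≢0 q) =
    comaximal {constant = a ℤ.* b} {u * u' * f + u * v' * h + v * g * u'} {v * v'} ab≢0 (begin
      (u * u' * f + u * v' * h + v * g * u') * f + v * v' * (g * h)
        ≈⟨ solve 7 (λ f g h u v u' v' → (u :* u' :* f :+ u :* v' :* h :+ v :* g :* u') :* f :+ v :* v' :* (g :* h)
             := (u :* f :+ v :* g) :* (u' :* f :+ v' :* h)) refl f g h u v u' v' ⟩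
      (u * f + v * g) * (u' * f + v' * h)  ≈⟨ *-cong p q ⟩
      ⟦ a ⟧ℤ * ⟦ b ⟧ℤ                      ≈⟨ ⟦⟧ℤ-* a b ⟨
      ⟦ a ℤ.* b ⟧ℤ                         ∎)
    where
    ab≢0 : a ℤ.* b ≢ + 0
    ab≢0 ab≡0 with ℤ.i*j≡0⇒i≡0∨j≡0 a ab≡0
    ... | inj₁ a≡0 = a≢0 a≡0
    ... | inj₂ b≡0 = b≢0 b≡0

  Comaximal-^ : ∀ {f g} n → Comaximal f g → Comaximal f (g ^ n)
  Comaximal-^ zero fg = Comaximal-1 _
  Comaximal-^ (suc n) fg = Comaximal-* fg (Comaximal-^ n fg)

  Comaximal-∏ : ∀ {f} n {g} → (∀ k → k < n → Comaximal f (g k)) → Comaximal f (∏ n g)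
  Comaximal-∏ zero fg = Comaximal-1 _
  Comaximal-∏ (suc n) fg = Comaximal-* (Comaximal-∏ n λ k k<n → fg k (ℕ.m<n⇒m<1+n k<n)) (fg n ℕ.≤-refl)

  -- Modulo `f` the element `g` is a multiple of `h`, so a Bézout identity for `g` becomes one for
  -- `h` with the same constant.
  Comaximal-ideal : ∀ {f g h} β → f ∣ g - β * h → Comaximal f g → Comaximal f h
  Comaximal-ideal {f} {g} {h} β (α , αf≈) (comaximal {a} {u} {v} a≢0 p) =
    comaximal {constant = a} {u + v * α} {v * β} a≢0 (begin
      (u + v * α) * f + v * β * h
        ≈⟨ solve 6 (λ u v α β f h → (u :+ v :* α) :* f :+ v :* β :* h := u :* f :+ v :* (α :* f :+ β :* h)) refl u v α β f h ⟩
      u * f + v * (α * f + β * h)          ≈⟨ +-congˡ (*-congˡ (+-congʳ αf≈)) ⟩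
      u * f + v * (g - β * h + β * h)
        ≈⟨ solve 6 (λ u v g β f h → u :* f :+ v :* (g :- β :* h :+ β :* h) := u :* f :+ v :* g) refl u v g β f h ⟩
      u * f + v * g                        ≈⟨ p ⟩
      ⟦ a ⟧ℤ                               ∎)

  Comaximal-∣ : ∀ {f g h} → h ∣ g → Comaximal f g → Comaximal f h
  Comaximal-∣ (β , βh≈g) = Comaximal-ideal β (∣-resp (sym (x≈y⇒x-y≈0 (sym βh≈g))) ∣-0)

  -- The Bézout identity multiplied by `x` shows that `f` divides an integer multiple of `x`;
  -- saturation then removes the integer.
  Comaximal-cancel : ∀ {f g} → Comaximal f g → Saturated f → ∀ {x} → f ∣ g * x → f ∣ x
  Comaximal-cancel {f} {g} (comaximal {a} {u} {v} a≢0 p) sat {x} f∣gx =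
    sat a x a≢0 (∣-resp (begin
      u * x * f + v * (g * x)  ≈⟨ solve 5 (λ u x f v g → u :* x :* f :+ v :* (g :* x) := (u :* f :+ v :* g) :* x) refl u x f v g ⟩
      (u * f + v * g) * x      ≈⟨ *-congʳ p ⟩
      ⟦ a ⟧ℤ * x               ∎)
      (∣-+ (∣-factorʳ (u * x) f) (∣-*ˡ v f∣gx)))

  Comaximal-*-∣ : ∀ {f g x} → Comaximal f g → Saturated g → f ∣ x → g ∣ x → f * g ∣ x
  Comaximal-*-∣ {f} {g} {x} fg sat (a , af≈x) g∣x =
    ∣-resp (trans (*-comm f a) af≈x)
      (∣-pres-* (∣-refl {f}) (Comaximal-cancel (Comaximal-sym fg) sat (∣-resp (trans (sym af≈x) (*-comm a f)) g∣x)))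

  1-x∣1-x^ : ∀ x t → x - 1# ∣ x ^ t - 1#
  1-x∣1-x^ x zero = ∣-resp (sym (-‿inverseʳ 1#)) ∣-0
  1-x∣1-x^ x (suc t) = ∣-resp (solve 2 (λ x y → x :* (y :- 1ᶜ) :+ (x :- 1ᶜ) := x :* y :- 1ᶜ) refl x (x ^ t))
    (∣-+ (∣-*ˡ x (1-x∣1-x^ x t)) ∣-refl)

  ^-∣ : ∀ x m t → x ^ m - 1# ∣ x ^ (m ℕ.* t) - 1#
  ^-∣ x m t = ∣-resp (+-congʳ (^-assocʳ x m t)) (1-x∣1-x^ (x ^ m) t)

  -- Modulo x - 1 every power of `x` is 1. The integer `t` becomes the constant in the comaximality
  -- of cyclotomic polynomials.
  geom-mod : ∀ x t → x - 1# ∣ geom x t - ⟦ + t ⟧ℤ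
  geom-mod x zero = ∣-resp (sym (-‿inverseʳ 0#)) ∣-0
  geom-mod x (suc t) = ∣-resp (begin
    (geom x t - ⟦ + t ⟧ℤ) + (x ^ t - 1#)
      ≈⟨ solve 3 (λ g k y → (g :- k) :+ (y :- 1ᶜ) := (g :+ y) :- (1ᶜ :+ k)) refl (geom x t) ⟦ + t ⟧ℤ (x ^ t) ⟩
    geom x (suc t) - (1# + ⟦ + t ⟧ℤ)   ≈⟨ +-congˡ (-‿cong (⟦⟧ℤ-+ (+ 1) (+ t))) ⟨
    geom x (suc t) - ⟦ + suc t ⟧ℤ      ∎)
    (∣-+ (geom-mod x t) (1-x∣1-x^ x t))

module QuotientRing {c ℓ : Level} (R : CommutativeRing c ℓ) (f : CommutativeRing.Carrier R) where
  open CommutativeRing R hiding (zero)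
  open FiniteSums R
  open QuintupleSum R
  open Divisors R

  infix 4 _≡ₘ_
  record _≡ₘ_ (x y : Carrier) : Set (c ⊔ ℓ) where
    constructor mod
    field difference : f ∣ x - y

  ≈⇒≡ₘ : ∀ {x y} → x ≈ y → x ≡ₘ y
  ≈⇒≡ₘ x≈y = mod (∣-resp (sym (x≈y⇒x-y≈0 x≈y)) ∣-0)

  ∣⇒≡ₘ0 : ∀ {x} → f ∣ x → x ≡ₘ 0#
  ∣⇒≡ₘ0 f∣x = mod (∣-resp (solve 1 (λ x → x := x :- con (+ 0)) refl _) f∣x)

  ≡ₘ0⇒∣ : ∀ {x} → x ≡ₘ 0# → f ∣ x
  ≡ₘ0⇒∣ (mod f∣) = ∣-resp (solve 1 (λ x → x :- con (+ 0) := x) refl _) f∣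

  private
    ≡ₘ-sym : ∀ {x y} → x ≡ₘ y → y ≡ₘ x
    ≡ₘ-sym {x} {y} (mod d) = mod (∣-resp (solve 2 (λ x y → :- (x :- y) := y :- x) refl x y) (∣-neg d))

    ≡ₘ-trans : ∀ {x y z} → x ≡ₘ y → y ≡ₘ z → x ≡ₘ z
    ≡ₘ-trans {x} {y} {z} (mod d) (mod e) =
      mod (∣-resp (solve 3 (λ x y z → (x :- y) :+ (y :- z) := x :- z) refl x y z) (∣-+ d e))

    +-cong-≡ₘ : ∀ {x x' y y'} → x ≡ₘ x' → y ≡ₘ y' → x + y ≡ₘ x' + y'
    +-cong-≡ₘ {x} {x'} {y} {y'} (mod d) (mod e) =
      mod (∣-resp (solve 4 (λ x x' y y' → (x :- x') :+ (y :- y') := (x :+ y) :- (x' :+ y')) refl x x' y y') (∣-+ d e))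

    *-cong-≡ₘ : ∀ {x x' y y'} → x ≡ₘ x' → y ≡ₘ y' → x * y ≡ₘ x' * y'
    *-cong-≡ₘ {x} {x'} {y} {y'} (mod d) (mod e) =
      mod (∣-resp (solve 4 (λ x x' y y' → y :* (x :- x') :+ x' :* (y :- y') := (x :* y) :- (x' :* y')) refl x x' y y')
        (∣-+ (∣-*ˡ y d) (∣-*ˡ x' e)))

    neg-cong-≡ₘ : ∀ {x y} → x ≡ₘ y → - x ≡ₘ - y
    neg-cong-≡ₘ {x} {y} (mod d) = mod (∣-resp (solve 2 (λ x y → :- (x :- y) := :- x :- (:- y)) refl x y) (∣-neg d))

  R/f : CommutativeRing c (c ⊔ ℓ)
  R/f = record
    { Carrier = Carrier ; _≈_ = _≡ₘ_ ; _+_ = _+_ ; _*_ = _*_ ; -_ = -_ ; 0# = 0# ; 1# = 1#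
    ; isCommutativeRing = record
      { isRing = record
        { +-isAbelianGroup = record
          { isGroup = record
            { isMonoid = record
              { isSemigroup = record
                { isMagma = record
                  { isEquivalence = record { refl = ≈⇒≡ₘ refl ; sym = ≡ₘ-sym ; trans = ≡ₘ-trans }
                  ; ∙-cong = +-cong-≡ₘ }
                ; assoc = λ x y z → ≈⇒≡ₘ (+-assoc x y z) }
              ; identity = (λ x → ≈⇒≡ₘ (+-identityˡ x)) , (λ x → ≈⇒≡ₘ (+-identityʳ x)) }
            ; inverse = (λ x → ≈⇒≡ₘ (-‿inverseˡ x)) , (λ x → ≈⇒≡ₘ (-‿inverseʳ x))
            ; ⁻¹-cong = neg-cong-≡ₘ }
          ; comm = λ x y → ≈⇒≡ₘ (+-comm x y) }
        ; *-cong = *-cong-≡ₘ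
        ; *-assoc = λ x y z → ≈⇒≡ₘ (*-assoc x y z)
        ; *-identity = (λ x → ≈⇒≡ₘ (*-identityˡ x)) , (λ x → ≈⇒≡ₘ (*-identityʳ x))
        ; distrib = (λ x y z → ≈⇒≡ₘ (distribˡ x y z)) , (λ x y z → ≈⇒≡ₘ (distribʳ x y z)) }
      ; *-comm = λ x y → ≈⇒≡ₘ (*-comm x y) } }

  private
    module M = CommutativeRing R/f
    module MΣ = FiniteSums R/f
    module MQ = QuintupleSum R/f

  -- The operations of `R/f` are those of `R`, but powers, sums and what is built from them are
  -- separate recursive functions over the two rings. Their agreement takes an induction, here and
  -- in the lemmas that follow.
  ^-mod : ∀ x n → x ^ n ≡ₘ x MΣ.^ n
  ^-mod x zero = M.refl
  ^-mod x (suc n) = M.*-congˡ (^-mod x n)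

  ∑-mod : ∀ n {g h} → (∀ k → g k ≡ₘ h k) → ∑ n g ≡ₘ MΣ.∑ n h
  ∑-mod zero g≡h = M.refl
  ∑-mod (suc n) g≡h = M.+-cong (∑-mod n g≡h) (g≡h n)

  geom-mod-f : ∀ q n → geom q n ≡ₘ MQ.geom q n
  geom-mod-f q n = ∑-mod n (^-mod q)

  oddFactor-mod : ∀ q i → oddFactor q i ≡ₘ MQ.oddFactor q i
  oddFactor-mod q i = M.+-congˡ (M.-‿cong (M.*-congˡ (^-mod (q * q) i)))

  evenFactor-mod : ∀ q i → evenFactor q i ≡ₘ MQ.evenFactor q i
  evenFactor-mod q i = M.+-congˡ (M.-‿cong (^-mod (q * q) (suc i)))

  τ-mod : ∀ q k → τ q k ≡ₘ MQ.τ q k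
  τ-mod q zero = M.refl
  τ-mod q (suc k) = M.-‿cong (M.*-cong (^-mod (q * q) (suc k)) (τ-mod q k))

  summand-mod : ∀ q b k → summand q b k ≡ₘ MQ.summand q b k
  summand-mod q b k = M.*-cong (M.*-cong (τ-mod q k) (geom-mod-f q (4 ℕ.* k ℕ.+ 1))) (^-mod (b k) 5)

  defect-mod : ∀ q N b m → defect q N b m ≡ₘ MQ.defect q N b m
  defect-mod q N b m = M.+-cong (M.*-cong (^-mod q N) (∑-mod m (summand-mod q b)))
    (M.-‿cong (M.*-cong (M.*-congʳ (geom-mod-f q (suc (N ℕ.+ N))))
      (∑-mod (suc N) λ k → M.*-cong (^-mod (b k) 3) (^-mod (q * q) k))))

  -- Supplies the regular elements 1 - qⁱ that the argument in the quotient ring asks for.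
  Comaximal⇒Regular : ∀ {g} → Saturated f → Comaximal f g → MΣ.Regular g
  Comaximal⇒Regular sat fg y gy≡0 = ∣⇒≡ₘ0 (Comaximal-cancel fg sat (≡ₘ0⇒∣ gy≡0))

-- Factorisation of qⁿ − 1

module CyclotomicFactors {c ℓ : Level} (R : CommutativeRing c ℓ) where
  open CommutativeRing R hiding (zero)
  open FiniteSums R
  open QuintupleSum R using (geom; geom-closed)
  open Divisors R renaming (_,_ to _by_)
  open import Relation.Binary.Reasoning.Setoid setoid

  module _ (x : Carrier) where

    xⁿ-1 : ℕ → Carrier
    xⁿ-1 n = x ^ n - 1#

    -- Since x^b is 1 modulo `f`, exponents count modulo b, where the gcd is a multiple of j. Bézout
    -- over ℕ comes in two signed forms, and in both a factor `x ^ g` avoids negative powers of `x`.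
    gcd-in-ideal : ∀ f j b → f ∣ xⁿ-1 b → ∃ λ β → f ∣ xⁿ-1 (gcd j b) - β * xⁿ-1 j
    gcd-in-ideal f j b f∣ with Bézout.identity (gcd-GCD j b)
    ... | Bézout.+- s t g+tb≡sj with 1-x∣1-x^ (x ^ j) s
    ...   | β by eq = β , ∣-resp (begin
      - (x ^ g) * (x ^ (b ℕ.* t) - 1#)
        ≈⟨ solve 2 (λ y z → (:- y) :* (z :- 1ᶜ) := (y :- 1ᶜ) :- (y :* z :- 1ᶜ)) refl (x ^ g) (x ^ (b ℕ.* t)) ⟩
      (x ^ g - 1#) - (x ^ g * x ^ (b ℕ.* t) - 1#)       ≈⟨ +-congˡ (-‿cong (+-congʳ (^-homo-* x g (b ℕ.* t)))) ⟨
      (x ^ g - 1#) - (x ^ (g ℕ.+ b ℕ.* t) - 1#)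
        ≡⟨ ≡.cong (λ k → (x ^ g - 1#) - (x ^ k - 1#)) (≡.trans (≡.cong (g ℕ.+_) (ℕ.*-comm b t)) (≡.trans g+tb≡sj (ℕ.*-comm s j))) ⟩
      (x ^ g - 1#) - (x ^ (j ℕ.* s) - 1#)               ≈⟨ +-congˡ (-‿cong (trans eq (+-congʳ (^-assocʳ x j s)))) ⟨
      (x ^ g - 1#) - β * (x ^ j - 1#)                   ∎)
      (∣-*ˡ (- (x ^ g)) (∣-trans f∣ (^-∣ x b t)))
      where g = gcd j b
    gcd-in-ideal f j b f∣ | Bézout.-+ s t g+sj≡tb with 1-x∣1-x^ (x ^ j) s
    ... | β by eq = - (x ^ g * β) , ∣-resp (begin
      x ^ (b ℕ.* t) - 1#
        ≡⟨ ≡.cong (λ k → x ^ k - 1#) (≡.trans (ℕ.*-comm b t) (≡.trans (≡.sym g+sj≡tb) (≡.cong (g ℕ.+_) (ℕ.*-comm s j)))) ⟩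
      x ^ (g ℕ.+ j ℕ.* s) - 1#                          ≈⟨ +-congʳ (^-homo-* x g (j ℕ.* s)) ⟩
      x ^ g * x ^ (j ℕ.* s) - 1#
        ≈⟨ solve 2 (λ y z → y :* z :- 1ᶜ := (y :- 1ᶜ) :+ y :* (z :- 1ᶜ)) refl (x ^ g) (x ^ (j ℕ.* s)) ⟩
      (x ^ g - 1#) + x ^ g * (x ^ (j ℕ.* s) - 1#)       ≈⟨ +-congˡ (*-congˡ (trans eq (+-congʳ (^-assocʳ x j s)))) ⟨
      (x ^ g - 1#) + x ^ g * (β * (x ^ j - 1#))
        ≈⟨ solve 4 (λ y b z w → w :+ y :* (b :* z) := w :- (:- (y :* b)) :* z) refl (x ^ g) β (x ^ j - 1#) (x ^ g - 1#) ⟩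
      (x ^ g - 1#) - - (x ^ g * β) * (x ^ j - 1#)       ∎)
      (∣-trans f∣ (^-∣ x b t))
      where g = gcd j b

    module _ (Φ : ℕ → Carrier) where

      -- Non-divisors contribute 1, so products over divisors become products over an interval; the
      -- test is the one made by `newCyc`.
      divisorFactor : ℕ → ℕ → Carrier
      divisorFactor n d = if does (d ∣? n) then Φ d else 1#

      divisorFactor-∣ : ∀ {n d} → d ℕ.∣ n → divisorFactor n d ≡ Φ d
      divisorFactor-∣ {n} {d} d∣n rewrite dec-true (d ∣? n) d∣n = ≡.refl

      divisorFactor-elim : ∀ {p} (P : Carrier → Set p) n d → (d ℕ.∣ n → P (Φ d)) → (¬ d ℕ.∣ n → P 1#) → P (divisorFactor n d)
      divisorFactor-elim P n d yes-case no-case with d ∣? n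
      ... | yes d∣n = yes-case d∣n
      ... | no  d∤n = no-case d∤n

      properProduct : ℕ → Carrier
      properProduct m = ∏ m (λ i → divisorFactor (suc m) (suc i))

      Factorisation : ℕ → Set ℓ
      Factorisation m = Φ (suc m) * properProduct m ≈ xⁿ-1 (suc m)

      fullProduct≈ : ∀ m → Factorisation m → ∏ (suc m) (λ i → divisorFactor (suc m) (suc i)) ≈ xⁿ-1 (suc m)
      fullProduct≈ m F = trans (*-comm _ _) (trans (*-congʳ (reflexive (divisorFactor-∣ (ℕ.∣-refl {suc m})))) F)

      Φ∣xⁿ-1 : ∀ m t → Factorisation m → Φ (suc m) ∣ xⁿ-1 (suc m ℕ.* t)
      Φ∣xⁿ-1 m t F = ∣-trans (∣-resp F (∣-factorˡ _ _)) (^-∣ x (suc m) t)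

      module _ (xⁿ-1-regular : ∀ n → Regular (xⁿ-1 (suc n))) where

        -- Write B = b + 1, G = g + 1, B = (t + 1) G and y = x^G. All cyclotomic factors of y - 1
        -- are among those of the proper divisors of B, so Φ_B divides (x^B - 1) / (y - 1) = 1 + y +
        -- ... + y^t, and this sum is t + 1 modulo y - 1.
        Comaximal-divisor : ∀ b g → Factorisation b → Factorisation g → suc g ℕ.∣ suc b → g < b → Comaximal (Φ (suc b)) (xⁿ-1 (suc g))
        Comaximal-divisor b g Fb Fg (divides zero ()) g<b
        Comaximal-divisor b g Fb Fg g∣b@(divides (suc t) b≡tg) g<b =
          comaximal {constant = + suc t} {h} { - s } (λ ()) (begin
          h * Φ (suc b) + - s * xⁿ-1 (suc g)
            ≈⟨ +-cong hΦ≈geom (trans (sym (-‿distribˡ-* s _)) (-‿cong (_∣_.equality t≡geom))) ⟩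
          geom (x ^ suc g) (suc t) - (geom (x ^ suc g) (suc t) - ⟦ + suc t ⟧ℤ)
            ≈⟨ solve 2 (λ u k → u :- (u :- k) := k) refl (geom (x ^ suc g) (suc t)) ⟦ + suc t ⟧ℤ ⟩
          ⟦ + suc t ⟧ℤ ∎)
          where
          factor-∣ : ∀ i → i < suc g → divisorFactor (suc g) (suc i) ∣ divisorFactor (suc b) (suc i)
          factor-∣ i _ = divisorFactor-elim (_∣ divisorFactor (suc b) (suc i)) (suc g) (suc i)
            (λ i∣g → ∣-resp (sym (reflexive (divisorFactor-∣ (ℕ.∣-trans i∣g g∣b)))) ∣-refl)
            (λ _ → _ by *-identityʳ _)
          xᵍ-1∣proper : xⁿ-1 (suc g) ∣ properProduct b
          xᵍ-1∣proper = ∣-respˡ (fullProduct≈ g Fg) (∣-trans (∣-∏ (suc g) factor-∣)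
            (∏-prefix-∣ (λ i → divisorFactor (suc b) (suc i)) g<b))
          t≡geom : xⁿ-1 (suc g) ∣ geom (x ^ suc g) (suc t) - ⟦ + suc t ⟧ℤ
          t≡geom = geom-mod (x ^ suc g) (suc t)
          h s : Carrier
          h = _∣_.quotient xᵍ-1∣proper
          s = _∣_.quotient t≡geom
          hΦ≈geom : h * Φ (suc b) ≈ geom (x ^ suc g) (suc t)
          hΦ≈geom = Regular-cancel (xⁿ-1-regular g) (begin
            xⁿ-1 (suc g) * (h * Φ (suc b))       ≈⟨ solve 3 (λ a b c → a :* (b :* c) := c :* (b :* a)) refl _ _ _ ⟩
            Φ (suc b) * (h * xⁿ-1 (suc g))       ≈⟨ *-congˡ (_∣_.equality xᵍ-1∣proper) ⟩
            Φ (suc b) * properProduct b         ≈⟨ Fb ⟩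
            xⁿ-1 (suc b)                         ≡⟨ ≡.cong xⁿ-1 (≡.trans b≡tg (ℕ.*-comm (suc t) (suc g))) ⟩
            xⁿ-1 (suc g ℕ.* suc t)             ≈⟨ +-congʳ (^-assocʳ x (suc g) (suc t)) ⟨
            (x ^ suc g) ^ suc t - 1#            ≈⟨ solve 1 (λ y → y :- 1ᶜ := :- (1ᶜ :- y)) refl _ ⟩
            - (1# - (x ^ suc g) ^ suc t)        ≈⟨ -‿cong (geom-closed (x ^ suc g) (suc t)) ⟨
            - ((1# - x ^ suc g) * geom (x ^ suc g) (suc t))
              ≈⟨ solve 2 (λ y z → :- ((1ᶜ :- y) :* z) := (y :- 1ᶜ) :* z) refl _ _ ⟩
            xⁿ-1 (suc g) * geom (x ^ suc g) (suc t)  ∎)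

        -- Modulo Φ the power x^j - 1 generates x^g - 1 for g = gcd j (suc b), and this g is a
        -- proper divisor of `suc b`.
        Comaximal-nonmultiple : ∀ b j → (∀ e → e ≤ b → Factorisation e) → ¬ suc b ℕ.∣ j → Comaximal (Φ (suc b)) (xⁿ-1 j)
        Comaximal-nonmultiple b j F b∤j with gcd j (suc b) in eq | gcd-in-ideal (Φ (suc b)) j (suc b)
              (∣-resp (reflexive (≡.cong xⁿ-1 (ℕ.*-identityʳ (suc b)))) (Φ∣xⁿ-1 b 1 (F b ℕ.≤-refl)))
        ... | zero  | _ = ⊥-elim (ℕ.1+n≢0 (gcd[m,n]≡0⇒n≡0 j eq))
        ... | suc g | β , ideal = Comaximal-ideal β ideal
              (Comaximal-divisor b g (F b ℕ.≤-refl) (F g (ℕ.<⇒≤ g<b)) g∣b g<b)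
          where
          g∣b : suc g ℕ.∣ suc b
          g∣b = ≡.subst (ℕ._∣ suc b) eq (gcd[m,n]∣n j (suc b))
          g<b : g < b
          g<b = ℕ.≤∧≢⇒< (ℕ.s≤s⁻¹ (ℕ.∣⇒≤ g∣b)) λ { ≡.refl → b∤j (≡.subst (ℕ._∣ j) eq (gcd[m,n]∣m j (suc b))) }

        -- Of two distinct positive integers at least one does not divide the other. Its Φ is
        -- comaximal with the whole of x^i - 1 for the other integer i, hence with the factor Φ_i.
        Comaximal-distinct : ∀ a b → (∀ e → e ≤ a ℕ.⊔ b → Factorisation e) → a ≢ b → Comaximal (Φ (suc a)) (Φ (suc b))
        Comaximal-distinct a b F a≢b with suc b ∣? suc a
        ... | no  b∤a = Comaximal-sym (Comaximal-∣ (Φ∣ a (ℕ.m≤m⊔n a b))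
                          (Comaximal-nonmultiple b (suc a) (λ e e≤b → F e (ℕ.≤-trans e≤b (ℕ.m≤n⊔m a b))) b∤a))
          where
          Φ∣ : ∀ e → e ≤ a ℕ.⊔ b → Φ (suc e) ∣ xⁿ-1 (suc e)
          Φ∣ e le = ∣-resp (F e le) (∣-factorˡ _ _)
        ... | yes b∣a = Comaximal-∣ (∣-resp (F b (ℕ.m≤n⊔m a b)) (∣-factorˡ _ _))
                          (Comaximal-nonmultiple a (suc b) (λ e e≤a → F e (ℕ.≤-trans e≤a (ℕ.m≤m⊔n a b)))
                            λ a∣b → a≢b (ℕ.suc-injective (ℕ.∣-antisym a∣b b∣a)))

        divisorFactor-comaximal : ∀ n a b → (∀ e → e ≤ a ℕ.⊔ b → Factorisation e) → a ≢ b →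
                                  Comaximal (divisorFactor n (suc a)) (divisorFactor n (suc b))
        divisorFactor-comaximal n a b F a≢b = divisorFactor-elim (λ y → Comaximal y (divisorFactor n (suc b))) n (suc a)
          (λ _ → divisorFactor-elim (Comaximal (Φ (suc a))) n (suc b) (λ _ → Comaximal-distinct a b F a≢b) (λ _ → Comaximal-1 _))
          (λ _ → Comaximal-sym (Comaximal-1 _))

        -- distinct cyclotomic factors are comaximal, so their product divides whatever each of them divides
        divisorProduct-∣ : ∀ n m {y} → (∀ e → e < m → Factorisation e) → (∀ e → e < m → Saturated (Φ (suc e))) →
                           (∀ e → e < m → divisorFactor n (suc e) ∣ y) → ∏ m (λ i → divisorFactor n (suc i)) ∣ y
        divisorProduct-∣ n zero {y} F sat φ∣y = y by *-identityʳ y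
        divisorProduct-∣ n (suc m) F sat φ∣y = Comaximal-*-∣
          (Comaximal-sym (Comaximal-∏ m λ k k<m → divisorFactor-comaximal n m k
            (λ e e≤m⊔k → F e (s≤s (ℕ.≤-trans e≤m⊔k (ℕ.≤-reflexive (ℕ.m≥n⇒m⊔n≡m (ℕ.<⇒≤ k<m)))))) (λ m≡k → ℕ.<⇒≢ k<m (≡.sym m≡k))))
          saturated
          (divisorProduct-∣ n m (λ e e<m → F e (ℕ.m<n⇒m<1+n e<m)) (λ e e<m → sat e (ℕ.m<n⇒m<1+n e<m))
            (λ e e<m → φ∣y e (ℕ.m<n⇒m<1+n e<m)))
          (φ∣y m ℕ.≤-refl)
          where
          saturated : Saturated (divisorFactor n (suc m))
          saturated = divisorFactor-elim Saturated n (suc m) (λ _ → sat m ℕ.≤-refl) (λ _ _ z _ _ → z by *-identityʳ z)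

        -- This makes the division that defines `Φ (suc m)` exact, using only what is known at
        -- smaller indices.
        properProduct-∣ : ∀ m → (∀ e → e < m → Factorisation e) → (∀ e → e < m → Saturated (Φ (suc e))) → properProduct m ∣ xⁿ-1 (suc m)
        properProduct-∣ m F sat = divisorProduct-∣ (suc m) m F sat φ∣
          where
          φ∣ : ∀ e → e < m → divisorFactor (suc m) (suc e) ∣ xⁿ-1 (suc m)
          φ∣ e e<m = divisorFactor-elim (_∣ xⁿ-1 (suc m)) (suc m) (suc e)
            (λ { (divides t eq) → ∣-resp (reflexive (≡.cong xⁿ-1 (≡.trans (ℕ.*-comm (suc e) t) (≡.sym eq)))) (Φ∣xⁿ-1 e t (F e e<m)) })
            (λ _ → _ by *-identityʳ _)

m+m≢1+n+n : ∀ m n → m ℕ.+ m ≢ suc (n ℕ.+ n)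
m+m≢1+n+n m n eq = ℕ.even≢odd m n
  (≡.subst₂ (λ x y → m ℕ.+ x ≡ suc (n ℕ.+ y)) (≡.sym (ℕ.+-identityʳ m)) (≡.sym (ℕ.+-identityʳ n)) eq)

-- Sums over blocks of consecutive terms

module BlockSums {c ℓ : Level} (R : CommutativeRing c ℓ) where
  open CommutativeRing R hiding (zero)
  open FiniteSums R
  open QuintupleSum R using (geom; geom-closed; τ; oddFactor; evenFactor; summand; cubicSum; w-closed; quintuple-sum)
  open import Relation.Binary.Reasoning.Setoid setoid

  [q²]^≈ : ∀ q m → (q * q) ^ m ≈ q ^ (m ℕ.+ m)
  [q²]^≈ q m = trans (^-distrib-* q q m) (sym (^-homo-* q m m))

  oddFactor≈ : ∀ q i → oddFactor q i ≈ 1# - q ^ suc (i ℕ.+ i)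
  oddFactor≈ q i = +-congˡ (-‿cong (*-congˡ ([q²]^≈ q i)))

  evenFactor≈ : ∀ q i → evenFactor q i ≈ 1# - q ^ (suc i ℕ.+ suc i)
  evenFactor≈ q i = +-congˡ (-‿cong ([q²]^≈ q (suc i)))

  module _ (q : Carrier) (N : ℕ) (0<N : 0 < N) where

    private
      n d : ℕ → Carrier
      n = oddFactor q
      d = evenFactor q

      D : ℕ
      D = suc (N ℕ.+ N)

      Q : Carrier
      Q = q * q

    -- The range reaches 2D because `evenFactor q k` has exponent 2(k + 1) with k + 1 < D. These
    -- exponents miss the excluded value D since D is odd.
    module _ (1-qⁱ-regular : ∀ i → 0 < i → i < D ℕ.+ D → i ≢ D → Regular (1# - q ^ i))
             (nN³≈0 : n N ^ 3 ≈ 0#) where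

      private
        N<D : N < D
        N<D = s≤s (ℕ.m≤m+n N N)

        D≤D+D : D ≤ D ℕ.+ D
        D≤D+D = ℕ.m≤m+n D D

        n-regular : ∀ k → k < N → Regular (n k)
        n-regular k k<N = Regular-resp (sym (oddFactor≈ q k))
          (1-qⁱ-regular (suc (k ℕ.+ k)) (s≤s z≤n) (ℕ.<-≤-trans i<D D≤D+D) (ℕ.<⇒≢ i<D))
          where
          i<D : suc (k ℕ.+ k) < D
          i<D = s≤s (ℕ.+-mono-<-≤ k<N (ℕ.<⇒≤ k<N))

        d-regular : ∀ k → suc k < D → Regular (d k)
        d-regular k 1+k<D = Regular-resp (sym (evenFactor≈ q k))
          (1-qⁱ-regular (suc k ℕ.+ suc k) (s≤s z≤n) (ℕ.+-mono-< 1+k<D 1+k<D) (m+m≢1+n+n (suc k) N))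

        1-q-regular : Regular (1# - q)
        1-q-regular = Regular-resp (+-congˡ (-‿cong (*-identityʳ q)))
          (1-qⁱ-regular 1 (s≤s z≤n) (ℕ.<-≤-trans 1<D D≤D+D) (ℕ.<⇒≢ 1<D))
          where
          1<D : 1 < D
          1<D = s≤s (ℕ.<-≤-trans 0<N (ℕ.m≤m+n N N))

        p q⁻¹ : Carrier
        p = q * Q ^ N
        q⁻¹ = Q ^ N * (⟦ + 3 ⟧ℤ - ⟦ + 3 ⟧ℤ * p + p * p)

        -- (1 − p)³ ≈ 0 makes p, hence q, invertible
        qq⁻¹≈1 : q * q⁻¹ ≈ 1#
        qq⁻¹≈1 = begin
          q * (Q ^ N * (⟦ + 3 ⟧ℤ - ⟦ + 3 ⟧ℤ * p + p * p))
            ≈⟨ solve 2 (λ q x → q :* (x :* (con (+ 3) :- con (+ 3) :* (q :* x) :+ (q :* x) :* (q :* x)))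
                 := 1ᶜ :- (1ᶜ :- q :* x) :^ 3) refl q (Q ^ N) ⟩
          1# - n N ^ 3    ≈⟨ +-congˡ (trans (-‿cong nN³≈0) -0#≈0#) ⟩
          1# + 0#         ≈⟨ +-identityʳ 1# ⟩
          1#              ∎

        q-regular : Regular q
        q-regular y qy≈0 = begin
          y                ≈⟨ *-identityˡ y ⟨
          1# * y           ≈⟨ *-congʳ qq⁻¹≈1 ⟨
          q * q⁻¹ * y      ≈⟨ solve 3 (λ q r y → q :* r :* y := r :* (q :* y)) refl q q⁻¹ y ⟩
          q⁻¹ * (q * y)    ≈⟨ *-annihilates qy≈0 ⟩
          0#               ∎

      half-block : ∀ b → (∀ k → k < N → d k * b (suc k) ≈ n k * b k) →
                   q ^ N * ∑ (suc N) (summand q b) ≈ cubicSum q N b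
      half-block b b-rec = quintuple-sum q q⁻¹ qq⁻¹≈1 N b b-rec
        (λ k k<N → d-regular k (ℕ.≤-<-trans k<N N<D)) n-regular 1-q-regular nN³≈0

      module _ (b : ℕ → Carrier) (b-rec : ∀ k → suc k < D → d k * b (suc k) ≈ n k * b k) where

        private
          tail-step : ∀ k → suc k < D → n k ^ 3 * b k ^ 3 ≈ 0# → b (suc k) ^ 3 ≈ 0#
          tail-step k 1+k<D eq = Regular-^ 3 (d-regular k 1+k<D) _ (begin
            d k ^ 3 * b (suc k) ^ 3   ≈⟨ ^-distrib-* (d k) (b (suc k)) 3 ⟨
            (d k * b (suc k)) ^ 3     ≈⟨ ^-congˡ 3 (b-rec k 1+k<D) ⟩
            (n k * b k) ^ 3           ≈⟨ ^-distrib-* (n k) (b k) 3 ⟩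
            n k ^ 3 * b k ^ 3         ≈⟨ eq ⟩
            0#                        ∎)

          -- As `n N` is only nilpotent, `b k` itself need not vanish beyond `N`. The cubed
          -- recurrence carries `n N ^ 3 ≈ 0` forward, and the fifth power in `summand` contains the
          -- cube.
          tail : ∀ m → suc N ℕ.+ m < D → b (suc N ℕ.+ m) ^ 3 ≈ 0#
          tail zero lt rewrite ℕ.+-identityʳ N = tail-step N lt (trans (*-congʳ nN³≈0) (zeroˡ _))
          tail (suc m) lt rewrite ℕ.+-suc N m =
            tail-step (suc N ℕ.+ m) lt (*-annihilates (tail m (ℕ.<⇒≤ lt)))

          summand-tail : ∀ m → m < N → summand q b (suc N ℕ.+ m) ≈ 0#
          summand-tail m m<N = *-annihilates (begin
            b k ^ 5            ≈⟨ solve 1 (λ x → x :^ 5 := x :^ 3 :* x :^ 2) refl (b k) ⟩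
            b k ^ 3 * b k ^ 2  ≈⟨ *-congʳ (tail m (s≤s (ℕ.+-monoʳ-< N m<N))) ⟩
            0# * b k ^ 2       ≈⟨ zeroˡ _ ⟩
            0#                 ∎)
            where k = suc N ℕ.+ m

        full≈half : ∑ D (summand q b) ≈ ∑ (suc N) (summand q b)
        full≈half = begin
          ∑ (suc N ℕ.+ N) (summand q b)                                                ≈⟨ ∑-split (suc N) N _ ⟩
          ∑ (suc N) (summand q b) + ∑ N (λ k → summand q b (suc N ℕ.+ k))   ≈⟨ +-congˡ (∑-zero N summand-tail) ⟩
          ∑ (suc N) (summand q b) + 0#                                                 ≈⟨ +-identityʳ _ ⟩
          ∑ (suc N) (summand q b)                                                      ∎

        full-block : q ^ N * ∑ D (summand q b) ≈ cubicSum q N b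
        full-block = trans (*-congˡ full≈half)
          (half-block b λ k k<N → b-rec k (ℕ.≤-<-trans k<N N<D))

      module _ (q^D≈1 : q ^ D ≈ 1#) where

        private
          q^[lD]≈1 : ∀ l → q ^ (l ℕ.* D) ≈ 1#
          q^[lD]≈1 zero = refl
          q^[lD]≈1 (suc l) = trans (^-homo-* q D (l ℕ.* D)) (trans (*-cong q^D≈1 (q^[lD]≈1 l)) (*-identityˡ 1#))

          Q^[lD+k]≈ : ∀ l k → Q ^ (l ℕ.* D ℕ.+ k) ≈ Q ^ k
          Q^[lD+k]≈ l k = begin
            Q ^ (l ℕ.* D ℕ.+ k)                        ≈⟨ ^-homo-* Q (l ℕ.* D) k ⟩
            Q ^ (l ℕ.* D) * Q ^ k                      ≈⟨ *-congʳ (^-distrib-* q q (l ℕ.* D)) ⟩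
            q ^ (l ℕ.* D) * q ^ (l ℕ.* D) * Q ^ k      ≈⟨ *-congʳ (*-cong (q^[lD]≈1 l) (q^[lD]≈1 l)) ⟩
            1# * 1# * Q ^ k                            ≈⟨ solve 1 (λ x → 1ᶜ :* 1ᶜ :* x := x) refl _ ⟩
            Q ^ k                                      ∎

          Q^[1+lD+k]≈ : ∀ l k → Q ^ suc (l ℕ.* D ℕ.+ k) ≈ Q ^ suc k
          Q^[1+lD+k]≈ l k = *-congˡ (Q^[lD+k]≈ l k)

          -- The ratios -Q^(k+1) of successive values are periodic, so passing to block `l`
          -- multiplies `τ` by a constant, which does no harm to a block sum that vanishes.
          τ-periodic : ∀ l k → τ q (l ℕ.* D ℕ.+ k) ≈ τ q (l ℕ.* D) * τ q k
          τ-periodic l zero = trans (reflexive (≡.cong (τ q) (ℕ.+-identityʳ (l ℕ.* D)))) (sym (*-identityʳ _))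
          τ-periodic l (suc k) rewrite ℕ.+-suc (l ℕ.* D) k = begin
            - (Q ^ suc (l ℕ.* D ℕ.+ k) * τ q (l ℕ.* D ℕ.+ k))   ≈⟨ -‿cong (*-cong (Q^[1+lD+k]≈ l k) (τ-periodic l k)) ⟩
            - (Q ^ suc k * (τ q (l ℕ.* D) * τ q k))
              ≈⟨ solve 3 (λ x t u → :- (x :* (t :* u)) := t :* (:- (x :* u))) refl (Q ^ suc k) _ _ ⟩
            τ q (l ℕ.* D) * τ q (suc k)                         ∎

          -- After multiplication by the regular element 1 - q only the periodic power q^(4k+1) is
          -- left.
          geom-periodic : ∀ l k → geom q (4 ℕ.* (l ℕ.* D ℕ.+ k) ℕ.+ 1) ≈ geom q (4 ℕ.* k ℕ.+ 1)
          geom-periodic l k = Regular-cancel 1-q-regular (begin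
            (1# - q) * geom q (4 ℕ.* (l ℕ.* D ℕ.+ k) ℕ.+ 1)   ≈⟨ w-closed q q⁻¹ (l ℕ.* D ℕ.+ k) ⟩
            1# - q * (Q ^ (l ℕ.* D ℕ.+ k) * Q ^ (l ℕ.* D ℕ.+ k))
              ≈⟨ +-congˡ (-‿cong (*-congˡ (*-cong (Q^[lD+k]≈ l k) (Q^[lD+k]≈ l k)))) ⟩
            1# - q * (Q ^ k * Q ^ k)                          ≈⟨ w-closed q q⁻¹ k ⟨
            (1# - q) * geom q (4 ℕ.* k ℕ.+ 1)                 ∎)

          geom-D≈0 : geom q D ≈ 0#
          geom-D≈0 = 1-q-regular _ (trans (geom-closed q D) (trans (+-congˡ (-‿cong q^D≈1)) (-‿inverseʳ 1#)))

          cubic≈0 : ∀ b → cubicSum q N b ≈ 0#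
          cubic≈0 b = trans (*-congʳ (trans (*-congʳ geom-D≈0) (zeroˡ _))) (zeroˡ _)

        module _ (b : ℕ → Carrier) (M : ℕ) (b-rec : ∀ k → suc k < M → d k * b (suc k) ≈ n k * b k) where

          private
            shifted : ℕ → ℕ → Carrier
            shifted l k = b (l ℕ.* D ℕ.+ k)

            -- The coefficients depend only on the position `k` in the block. This is applied for
            -- suc k < D only: at the end of a block `evenFactor` is zero, so the values in the next
            -- block start from a free constant.
            shifted-rec : ∀ l k → suc (l ℕ.* D ℕ.+ k) < M → d k * shifted l (suc k) ≈ n k * shifted l k
            shifted-rec l k lt rewrite ℕ.+-suc (l ℕ.* D) k = begin
              d k * b (suc (l ℕ.* D ℕ.+ k))                        ≈⟨ *-congʳ (+-congˡ (-‿cong (Q^[1+lD+k]≈ l k))) ⟨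
              d (l ℕ.* D ℕ.+ k) * b (suc (l ℕ.* D ℕ.+ k))          ≈⟨ b-rec _ lt ⟩
              n (l ℕ.* D ℕ.+ k) * b (l ℕ.* D ℕ.+ k)                ≈⟨ *-congʳ (+-congˡ (-‿cong (*-congˡ (Q^[lD+k]≈ l k)))) ⟩
              n k * b (l ℕ.* D ℕ.+ k)                              ∎

            block≈ : ∀ m l → ∑ m (λ k → summand q b (l ℕ.* D ℕ.+ k)) ≈ τ q (l ℕ.* D) * ∑ m (summand q (shifted l))
            block≈ m l = trans (∑-cong m λ k _ → trans
              (*-congʳ (*-cong (τ-periodic l k) (geom-periodic l k)))
              (solve 4 (λ t u g x → (t :* u) :* g :* x := t :* (u :* g :* x)) refl _ _ _ _))
              (sym (∑-*ˡ m _ _))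

            q^N-cancel : ∀ {x} → q ^ N * x ≈ 0# → x ≈ 0#
            q^N-cancel = Regular-^ N q-regular _

            half-block≈0 : ∀ l → l ℕ.* D ℕ.+ N < M → ∑ (suc N) (λ k → summand q b (l ℕ.* D ℕ.+ k)) ≈ 0#
            half-block≈0 l lt = trans (block≈ (suc N) l) (*-annihilates (q^N-cancel (trans
              (half-block (shifted l) λ k k<N →
                shifted-rec l k (ℕ.≤-<-trans (ℕ.≤-trans (ℕ.≤-reflexive (≡.sym (ℕ.+-suc (l ℕ.* D) k))) (ℕ.+-monoʳ-≤ (l ℕ.* D) k<N)) lt))
              (cubic≈0 (shifted l)))))

            full-block≈0 : ∀ l → l ℕ.* D ℕ.+ D ≤ M → ∑ D (λ k → summand q b (l ℕ.* D ℕ.+ k)) ≈ 0#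
            full-block≈0 l le = trans (block≈ D l) (*-annihilates (q^N-cancel (trans
              (full-block (shifted l) λ k 1+k<D →
                shifted-rec l k (ℕ.<-≤-trans (ℕ.≤-<-trans (ℕ.≤-reflexive (≡.sym (ℕ.+-suc (l ℕ.* D) k))) (ℕ.+-monoʳ-< (l ℕ.* D) 1+k<D)) le))
              (cubic≈0 (shifted l)))))

          full-blocks≈0 : ∀ l → l ℕ.* D ≤ M → ∑ (l ℕ.* D) (summand q b) ≈ 0#
          full-blocks≈0 zero _ = refl
          full-blocks≈0 (suc l) le = begin
            ∑ (D ℕ.+ l ℕ.* D) (summand q b)     ≡⟨ ≡.cong (λ m → ∑ m (summand q b)) (ℕ.+-comm D (l ℕ.* D)) ⟩
            ∑ (l ℕ.* D ℕ.+ D) (summand q b)     ≈⟨ ∑-split (l ℕ.* D) D _ ⟩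
            ∑ (l ℕ.* D) (summand q b) + ∑ D (λ k → summand q b (l ℕ.* D ℕ.+ k))
              ≈⟨ +-cong (full-blocks≈0 l (ℕ.≤-trans (ℕ.m≤n+m _ D) le)) (full-block≈0 l (ℕ.≤-trans (ℕ.≤-reflexive (ℕ.+-comm _ D)) le)) ⟩
            0# + 0#                             ≈⟨ +-identityˡ 0# ⟩
            0#                                  ∎

          half-blocks≈0 : ∀ l → l ℕ.* D ℕ.+ N < M → ∑ (l ℕ.* D ℕ.+ suc N) (summand q b) ≈ 0#
          half-blocks≈0 l lt = begin
            ∑ (l ℕ.* D ℕ.+ suc N) (summand q b)    ≈⟨ ∑-split (l ℕ.* D) (suc N) _ ⟩
            ∑ (l ℕ.* D) (summand q b) + ∑ (suc N) (λ k → summand q b (l ℕ.* D ℕ.+ k))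
              ≈⟨ +-cong (full-blocks≈0 l (ℕ.≤-trans (ℕ.m≤m+n _ N) (ℕ.<⇒≤ lt))) (half-block≈0 l lt) ⟩
            0# + 0#                                ≈⟨ +-identityˡ 0# ⟩
            0#                                     ∎

-- Gaussian binomial coefficients

module CentralBinomials {c ℓ : Level} (R : CommutativeRing c ℓ) where
  open CommutativeRing R hiding (zero)
  open FiniteSums R
  open QuintupleSum R using (oddFactor; evenFactor)
  open BlockSums R using (oddFactor≈; evenFactor≈)
  open import Relation.Binary.Reasoning.Setoid setoid

  module _ (q : Carrier) where

    -- The q-Pascal rule for the Gaussian binomial [i + j, i], which is thereby a polynomial in `q`
    -- by construction.
    gaussian : ℕ → ℕ → Carrier
    gaussian zero j = 1#
    gaussian (suc i) zero = 1#
    gaussian (suc i) (suc j) = gaussian i (suc j) + q ^ suc i * gaussian (suc i) j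

    -- In this order (q;q)_k, not divided by (1 - q)^k, then (q;q²)_k, (q²;q²)_k and (-q;q)_k.
    qFactorial oddProduct evenProduct plusProduct : ℕ → Carrier
    qFactorial k = ∏ k (λ i → 1# - q ^ suc i)
    oddProduct k = ∏ k (oddFactor q)
    evenProduct k = ∏ k (evenFactor q)
    plusProduct k = ∏ k (λ i → 1# + q ^ suc i)

    -- The induction step is (1 - x) + x (1 - y) = 1 - x y for x = q^(i+1) and y = q^(j+1).
    gaussian-qFactorial : ∀ i j → gaussian i j * qFactorial i * qFactorial j ≈ qFactorial (i ℕ.+ j)
    gaussian-qFactorial zero j = solve 1 (λ x → 1ᶜ :* 1ᶜ :* x := x) refl _
    gaussian-qFactorial (suc i) zero =
      trans (solve 1 (λ x → 1ᶜ :* x :* 1ᶜ := x) refl _) (reflexive (≡.cong qFactorial (≡.sym (ℕ.+-identityʳ (suc i)))))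
    gaussian-qFactorial (suc i) (suc j) = begin
      (g₁ + x * g₂) * (qFactorial i * (1# - x)) * (qFactorial j * (1# - y))
        ≈⟨ solve 6 (λ g₁ g₂ x y a b → (g₁ :+ x :* g₂) :* (a :* (1ᶜ :- x)) :* (b :* (1ᶜ :- y))
             := (1ᶜ :- x) :* (g₁ :* a :* (b :* (1ᶜ :- y))) :+ x :* (1ᶜ :- y) :* (g₂ :* (a :* (1ᶜ :- x)) :* b))
             refl g₁ g₂ x y (qFactorial i) (qFactorial j) ⟩
      (1# - x) * (g₁ * qFactorial i * qFactorial (suc j)) + x * (1# - y) * (g₂ * qFactorial (suc i) * qFactorial j)
        ≈⟨ +-cong (*-congˡ (gaussian-qFactorial i (suc j)))
                  (*-congˡ (trans (gaussian-qFactorial (suc i) j) (reflexive (≡.cong qFactorial (≡.sym (ℕ.+-suc i j)))))) ⟩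
      (1# - x) * z + x * (1# - y) * z
        ≈⟨ solve 3 (λ x y z → (1ᶜ :- x) :* z :+ x :* (1ᶜ :- y) :* z := z :* (1ᶜ :- x :* y)) refl x y z ⟩
      z * (1# - x * y)                              ≈⟨ *-congˡ (+-congˡ (-‿cong (^-homo-* q (suc i) (suc j)))) ⟨
      qFactorial (suc i ℕ.+ suc j)                  ∎
      where
      g₁ = gaussian i (suc j) ; g₂ = gaussian (suc i) j ; x = q ^ suc i ; y = q ^ suc j ; z = qFactorial (i ℕ.+ suc j)

    qFactorial-double : ∀ k → qFactorial (k ℕ.+ k) ≈ oddProduct k * evenProduct k
    qFactorial-double zero = sym (*-identityˡ 1#)
    qFactorial-double (suc k) rewrite ℕ.+-suc k k = begin
      qFactorial (k ℕ.+ k) * (1# - q ^ suc (k ℕ.+ k)) * (1# - q ^ suc (suc (k ℕ.+ k)))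
        ≈⟨ *-cong (*-cong (qFactorial-double k) (sym (oddFactor≈ q k)))
                  (trans (reflexive (≡.cong (λ m → 1# - q ^ suc m) (≡.sym (ℕ.+-suc k k)))) (sym (evenFactor≈ q k))) ⟩
      oddProduct k * evenProduct k * oddFactor q k * evenFactor q k
        ≈⟨ solve 4 (λ a b c d → a :* b :* c :* d := a :* c :* (b :* d)) refl _ _ _ _ ⟩
      oddProduct (suc k) * evenProduct (suc k) ∎

    evenProduct≈ : ∀ k → evenProduct k ≈ qFactorial k * plusProduct k
    evenProduct≈ k = trans (∏-cong k λ i _ → trans (+-congˡ (-‿cong (^-distrib-* q q (suc i))))
        (solve 1 (λ x → 1ᶜ :- x :* x := (1ᶜ :- x) :* (1ᶜ :+ x)) refl (q ^ suc i)))
      (∏-* k _ _)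

    module _ (1-qⁱ-regular : ∀ i → Regular (1# - q ^ suc i)) where

      private
        qFactorial-regular : ∀ k → Regular (qFactorial k)
        qFactorial-regular k = Regular-∏ k λ i _ → 1-qⁱ-regular i

        evenProduct-regular : ∀ k → Regular (evenProduct k)
        evenProduct-regular k = Regular-∏ k λ i _ → Regular-resp (sym (evenFactor≈ q i)) (1-qⁱ-regular (i ℕ.+ suc i))

      -- Follows from (q;q)_(2k) = (q;q²)_k (q²;q²)_k and (q²;q²)_k = (q;q)_k (-q;q)_k after
      -- cancelling one (q;q)_k.
      centralBinomial : ∀ k → gaussian k k * evenProduct k ≈ oddProduct k * (plusProduct k * plusProduct k)
      centralBinomial k = Regular-cancel (qFactorial-regular k) (begin
        qFactorial k * (gaussian k k * evenProduct k)                   ≈⟨ *-congˡ (*-congˡ (evenProduct≈ k)) ⟩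
        qFactorial k * (gaussian k k * (qFactorial k * plusProduct k))
          ≈⟨ solve 3 (λ f g w → f :* (g :* (f :* w)) := (g :* f :* f) :* w) refl _ _ _ ⟩
        gaussian k k * qFactorial k * qFactorial k * plusProduct k      ≈⟨ *-congʳ (trans (gaussian-qFactorial k k) (qFactorial-double k)) ⟩
        oddProduct k * evenProduct k * plusProduct k                    ≈⟨ *-congʳ (*-congˡ (evenProduct≈ k)) ⟩
        oddProduct k * (qFactorial k * plusProduct k) * plusProduct k
          ≈⟨ solve 3 (λ o f w → o :* (f :* w) :* w := f :* (o :* (w :* w))) refl _ _ _ ⟩
        qFactorial k * (oddProduct k * (plusProduct k * plusProduct k)) ∎)

      module _ (m : ℕ) where

        -- (q;q²)ₖ/(q²;q²)ₖ times the square of (−q;q)ₘ, a polynomial for k ≤ m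
        scaledRatio : ℕ → Carrier
        scaledRatio k = gaussian k k * (V * V)
          where V = ∏ (m ∸ k) (λ i → 1# + q ^ suc (k ℕ.+ i))

        scaledRatio-value : ∀ k → k ≤ m → scaledRatio k * evenProduct k ≈ oddProduct k * (plusProduct m * plusProduct m)
        scaledRatio-value k k≤m = begin
          gaussian k k * (V * V) * evenProduct k                ≈⟨ solve 3 (λ g v e → g :* (v :* v) :* e := (g :* e) :* (v :* v)) refl _ _ _ ⟩
          gaussian k k * evenProduct k * (V * V)                ≈⟨ *-congʳ (centralBinomial k) ⟩
          oddProduct k * (plusProduct k * plusProduct k) * (V * V)
            ≈⟨ solve 3 (λ o w v → o :* (w :* w) :* (v :* v) := o :* ((w :* v) :* (w :* v))) refl _ _ _ ⟩
          oddProduct k * ((plusProduct k * V) * (plusProduct k * V))  ≈⟨ *-congˡ (*-cong WV≈ WV≈) ⟩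
          oddProduct k * (plusProduct m * plusProduct m)        ∎
          where
          V = ∏ (m ∸ k) (λ i → 1# + q ^ suc (k ℕ.+ i))
          WV≈ : plusProduct k * V ≈ plusProduct m
          WV≈ = trans (sym (∏-split k (m ∸ k) _)) (reflexive (≡.cong plusProduct (ℕ.m+[n∸m]≡n k≤m)))

        scaledRatio-rec : ∀ k → k < m → evenFactor q k * scaledRatio (suc k) ≈ oddFactor q k * scaledRatio k
        scaledRatio-rec k k<m = Regular-cancel (evenProduct-regular k) (begin
          evenProduct k * (evenFactor q k * scaledRatio (suc k))
            ≈⟨ solve 3 (λ e d b → e :* (d :* b) := b :* (e :* d)) refl _ _ _ ⟩
          scaledRatio (suc k) * evenProduct (suc k)             ≈⟨ scaledRatio-value (suc k) k<m ⟩
          oddProduct k * oddFactor q k * (plusProduct m * plusProduct m)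
            ≈⟨ solve 3 (λ o n w → o :* n :* w := n :* (o :* w)) refl _ _ _ ⟩
          oddFactor q k * (oddProduct k * (plusProduct m * plusProduct m))   ≈⟨ *-congˡ (scaledRatio-value k (ℕ.<⇒≤ k<m)) ⟨
          oddFactor q k * (scaledRatio k * evenProduct k)
            ≈⟨ solve 3 (λ n b e → n :* (b :* e) := e :* (n :* b)) refl _ _ _ ⟩
          evenProduct k * (oddFactor q k * scaledRatio k)       ∎)

-- Odd numbers and their factors

parity : ∀ k → (∃ λ j → k ≡ j ℕ.+ j) ⊎ (∃ λ j → k ≡ suc (j ℕ.+ j))
parity zero = inj₁ (0 , ≡.refl)
parity (suc k) with parity k
... | inj₁ (j , ≡.refl) = inj₂ (j , ≡.refl)
... | inj₂ (j , ≡.refl) = inj₁ (suc j , ≡.cong suc (≡.sym (ℕ.+-suc j j)))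

m+m≡n+n⇒m≡n : ∀ m n → m ℕ.+ m ≡ n ℕ.+ n → m ≡ n
m+m≡n+n⇒m≡n m n eq = ℕ.*-cancelˡ-≡ m n 2
  (≡.subst₂ (λ x y → m ℕ.+ x ≡ n ℕ.+ y) (≡.sym (ℕ.+-identityʳ m)) (≡.sym (ℕ.+-identityʳ n)) eq)

-- Factors of an odd number are odd. With d = 2d' + 1 the last equation says that the indices 0,
-- ..., N consist of l' whole blocks of length d and the first d' + 1 indices of one more.
odd-product : ∀ l d N → l ℕ.* d ≡ suc (N ℕ.+ N) →
              ∃₂ λ l' d' → l ≡ suc (l' ℕ.+ l') × d ≡ suc (d' ℕ.+ d') × N ≡ l' ℕ.* suc (d' ℕ.+ d') ℕ.+ d'
odd-product l d N eq with parity l | parity d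
... | inj₁ (j , ≡.refl) | _ = ⊥-elim (m+m≢1+n+n (j ℕ.* d) N (≡.trans (≡.sym (ℕ.*-distribʳ-+ d j j)) eq))
... | inj₂ _ | inj₁ (j , ≡.refl) = ⊥-elim (m+m≢1+n+n (l ℕ.* j) N (≡.trans (≡.sym (ℕ.*-distribˡ-+ l j j)) eq))
... | inj₂ (l' , ≡.refl) | inj₂ (d' , ≡.refl) = l' , d' , ≡.refl , ≡.refl ,
  m+m≡n+n⇒m≡n N _ (ℕ.suc-injective (≡.trans (≡.sym eq) (expand l' d')))
  where
  expand : ∀ l d → suc (l ℕ.+ l) ℕ.* suc (d ℕ.+ d) ≡ suc ((l ℕ.* suc (d ℕ.+ d) ℕ.+ d) ℕ.+ (l ℕ.* suc (d ℕ.+ d) ℕ.+ d))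
  expand = solve-∀

-- Divisibility by [n]Φₙ²

module Supercongruence {c ℓ : Level} (R : CommutativeRing c ℓ) where
  open CommutativeRing R hiding (zero)
  open FiniteSums R
  open QuintupleSum R using (geom; geom-closed; oddFactor; evenFactor; summand; cubicSum; defect)
  open Divisors R renaming (_,_ to _by_)
  open CyclotomicFactors R
  open BlockSums R using (oddFactor≈)
  open import Relation.Binary.Reasoning.Setoid setoid

  module _ (q : Carrier) (b : ℕ → Carrier) where

    private
      1-qⁱ∣ : ∀ {f i} → Comaximal f (xⁿ-1 q i) → Comaximal f (1# - q ^ i)
      1-qⁱ∣ {f} {i} = Comaximal-ideal (- 1#) (∣-resp (solve 1 (λ x → con (+ 0) := (x :- 1ᶜ) :- (:- 1ᶜ) :* (1ᶜ :- x)) refl (q ^ i)) ∣-0)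

    -- Applied twice: with `f` equal to Φ_d and D = d, and with `f` equal to Φ_n³ and D = n.
    module Modulo (f : Carrier) (saturated : Saturated f) (D' : ℕ) (0<D' : 0 < D')
                  (comaximal-with : ∀ i → ¬ suc (D' ℕ.+ D') ℕ.∣ i → Comaximal f (xⁿ-1 q i)) where

      open QuotientRing R f
      private
        module M = CommutativeRing R/f
        module MΣ = FiniteSums R/f
        module MQ = QuintupleSum R/f
        module MB = BlockSums R/f

        D : ℕ
        D = suc (D' ℕ.+ D')

      nonmultiple : ∀ i → 0 < i → i < D ℕ.+ D → i ≢ D → ¬ D ℕ.∣ i
      nonmultiple i 0<i i<2D i≢D (divides 0 eq) = ℕ.<⇒≢ 0<i (≡.sym eq)
      nonmultiple i 0<i i<2D i≢D (divides 1 eq) = i≢D (≡.trans eq (ℕ.+-identityʳ D))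
      nonmultiple i 0<i i<2D i≢D (divides (suc (suc t)) eq) = ℕ.<⇒≱ i<2D (≡.subst (D ℕ.+ D ≤_) (≡.sym eq)
        (ℕ.+-monoʳ-≤ D (ℕ.m≤m+n D (t ℕ.* D))))

      1-qⁱ-regular : ∀ i → 0 < i → i < D ℕ.+ D → i ≢ D → MΣ.Regular (M.1# M.- q MΣ.^ i)
      1-qⁱ-regular i 0<i i<2D i≢D = MΣ.Regular-resp (M.+-congˡ (M.-‿cong (^-mod q i)))
        (Comaximal⇒Regular saturated (1-qⁱ∣ {i = i} (comaximal-with i (nonmultiple i 0<i i<2D i≢D))))

      recurrence-mod : ∀ k → evenFactor q k * b (suc k) ≈ oddFactor q k * b k →
                       MQ.evenFactor q k M.* b (suc k) M.≈ MQ.oddFactor q k M.* b k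
      recurrence-mod k eq = M.trans (M.*-congʳ (M.sym (evenFactor-mod q k)))
        (M.trans (≈⇒≡ₘ eq) (M.*-congʳ (oddFactor-mod q k)))

      nil-mod : f ∣ oddFactor q D' ^ 3 → MQ.oddFactor q D' MΣ.^ 3 M.≈ M.0#
      nil-mod f∣ = M.trans (M.sym (M.trans (^-mod _ 3) (MΣ.^-congˡ 3 (oddFactor-mod q D')))) (∣⇒≡ₘ0 f∣)

      ∣-defect : ∀ m → q MΣ.^ D' M.* MΣ.∑ m (MQ.summand q b) M.≈ MQ.cubicSum q D' b → f ∣ defect q D' b m
      ∣-defect m eq = ≡ₘ0⇒∣ (M.trans (defect-mod q D' b m) (MΣ.x≈y⇒x-y≈0 eq))

      ∣-defect-cube : f ∣ oddFactor q D' ^ 3 → (∀ k → suc k < D → evenFactor q k * b (suc k) ≈ oddFactor q k * b k) →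
                      f ∣ defect q D' b D × f ∣ defect q D' b (suc D')
      ∣-defect-cube f∣ b-rec =
          ∣-defect D (MB.full-block q D' 0<D' 1-qⁱ-regular (nil-mod f∣) b (λ k lt → recurrence-mod k (b-rec k lt)))
        , ∣-defect (suc D') (MB.half-block q D' 0<D' 1-qⁱ-regular (nil-mod f∣) b
            (λ k k<D' → recurrence-mod k (b-rec k (s≤s (ℕ.<-≤-trans k<D' (ℕ.m≤m+n D' D'))))))

      ∣-sum : ∀ m → MΣ.∑ m (MQ.summand q b) M.≈ M.0# → f ∣ ∑ m (summand q b)
      ∣-sum m eq = ≡ₘ0⇒∣ (M.trans (∑-mod m (summand-mod q b)) eq)

      -- Here both parts of the defect are divisible by `f` separately: the sum block by block, and
      -- `cubicSum` through [n], since `f` divides qⁿ - 1 and is comaximal with q - 1.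
      ∣-defect-blocks : f ∣ xⁿ-1 q D → ∀ N l' → N ≡ l' ℕ.* D ℕ.+ D' → suc (l' ℕ.+ l') ℕ.* D ≡ suc (N ℕ.+ N) →
                        (∀ k → suc k < suc (N ℕ.+ N) → evenFactor q k * b (suc k) ≈ oddFactor q k * b k) →
                        f ∣ defect q N b (suc (N ℕ.+ N)) × f ∣ defect q N b (suc N)
      ∣-defect-blocks f∣ N l' N≡ n≡ b-rec =
          ∣-+ (∣-*ˡ (q ^ N) (≡.subst (λ m → f ∣ ∑ m (summand q b)) n≡ (∣-sum (suc (l' ℕ.+ l') ℕ.* D)
            (MB.full-blocks≈0 q D' 0<D' 1-qⁱ-regular nil q^D≈1 b n rec (suc (l' ℕ.+ l')) (ℕ.≤-reflexive n≡)))))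
            f∣cubic
        , ∣-+ (∣-*ˡ (q ^ N) (≡.subst (λ m → f ∣ ∑ m (summand q b)) 1+N≡ (∣-sum (l' ℕ.* D ℕ.+ suc D')
            (MB.half-blocks≈0 q D' 0<D' 1-qⁱ-regular nil q^D≈1 b n rec l' (s≤s (≡.subst (_≤ N ℕ.+ N) N≡ (ℕ.m≤m+n N N)))))))
            f∣cubic
        where
        n = suc (N ℕ.+ N)
        1+N≡ : l' ℕ.* D ℕ.+ suc D' ≡ suc N
        1+N≡ = ≡.trans (ℕ.+-suc (l' ℕ.* D) D') (≡.cong suc (≡.sym N≡))
        rec : ∀ k → suc k < n → MQ.evenFactor q k M.* b (suc k) M.≈ MQ.oddFactor q k M.* b k
        rec k lt = recurrence-mod k (b-rec k lt)
        q^D≈1 : q MΣ.^ D M.≈ M.1#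
        q^D≈1 = M.trans (M.sym (^-mod q D)) (mod f∣)
        f∣1-q^D : f ∣ 1# - q ^ D
        f∣1-q^D = ∣-resp (solve 1 (λ x → :- (x :- 1ᶜ) := 1ᶜ :- x) refl (q ^ D)) (∣-neg f∣)
        nil : MQ.oddFactor q D' MΣ.^ 3 M.≈ M.0#
        nil = nil-mod (∣-*ʳ _ (∣-resp (sym (oddFactor≈ q D')) f∣1-q^D))
        f∣q^n-1 : f ∣ xⁿ-1 q n
        f∣q^n-1 = ∣-trans f∣ (≡.subst (λ m → xⁿ-1 q D ∣ xⁿ-1 q m) (≡.trans (ℕ.*-comm D (suc (l' ℕ.+ l'))) n≡) (^-∣ q D (suc (l' ℕ.+ l'))))
        1<D : 1 < D
        1<D = s≤s (ℕ.<-≤-trans 0<D' (ℕ.m≤m+n D' D'))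
        f∣geom : f ∣ geom q n
        f∣geom = Comaximal-cancel (1-qⁱ∣ {i = 1} (comaximal-with 1 (nonmultiple 1 (s≤s z≤n) (ℕ.<-≤-trans 1<D (ℕ.m≤m+n D D)) (ℕ.<⇒≢ 1<D)))) saturated
          (∣-resp (trans (solve 1 (λ x → :- (x :- 1ᶜ) := 1ᶜ :- x) refl (q ^ n))
            (trans (sym (geom-closed q n)) (*-congʳ (+-congˡ (-‿cong (sym (*-identityʳ q))))))) (∣-neg f∣q^n-1))
        f∣cubic : f ∣ - cubicSum q N b
        f∣cubic = ∣-neg (∣-*ʳ _ (∣-*ʳ _ f∣geom))

    module _ (Φ : ℕ → Carrier)
             (factorisation : ∀ m → Factorisation q Φ m)
             (Φ^-saturated : ∀ m e → Saturated (Φ (suc m) ^ e))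
             (xⁿ-1-regular : ∀ n → Regular (xⁿ-1 q (suc n))) where

      private
        Φ-saturated : ∀ m → Saturated (Φ (suc m))
        Φ-saturated m k x k≢0 f∣ = ∣-respˡ (*-identityʳ _) (Φ^-saturated m 1 k x k≢0 (∣-respˡ (sym (*-identityʳ _)) f∣))

        Φ∣ : ∀ m → Φ (suc m) ∣ xⁿ-1 q (suc m)
        Φ∣ m = ∣-resp (factorisation m) (∣-factorˡ _ _)

        Φ-comaximal : ∀ m i → ¬ suc m ℕ.∣ i → Comaximal (Φ (suc m)) (xⁿ-1 q i)
        Φ-comaximal m i = Comaximal-nonmultiple q Φ xⁿ-1-regular m i λ e _ → factorisation e

        q-1 : Carrier
        q-1 = xⁿ-1 q 1

      module _ (N : ℕ) (b-rec : ∀ k → suc k < suc (N ℕ.+ N) → evenFactor q k * b (suc k) ≈ oddFactor q k * b k) where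

        private
          m n : ℕ
          m = N ℕ.+ N
          n = suc m

        modulus : Carrier
        modulus = geom q n * Φ n * Φ n

        Φ-divides-defects : ∀ e → 0 < e → suc e ℕ.∣ n → Φ (suc e) ∣ defect q N b n × Φ (suc e) ∣ defect q N b (suc N)
        Φ-divides-defects e 0<e (divides l n≡l*d) with odd-product l (suc e) N (≡.sym n≡l*d)
        Φ-divides-defects _ () _ | l' , zero , ≡.refl , ≡.refl , N≡
        Φ-divides-defects _ _ (divides _ n≡l*d) | l' , suc d' , ≡.refl , ≡.refl , N≡ =
          Modulo.∣-defect-blocks (Φ (suc (suc d' ℕ.+ suc d'))) (Φ-saturated (suc d' ℕ.+ suc d')) (suc d') (s≤s z≤n)
            (Φ-comaximal (suc d' ℕ.+ suc d')) (Φ∣ (suc d' ℕ.+ suc d')) N l' N≡ (≡.sym n≡l*d) b-rec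

        Φ³-divides-defects : 0 < N → Φ n ^ 3 ∣ defect q N b n × Φ n ^ 3 ∣ defect q N b (suc N)
        Φ³-divides-defects 0<N = Modulo.∣-defect-cube (Φ n ^ 3) (Φ^-saturated m 3) N 0<N
          (λ i n∤i → Comaximal-sym (Comaximal-^ 3 (Comaximal-sym (Φ-comaximal m i n∤i))))
          (∣-pres-* Φ∣odd (∣-pres-* Φ∣odd (∣-pres-* Φ∣odd ∣-refl))) b-rec
          where
          Φ∣odd : Φ n ∣ oddFactor q N
          Φ∣odd = ∣-resp (trans (solve 1 (λ x → :- (x :- 1ᶜ) := 1ᶜ :- x) refl (q ^ n)) (sym (oddFactor≈ q N))) (∣-neg (Φ∣ m))

        -- Nothing is assumed about Φ_1 and y, and [n] lacks that factor. Multiplication by q - 1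
        -- settles both: (q - 1)[n]Φ_n² = Π Φ_n³, where `Π` is the product of Φ_d over the proper
        -- divisors d of n.
        modulus-∣ : ∀ {y} → (∀ e → 0 < e → suc e ℕ.∣ n → Φ (suc e) ∣ y) → Φ n ^ 3 ∣ y → modulus ∣ y
        modulus-∣ {y} Φ∣y Φ³∣y = h by Regular-cancel (xⁿ-1-regular 0) (begin
            q-1 * (h * modulus)
              ≈⟨ solve 4 (λ s h g p → s :* (h :* (g :* p :* p)) := h :* ((s :* g) :* (p :* p))) refl q-1 h (geom q n) (Φ n) ⟩
            h * (q-1 * geom q n * (Φ n * Φ n))       ≈⟨ *-congˡ (*-congʳ q-1*geom≈) ⟩
            h * (Φ n * Π * (Φ n * Φ n))
              ≈⟨ solve 3 (λ h p r → h :* (p :* r :* (p :* p)) := h :* (r :* p :^ 3)) refl h (Φ n) Π ⟩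
            h * (Π * Φ n ^ 3)                        ≈⟨ _∣_.equality ΠΦ³∣ ⟩
            q-1 * y                                  ∎)
          where
          Π : Carrier
          Π = properProduct q Φ m
          Π∣ : Π ∣ q-1 * y
          Π∣ = divisorProduct-∣ q Φ xⁿ-1-regular n m (λ e _ → factorisation e) (λ e _ → Φ-saturated e) φ∣
            where
            φ∣ : ∀ e → e < m → divisorFactor q Φ n (suc e) ∣ q-1 * y
            φ∣ zero _ = divisorFactor-elim q Φ (_∣ q-1 * y) n 1
              (λ _ → ∣-*ʳ y (Φ∣ 0)) (λ _ → _ by *-identityʳ _)
            φ∣ (suc e) _ = divisorFactor-elim q Φ (_∣ q-1 * y) n (suc (suc e))
              (λ d∣n → ∣-*ˡ q-1 (Φ∣y (suc e) (s≤s z≤n) d∣n)) (λ _ → _ by *-identityʳ _)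
          Φ⊥Π : Comaximal (Φ n) Π
          Φ⊥Π = Comaximal-∏ m λ e e<m → divisorFactor-elim q Φ (Comaximal (Φ n)) n (suc e)
            (λ _ → Comaximal-distinct q Φ xⁿ-1-regular m e (λ k _ → factorisation k) (λ m≡e → ℕ.<⇒≢ e<m (≡.sym m≡e)))
            (λ _ → Comaximal-1 _)
          ΠΦ³∣ : Π * Φ n ^ 3 ∣ q-1 * y
          ΠΦ³∣ = Comaximal-*-∣ (Comaximal-^ 3 (Comaximal-sym Φ⊥Π)) (Φ^-saturated m 3) Π∣ (∣-*ˡ q-1 Φ³∣y)
          h : Carrier
          h = _∣_.quotient ΠΦ³∣
          q-1*geom≈ : q-1 * geom q n ≈ Φ n * Π
          q-1*geom≈ = begin
            q-1 * geom q n             ≈⟨ solve 2 (λ q g → (q :* 1ᶜ :- 1ᶜ) :* g := :- ((1ᶜ :- q) :* g)) refl q (geom q n) ⟩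
            - ((1# - q) * geom q n)    ≈⟨ -‿cong (geom-closed q n) ⟩
            - (1# - q ^ n)             ≈⟨ solve 1 (λ x → :- (1ᶜ :- x) := x :- 1ᶜ) refl (q ^ n) ⟩
            xⁿ-1 q n                   ≈⟨ factorisation m ⟨
            Φ n * Π                    ∎

        modulus-divides-defects : 0 < N → modulus ∣ defect q N b n × modulus ∣ defect q N b (suc N)
        modulus-divides-defects 0<N =
            modulus-∣ (λ e 0<e d∣n → proj₁ (Φ-divides-defects e 0<e d∣n)) (proj₁ (Φ³-divides-defects 0<N))
          , modulus-∣ (λ e 0<e d∣n → proj₂ (Φ-divides-defects e 0<e d∣n)) (proj₂ (Φ³-divides-defects 0<N))

    -- The case n = 1, outside the general argument because there 1 - qⁿ is 1 - q, which would have
    -- to be nilpotent and regular at once. Both parts of the defect are `b 0 ^ 5`.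
    defect-zero : defect q 0 b 1 ≈ 0#
    defect-zero = solve 1 (λ b → 1ᶜ :* (con (+ 0) :+ 1ᶜ :* (con (+ 0) :+ 1ᶜ) :* b :^ 5)
      :- (con (+ 0) :+ 1ᶜ) :* (b :* b) :* (con (+ 0) :+ b :^ 3 :* 1ᶜ) := con (+ 0)) refl (b 0)

-- Comaximality of qⁿ - 1 with the factors of the denominators

module DenominatorComaximality {c ℓ : Level} (R : CommutativeRing c ℓ) where
  open CommutativeRing R hiding (zero)
  open FiniteSums R
  open QuintupleSum R using (geom; geom-closed)
  open Divisors R renaming (_,_ to _by_)
  open CyclotomicFactors R using (xⁿ-1)
  open BlockSums R using ([q²]^≈)
  open import Relation.Binary.Reasoning.Setoid setoid

  geom-∣ : ∀ q n → geom q n ∣ xⁿ-1 q n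
  geom-∣ q n = - (1# - q) by trans (sym (-‿distribˡ-* _ _)) (trans (-‿cong (geom-closed q n))
    (solve 1 (λ x → :- (1ᶜ :- x) := x :- 1ᶜ) refl (q ^ n)))

  xⁿ-1-comaximal-x : ∀ q m → Comaximal (xⁿ-1 q (suc m)) q
  xⁿ-1-comaximal-x q m = comaximal {constant = + 1} { - 1# } {q ^ m} (λ ())
    (solve 2 (λ q x → (:- 1ᶜ) :* (q :* x :- 1ᶜ) :+ x :* q := 1ᶜ) refl q (q ^ m))

  -- Modulo 1 + x the square of `x` is 1, so an odd power of `x` may be replaced by `x`.
  1+x∣1+x^odd : ∀ x N → 1# + x ∣ 1# + x ^ suc (N ℕ.+ N)
  1+x∣1+x^odd x N = ∣-resp (begin
    x * ((x * x) ^ N - 1#) + (1# + x)   ≈⟨ +-congʳ (*-congˡ (+-congʳ ([q²]^≈ x N))) ⟩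
    x * (x ^ (N ℕ.+ N) - 1#) + (1# + x) ≈⟨ solve 2 (λ x y → x :* (y :- 1ᶜ) :+ (1ᶜ :+ x) := 1ᶜ :+ x :* y) refl x _ ⟩
    1# + x ^ suc (N ℕ.+ N)              ∎)
    (∣-+ (∣-*ˡ x (∣-trans (x - 1# by solve 1 (λ x → (x :- 1ᶜ) :* (1ᶜ :+ x) := x :* x :- 1ᶜ) refl x) (1-x∣1-x^ (x * x) N))) ∣-refl)

  -- for odd n, 1 + qʲ divides 1 + qʲⁿ ≡ 2 modulo qⁿ − 1
  xⁿ-1-comaximal-1+xʲ : ∀ q N j → Comaximal (xⁿ-1 q (suc (N ℕ.+ N))) (1# + q ^ j)
  xⁿ-1-comaximal-1+xʲ q N j = comaximal {constant = + 2} { - t } {s} (λ ()) (begin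
    - t * xⁿ-1 q n + s * (1# + q ^ j)
      ≈⟨ +-cong (trans (sym (-‿distribˡ-* _ _)) (-‿cong (trans (_∣_.equality t∣) (+-congʳ (exponent j))))) (_∣_.equality s∣) ⟩
    - ((q ^ j) ^ n - 1#) + (1# + (q ^ j) ^ n)   ≈⟨ solve 1 (λ y → (:- (y :- 1ᶜ)) :+ (1ᶜ :+ y) := con (+ 2)) refl _ ⟩
    ⟦ + 2 ⟧ℤ                                    ∎)
    where
    n = suc (N ℕ.+ N)
    exponent : ∀ j → q ^ (n ℕ.* j) ≈ (q ^ j) ^ n
    exponent j = trans (^-congʳ q (ℕ.*-comm n j)) (sym (^-assocʳ q j n))
    t∣ : xⁿ-1 q n ∣ xⁿ-1 q (n ℕ.* j)
    t∣ = ^-∣ q n j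
    s∣ : 1# + q ^ j ∣ 1# + (q ^ j) ^ n
    s∣ = 1+x∣1+x^odd (q ^ j) N
    t s : Carrier
    t = _∣_.quotient t∣
    s = _∣_.quotient s∣

-- The polynomial ring ℤ[q]

coeff : Poly → ℕ → ℤ
coeff [] i = + 0
coeff (a ∷ p) zero = a
coeff (a ∷ p) (suc i) = coeff p i

-- a record, unlike _≈ₚ_, lets the two polynomials be inferred from a proof
infix 4 _≋_
record _≋_ (p q : Poly) : Set where
  constructor coeffwise
  field at : ∀ i → coeff p i ≡ coeff q i
open _≋_

coeff-+ : ∀ p q i → coeff (p +ₚ q) i ≡ coeff p i ℤ.+ coeff q i
coeff-+ [] q i = ≡.sym (ℤ.+-identityˡ _)
coeff-+ (a ∷ p) [] i = ≡.sym (ℤ.+-identityʳ _)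
coeff-+ (a ∷ p) (b ∷ q) zero = ≡.refl
coeff-+ (a ∷ p) (b ∷ q) (suc i) = coeff-+ p q i

coeff-neg : ∀ p i → coeff (-ₚ p) i ≡ ℤ.- coeff p i
coeff-neg [] i = ≡.refl
coeff-neg (a ∷ p) zero = ≡.refl
coeff-neg (a ∷ p) (suc i) = coeff-neg p i

coeff-· : ∀ a p i → coeff (a ·ₚ p) i ≡ a ℤ.* coeff p i
coeff-· a [] i = ≡.sym (ℤ.*-zeroʳ a)
coeff-· a (b ∷ p) zero = ≡.refl
coeff-· a (b ∷ p) (suc i) = coeff-· a p i

coeff-- : ∀ p q i → coeff (p -ₚ q) i ≡ coeff p i ℤ.- coeff q i
coeff-- p q i = ≡.trans (coeff-+ p (-ₚ q) i) (≡.cong (ℤ._+_ (coeff p i)) (coeff-neg q i))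

IsZeroₚ⇒coeff : ∀ {p} → IsZeroₚ p → ∀ i → coeff p i ≡ + 0
IsZeroₚ⇒coeff [] i = ≡.refl
IsZeroₚ⇒coeff (a≡0 ∷ z) zero = a≡0
IsZeroₚ⇒coeff (a≡0 ∷ z) (suc i) = IsZeroₚ⇒coeff z i

coeff⇒IsZeroₚ : ∀ p → (∀ i → coeff p i ≡ + 0) → IsZeroₚ p
coeff⇒IsZeroₚ [] z = []
coeff⇒IsZeroₚ (a ∷ p) z = z 0 ∷ coeff⇒IsZeroₚ p (λ i → z (suc i))

≈ₚ⇒≋ : ∀ p q → p ≈ₚ q → p ≋ q
≈ₚ⇒≋ p q p≈q .at i = ℤ.i-j≡0⇒i≡j _ _ (≡.trans (≡.sym (coeff-- p q i)) (IsZeroₚ⇒coeff p≈q i))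

≋⇒≈ₚ : ∀ {p q} → p ≋ q → p ≈ₚ q
≋⇒≈ₚ {p} {q} p≋q = coeff⇒IsZeroₚ (p -ₚ q) λ i → ≡.trans (coeff-- p q i) (ℤ.i≡j⇒i-j≡0 (p≋q .at i))

polySetoid : Setoid 0ℓ 0ℓ
polySetoid = record
  { Carrier = Poly ; _≈_ = _≋_
  ; isEquivalence = record
    { refl = coeffwise λ _ → ≡.refl
    ; sym = λ e → coeffwise λ i → ≡.sym (e .at i)
    ; trans = λ e f → coeffwise λ i → ≡.trans (e .at i) (f .at i) } }

private
  module ≋ = Setoid polySetoid

  +ₚ-cong : ∀ {p p' q q'} → p ≋ p' → q ≋ q' → p +ₚ q ≋ p' +ₚ q'
  +ₚ-cong {p} {p'} {q} {q'} e f .at i =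
    ≡.trans (coeff-+ p q i) (≡.trans (≡.cong₂ ℤ._+_ (e .at i) (f .at i)) (≡.sym (coeff-+ p' q' i)))

  +ₚ-assoc : ∀ p q r → (p +ₚ q) +ₚ r ≋ p +ₚ (q +ₚ r)
  +ₚ-assoc p q r .at i
    rewrite coeff-+ (p +ₚ q) r i | coeff-+ p q i | coeff-+ p (q +ₚ r) i | coeff-+ q r i = ℤ.+-assoc (coeff p i) (coeff q i) (coeff r i)

  +ₚ-comm : ∀ p q → p +ₚ q ≋ q +ₚ p
  +ₚ-comm p q .at i rewrite coeff-+ p q i | coeff-+ q p i = ℤ.+-comm (coeff p i) (coeff q i)

  +ₚ-identityʳ : ∀ p → p +ₚ [] ≋ p
  +ₚ-identityʳ [] = ≋.refl
  +ₚ-identityʳ (a ∷ p) = ≋.refl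

  -ₚ-inverseʳ : ∀ p → p -ₚ p ≋ []
  -ₚ-inverseʳ p .at i = ≡.trans (coeff-- p p i) (ℤ.+-inverseʳ (coeff p i))

  ·ₚ-cong : ∀ a {p q} → p ≋ q → a ·ₚ p ≋ a ·ₚ q
  ·ₚ-cong a {p} {q} e .at i = ≡.trans (coeff-· a p i) (≡.trans (≡.cong (ℤ._*_ a) (e .at i)) (≡.sym (coeff-· a q i)))

  ∷-cong : ∀ {a b p q} → a ≡ b → p ≋ q → a ∷ p ≋ b ∷ q
  ∷-cong e f .at zero = e
  ∷-cong e f .at (suc i) = f .at i

  0∷[] : + 0 ∷ [] ≋ []
  0∷[] .at zero = ≡.refl
  0∷[] .at (suc i) = ≡.refl

  0·ₚ : ∀ p → + 0 ·ₚ p ≋ []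
  0·ₚ p .at i = ≡.trans (coeff-· (+ 0) p i) (ℤ.*-zeroˡ (coeff p i))

  *ₚ-zeroʳ : ∀ p → p *ₚ [] ≋ []
  *ₚ-zeroʳ [] = ≋.refl
  *ₚ-zeroʳ (a ∷ p) = ≋.trans (∷-cong ≡.refl (*ₚ-zeroʳ p)) 0∷[]

  *ₚ-congˡ : ∀ p {q q'} → q ≋ q' → p *ₚ q ≋ p *ₚ q'
  *ₚ-congˡ [] e = ≋.refl
  *ₚ-congˡ (a ∷ p) e = +ₚ-cong (·ₚ-cong a e) (∷-cong ≡.refl (*ₚ-congˡ p e))

-- The recursion of the product in its second argument, mirroring the definition; commutativity
-- rests on it.
*ₚ-∷ : ∀ p b q → p *ₚ (b ∷ q) ≋ b ·ₚ p +ₚ (+ 0 ∷ p *ₚ q)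
*ₚ-∷ [] b q = ≋.sym 0∷[]
*ₚ-∷ (a ∷ p) b q = ∷-cong (≡.trans (ℤ.+-identityʳ _) (≡.trans (ℤ.*-comm a b) (≡.sym (ℤ.+-identityʳ _))))
  (≋.trans (+ₚ-cong ≋.refl (*ₚ-∷ p b q))
    (≋.trans (≋.sym (+ₚ-assoc (a ·ₚ q) (b ·ₚ p) _))
      (≋.trans (+ₚ-cong (+ₚ-comm (a ·ₚ q) (b ·ₚ p)) ≋.refl) (+ₚ-assoc (b ·ₚ p) (a ·ₚ q) _))))

private
  *ₚ-comm : ∀ p q → p *ₚ q ≋ q *ₚ p
  *ₚ-comm [] q = ≋.sym (*ₚ-zeroʳ q)
  *ₚ-comm (a ∷ p) q = ≋.trans (+ₚ-cong ≋.refl (∷-cong ≡.refl (*ₚ-comm p q))) (≋.sym (*ₚ-∷ q a p))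

  *ₚ-cong : ∀ {p p' q q'} → p ≋ p' → q ≋ q' → p *ₚ q ≋ p' *ₚ q'
  *ₚ-cong {p} {p'} {q} {q'} e f =
    ≋.trans (*ₚ-congˡ p f) (≋.trans (*ₚ-comm p q') (≋.trans (*ₚ-congˡ q' e) (*ₚ-comm q' p')))

  ·ₚ-+ : ∀ a p q → a ·ₚ (p +ₚ q) ≋ a ·ₚ p +ₚ a ·ₚ q
  ·ₚ-+ a p q .at i rewrite coeff-· a (p +ₚ q) i | coeff-+ p q i | coeff-+ (a ·ₚ p) (a ·ₚ q) i
    | coeff-· a p i | coeff-· a q i = ℤ.*-distribˡ-+ a (coeff p i) (coeff q i)

  +ₚ-interchange : ∀ p q r s → (p +ₚ q) +ₚ (r +ₚ s) ≋ (p +ₚ r) +ₚ (q +ₚ s)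
  +ₚ-interchange p q r s .at i rewrite coeff-+ (p +ₚ q) (r +ₚ s) i | coeff-+ (p +ₚ r) (q +ₚ s) i
    | coeff-+ p q i | coeff-+ r s i | coeff-+ p r i | coeff-+ q s i = interchange (coeff p i) (coeff q i) (coeff r i) (coeff s i)
    where
    interchange : ∀ a b c d → (a ℤ.+ b) ℤ.+ (c ℤ.+ d) ≡ (a ℤ.+ c) ℤ.+ (b ℤ.+ d)
    interchange = ℤ-Solver.solve-∀

  *ₚ-distribˡ : ∀ p q r → p *ₚ (q +ₚ r) ≋ p *ₚ q +ₚ p *ₚ r
  *ₚ-distribˡ [] q r = ≋.refl
  *ₚ-distribˡ (a ∷ p) q r =
    ≋.trans (+ₚ-cong (·ₚ-+ a q r) (∷-cong ≡.refl (*ₚ-distribˡ p q r)))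
            (+ₚ-interchange (a ·ₚ q) (a ·ₚ r) (+ 0 ∷ p *ₚ q) (+ 0 ∷ p *ₚ r))

  *ₚ-distribʳ : ∀ p q r → (q +ₚ r) *ₚ p ≋ q *ₚ p +ₚ r *ₚ p
  *ₚ-distribʳ p q r = ≋.trans (*ₚ-comm (q +ₚ r) p)
    (≋.trans (*ₚ-distribˡ p q r) (+ₚ-cong (*ₚ-comm p q) (*ₚ-comm p r)))

  ·ₚ-assoc : ∀ a b p → (a ℤ.* b) ·ₚ p ≋ a ·ₚ (b ·ₚ p)
  ·ₚ-assoc a b p .at i rewrite coeff-· (a ℤ.* b) p i | coeff-· a (b ·ₚ p) i | coeff-· b p i = ℤ.*-assoc a b (coeff p i)

  ·ₚ-*ₚ : ∀ a p q → (a ·ₚ p) *ₚ q ≋ a ·ₚ (p *ₚ q)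
  ·ₚ-*ₚ a [] q = ≋.refl
  ·ₚ-*ₚ a (b ∷ p) q = ≋.trans (+ₚ-cong (·ₚ-assoc a b q) (∷-cong (≡.sym (ℤ.*-zeroʳ a)) (·ₚ-*ₚ a p q)))
    (≋.sym (·ₚ-+ a (b ·ₚ q) (+ 0 ∷ p *ₚ q)))

  *ₚ-assoc : ∀ p q r → (p *ₚ q) *ₚ r ≋ p *ₚ (q *ₚ r)
  *ₚ-assoc [] q r = ≋.refl
  *ₚ-assoc (a ∷ p) q r = ≋.trans (*ₚ-distribʳ r (a ·ₚ q) (+ 0 ∷ p *ₚ q))
    (+ₚ-cong (·ₚ-*ₚ a q r) (≋.trans (+ₚ-cong (0·ₚ r) ≋.refl) (∷-cong ≡.refl (*ₚ-assoc p q r))))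

const-*ₚ : ∀ a p → (a ∷ []) *ₚ p ≋ a ·ₚ p
const-*ₚ a p = ≋.trans (+ₚ-cong ≋.refl 0∷[]) (+ₚ-identityʳ (a ·ₚ p))

private
  *ₚ-identityˡ : ∀ p → 1ₚ *ₚ p ≋ p
  *ₚ-identityˡ p = ≋.trans (const-*ₚ (+ 1) p) (coeffwise λ i → ≡.trans (coeff-· (+ 1) p i) (ℤ.*-identityˡ (coeff p i)))

polyRing : CommutativeRing 0ℓ 0ℓ
polyRing = record
  { Carrier = Poly ; _≈_ = _≋_ ; _+_ = _+ₚ_ ; _*_ = _*ₚ_ ; -_ = -ₚ_ ; 0# = 0ₚ ; 1# = 1ₚ
  ; isCommutativeRing = record
    { isRing = record
      { +-isAbelianGroup = record
        { isGroup = record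
          { isMonoid = record
            { isSemigroup = record
              { isMagma = record { isEquivalence = ≋.isEquivalence ; ∙-cong = +ₚ-cong }
              ; assoc = +ₚ-assoc }
            ; identity = (λ _ → ≋.refl) , +ₚ-identityʳ }
          ; inverse = (λ p → ≋.trans (+ₚ-comm (-ₚ p) p) (-ₚ-inverseʳ p)) , -ₚ-inverseʳ
          ; ⁻¹-cong = λ {p} {q} e → coeffwise λ i → ≡.trans (coeff-neg p i) (≡.trans (≡.cong ℤ.-_ (e .at i)) (≡.sym (coeff-neg q i))) }
        ; comm = +ₚ-comm }
      ; *-cong = *ₚ-cong
      ; *-assoc = *ₚ-assoc
      ; *-identity = *ₚ-identityˡ , (λ p → ≋.trans (*ₚ-comm p 1ₚ) (*ₚ-identityˡ p))
      ; distrib = *ₚ-distribˡ , *ₚ-distribʳ }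
    ; *-comm = *ₚ-comm } }

private
  module P = CommutativeRing polyRing
  module PS = FiniteSums polyRing
  module PD = Divisors polyRing
  module PC = CyclotomicFactors polyRing
  module PQ = QuintupleSum polyRing
  module PB = CentralBinomials polyRing
  module PX = DenominatorComaximality polyRing

open PS using (⟦_⟧ℤ; solve; con; _:=_; _:+_; _:*_; _:-_; :-_; _:^_)
open import Relation.Binary.Reasoning.Setoid P.setoid

-- Degrees and division with remainder

-- A list may end in zeros, so its length only bounds the degree; statements about degrees are
-- therefore made on coefficients.
DegBelow : Poly → ℕ → Set
DegBelow p m = ∀ i → m ≤ i → coeff p i ≡ + 0

-- The coefficient `a` may be zero, so `pseudoDivide` can treat its top coefficient without a case
-- distinction.
record Lead (p : Poly) (m : ℕ) (a : ℤ) : Set where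
  constructor lead
  field
    top : coeff p m ≡ a
    above : DegBelow p (suc m)
open Lead

Monic : Poly → ℕ → Set
Monic p m = Lead p m (+ 1)

DegBelow-resp : ∀ {p p' m} → p ≋ p' → DegBelow p m → DegBelow p' m
DegBelow-resp e d i m≤i = ≡.trans (≡.sym (e .at i)) (d i m≤i)

Lead-resp : ∀ {p p' m a} → p ≋ p' → Lead p m a → Lead p' m a
Lead-resp e (lead t d) = lead (≡.trans (≡.sym (e .at _)) t) (DegBelow-resp e d)

DegBelow-length : ∀ p → DegBelow p (length p)
DegBelow-length [] i _ = ≡.refl
DegBelow-length (a ∷ p) (suc i) (s≤s le) = DegBelow-length p i le

DegBelow-0 : ∀ {p} → DegBelow p 0 → p ≋ []
DegBelow-0 d .at i = d i z≤n

DegBelow-pred : ∀ p {m} → DegBelow p (suc m) → coeff p m ≡ + 0 → DegBelow p m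
DegBelow-pred p d z i m≤i with ℕ.m≤n⇒m<n∨m≡n m≤i
... | inj₁ m<i    = d i m<i
... | inj₂ ≡.refl = z

Lead-* : ∀ p q {m k a b} → Lead p m a → Lead q k b → Lead (p *ₚ q) (m ℕ.+ k) (a ℤ.* b)
Lead-* [] q (lead ≡.refl _) _ = lead ≡.refl λ _ _ → ≡.refl
Lead-* (c ∷ p) q {zero} {k} {b = b} (lead ≡.refl da) (lead tb db) = Lead-resp (P.sym cq≋)
  (lead (≡.trans (coeff-· c q k) (≡.cong (ℤ._*_ c) tb))
        (λ i k<i → ≡.trans (coeff-· c q i) (≡.trans (≡.cong (ℤ._*_ c) (db i k<i)) (ℤ.*-zeroʳ c))))
  where
  cq≋ : (c ∷ p) *ₚ q ≋ c ·ₚ q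
  cq≋ = P.trans (P.*-congʳ {q} {c ∷ p} {c ∷ []} λ where
                   .at zero → ≡.refl
                   .at (suc i) → da (suc i) (s≤s z≤n))
                (const-*ₚ c q)
Lead-* (c ∷ p) q {suc m} {k} {a} {b} (lead ta da) (lead tb db) =
  let lead t d = Lead-* p q {m} {k} {a} {b} (lead ta (λ i m<i → da (suc i) (s≤s m<i))) (lead tb db) in
  lead (≡.trans (coeffs (m ℕ.+ k)) (≡.trans (≡.cong₂ ℤ._+_ (zeroes (suc m ℕ.+ k) (s≤s (ℕ.m≤n+m k m))) t) (ℤ.+-identityˡ _)))
    λ { (suc i) (s≤s lt) → ≡.trans (coeffs i)
          (≡.cong₂ ℤ._+_ (zeroes (suc i) (s≤s (ℕ.≤-trans (ℕ.m≤n+m k (suc m)) lt))) (d i lt)) }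
  where
  coeffs : ∀ i → coeff ((c ∷ p) *ₚ q) (suc i) ≡ c ℤ.* coeff q (suc i) ℤ.+ coeff (p *ₚ q) i
  coeffs i = ≡.trans (coeff-+ (c ·ₚ q) _ (suc i)) (≡.cong (ℤ._+ _) (coeff-· c q (suc i)))
  zeroes : ∀ i → suc k ≤ i → c ℤ.* coeff q i ≡ + 0
  zeroes i lt = ≡.trans (≡.cong (ℤ._*_ c) (db i lt)) (ℤ.*-zeroʳ c)

Lead-unique : ∀ {p m k a b} → Lead p m a → Lead p k b → a ≢ + 0 → b ≢ + 0 → m ≡ k × a ≡ b
Lead-unique {m = m} {k} (lead ta da) (lead tb db) a≢0 b≢0 with ℕ.<-cmp m k
... | tri< m<k _ _ = ⊥-elim (b≢0 (≡.trans (≡.sym tb) (da k m<k)))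
... | tri≈ _ ≡.refl _ = ≡.refl , ≡.trans (≡.sym ta) tb
... | tri> _ _ k<m = ⊥-elim (a≢0 (≡.trans (≡.sym ta) (db m k<m)))

private
  1≢0 : + 1 ≢ + 0
  1≢0 ()

leadView : ∀ p → p ≋ [] ⊎ (∃₂ λ m a → Lead p m a × a ≢ + 0)
leadView [] = inj₁ P.refl
leadView (a ∷ p) with leadView p
... | inj₂ (m , b , lead t d , b≢0) = inj₂ (suc m , b , lead t (λ { (suc i) (s≤s lt) → d i lt }) , b≢0)
... | inj₁ p≋0 with a ℤ.≟ + 0
...   | yes a≡0 = inj₁ λ where
          .at zero → a≡0
          .at (suc i) → p≋0 .at i
...   | no  a≢0 = inj₂ (0 , a , lead ≡.refl (λ { (suc i) _ → p≋0 .at i }) , a≢0)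

i*j≢0 : ∀ {i j} → i ≢ + 0 → j ≢ + 0 → i ℤ.* j ≢ + 0
i*j≢0 {i} i≢0 j≢0 ij≡0 with ℤ.i*j≡0⇒i≡0∨j≡0 i ij≡0
... | inj₁ i≡0 = i≢0 i≡0
... | inj₂ j≡0 = j≢0 j≡0

-- For nonzero `y` the leading coefficients multiply to a nonzero coefficient in degree at least
-- `m`.
small-multiple : ∀ {f m a y} → Lead f m a → a ≢ + 0 → DegBelow (y *ₚ f) m → y ≋ []
small-multiple {f} {m} {a} {y} lf a≢0 d with leadView y
... | inj₁ y≋0 = y≋0
... | inj₂ (k , b , ly , b≢0) =
  ⊥-elim (i*j≢0 b≢0 a≢0 (≡.trans (≡.sym (Lead-* y f ly lf .top)) (d (k ℕ.+ m) (ℕ.m≤n+m m k))))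

Lead⇒Regular : ∀ {f m a} → Lead f m a → a ≢ + 0 → PS.Regular f
Lead⇒Regular {f} lf a≢0 y fy≋0 = small-multiple lf a≢0 (λ i _ → P.trans (P.*-comm y f) fy≋0 .at i)

⟦⟧ℤ≋ : ∀ k → ⟦ k ⟧ℤ ≋ k ∷ []
⟦⟧ℤ≋ (+ n) = nat n
  where
  nat : ∀ n → ⟦ + n ⟧ℤ ≋ + n ∷ []
  nat zero .at zero = ≡.refl
  nat zero .at (suc i) = ≡.refl
  nat (suc n) = P.trans (PS.⟦⟧ℤ-+ (+ 1) (+ n)) (P.trans (P.+-congˡ {1ₚ} (nat n)) (coeffwise λ { zero → ≡.refl ; (suc i) → ≡.refl }))
⟦⟧ℤ≋ -[1+ n ] = P.-‿cong (⟦⟧ℤ≋ (+ suc n))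

⟦⟧ℤ-*-coeff : ∀ k p i → coeff (⟦ k ⟧ℤ *ₚ p) i ≡ k ℤ.* coeff p i
⟦⟧ℤ-*-coeff k p i = ≡.trans (P.trans (P.*-congʳ (⟦⟧ℤ≋ k)) (const-*ₚ k p) .at i) (coeff-· k p i)

Lead-⟦⟧ℤ : ∀ k → Lead ⟦ k ⟧ℤ 0 k
Lead-⟦⟧ℤ k = Lead-resp (P.sym (⟦⟧ℤ≋ k)) (lead ≡.refl λ { (suc i) _ → ≡.refl })

Lead-1ₚ : Monic 1ₚ 0
Lead-1ₚ = lead ≡.refl λ { (suc i) _ → ≡.refl }

Lead-X^ : ∀ m → Monic (X^ m) m
Lead-X^ zero = Lead-1ₚ
Lead-X^ (suc m) = let lead t d = Lead-X^ m in lead t λ { (suc i) (s≤s lt) → d i lt }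

DegBelow-- : ∀ {p q m} → DegBelow p m → DegBelow q m → DegBelow (p -ₚ q) m
DegBelow-- {p} {q} dp dq i m≤i = ≡.trans (coeff-- p q i) (≡.cong₂ ℤ._-_ (dp i m≤i) (dq i m≤i))

module _ (B : Poly) {m : ℕ} {a : ℤ} (lB : Lead B m a) where

  -- Over ℤ a division by a non-monic polynomial works only after scaling by a power of its leading
  -- coefficient `a`; each round of `pseudoDivide` contributes one factor.
  record PseudoDivision (A : Poly) : Set where
    constructor pseudoDivision
    field
      exponent : ℕ
      quotient remainder : Poly
      equation : ⟦ a ℤ.^ exponent ⟧ℤ *ₚ A ≋ quotient *ₚ B +ₚ remainder
      small : DegBelow remainder m

  pseudoDivide : ∀ j A → DegBelow A (m ℕ.+ j) → PseudoDivision A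
  pseudoDivide zero A dA = pseudoDivision 0 [] A (P.*-identityˡ A) (≡.subst (DegBelow A) (ℕ.+-identityʳ m) dA)
  pseudoDivide (suc j) A dA = pseudoDivision (suc e) (⟦ a ℤ.^ e ⟧ℤ *ₚ t +ₚ Q) r eq s
    where
    k = coeff A (m ℕ.+ j)
    t = ⟦ k ⟧ℤ *ₚ X^ j
    A' = ⟦ a ⟧ℤ *ₚ A -ₚ t *ₚ B
    lead-t : Lead t j (k ℤ.* + 1)
    lead-t = Lead-* ⟦ k ⟧ℤ (X^ j) (Lead-⟦⟧ℤ k) (Lead-X^ j)
    lead-tB : Lead (t *ₚ B) (m ℕ.+ j) (a ℤ.* k)
    lead-tB = ≡.subst₂ (Lead (t *ₚ B)) (ℕ.+-comm j m)
      (≡.trans (≡.cong (ℤ._* a) (ℤ.*-identityʳ k)) (ℤ.*-comm k a)) (Lead-* t B lead-t lB)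
    lead-aA : Lead (⟦ a ⟧ℤ *ₚ A) (m ℕ.+ j) (a ℤ.* k)
    lead-aA = Lead-* ⟦ a ⟧ℤ A (Lead-⟦⟧ℤ a) (lead ≡.refl (≡.subst (DegBelow A) (ℕ.+-suc m j) dA))
    dA' : DegBelow A' (m ℕ.+ j)
    dA' = DegBelow-pred A' (DegBelow-- {⟦ a ⟧ℤ *ₚ A} {t *ₚ B} (lead-aA .above) (lead-tB .above))
      (≡.trans (coeff-- (⟦ a ⟧ℤ *ₚ A) (t *ₚ B) (m ℕ.+ j))
        (≡.trans (≡.cong₂ ℤ._-_ (lead-aA .top) (lead-tB .top)) (ℤ.+-inverseʳ (a ℤ.* k))))
    open PseudoDivision (pseudoDivide j A' dA')
      renaming (exponent to e; quotient to Q; remainder to r; equation to eq'; small to s)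
    eq : ⟦ a ℤ.^ suc e ⟧ℤ *ₚ A ≋ (⟦ a ℤ.^ e ⟧ℤ *ₚ t +ₚ Q) *ₚ B +ₚ r
    eq = begin
      ⟦ a ℤ.* a ℤ.^ e ⟧ℤ *ₚ A               ≈⟨ P.*-congʳ {A} (PS.⟦⟧ℤ-* a (a ℤ.^ e)) ⟩
      ⟦ a ⟧ℤ *ₚ ⟦ a ℤ.^ e ⟧ℤ *ₚ A
        ≈⟨ solve 4 (λ a c A u → a :* c :* A := c :* u :+ c :* (a :* A :- u)) P.refl ⟦ a ⟧ℤ ⟦ a ℤ.^ e ⟧ℤ A (t *ₚ B) ⟩
      ⟦ a ℤ.^ e ⟧ℤ *ₚ (t *ₚ B) +ₚ ⟦ a ℤ.^ e ⟧ℤ *ₚ A'   ≈⟨ P.+-congˡ {⟦ a ℤ.^ e ⟧ℤ *ₚ (t *ₚ B)} eq' ⟩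
      ⟦ a ℤ.^ e ⟧ℤ *ₚ (t *ₚ B) +ₚ (Q *ₚ B +ₚ r)
        ≈⟨ solve 5 (λ c t B Q r → c :* (t :* B) :+ (Q :* B :+ r) := (c :* t :+ Q) :* B :+ r) P.refl ⟦ a ℤ.^ e ⟧ℤ t B Q r ⟩
      (⟦ a ℤ.^ e ⟧ℤ *ₚ t +ₚ Q) *ₚ B +ₚ r     ∎

1^≡1 : ∀ e → (+ 1) ℤ.^ e ≡ + 1
1^≡1 zero = ≡.refl
1^≡1 (suc e) = ≡.trans (ℤ.*-identityˡ _) (1^≡1 e)

-- Division by a monic `f` needs no scaling: x = Q f + r. From u f = k x follows (u - k Q) f = k r,
-- a multiple of `f` of too small a degree, so r = 0.
Monic⇒Saturated : ∀ {f m} → Monic f m → PD.Saturated f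
Monic⇒Saturated {f} {m} lf k x k≢0 (u PD., uf≋kx) = Q PD., (begin
    Q *ₚ f                                ≈⟨ P.+-identityʳ (Q *ₚ f) ⟨
    Q *ₚ f +ₚ []                          ≈⟨ P.+-congˡ {Q *ₚ f} r≋0 ⟨
    Q *ₚ f +ₚ r                           ≈⟨ eq ⟨
    ⟦ (+ 1) ℤ.^ e ⟧ℤ *ₚ x                ≡⟨ ≡.cong (λ z → ⟦ z ⟧ℤ *ₚ x) (1^≡1 e) ⟩
    1ₚ *ₚ x                               ≈⟨ P.*-identityˡ x ⟩
    x                                     ∎)
  where
  open PseudoDivision (pseudoDivide f lf (length x) x (λ i le → DegBelow-length x i (ℕ.≤-trans (ℕ.m≤n+m _ m) le)))
    renaming (exponent to e; quotient to Q; remainder to r; equation to eq; small to s)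
  K = ⟦ k ⟧ℤ
  Kr≋ : (u -ₚ K *ₚ Q) *ₚ f ≋ K *ₚ r
  Kr≋ = begin
    (u -ₚ K *ₚ Q) *ₚ f                     ≈⟨ solve 4 (λ u K Q f → (u :- K :* Q) :* f := u :* f :- K :* (Q :* f)) P.refl u K Q f ⟩
    u *ₚ f -ₚ K *ₚ (Q *ₚ f)                ≈⟨ P.+-congʳ { -ₚ (K *ₚ (Q *ₚ f)) } uf≋kx ⟩
    K *ₚ x -ₚ K *ₚ (Q *ₚ f)                ≈⟨ P.+-congʳ { -ₚ (K *ₚ (Q *ₚ f)) } (P.*-congˡ {K} (P.trans (P.sym (P.*-identityˡ x)) (P.trans (P.reflexive (≡.cong (λ z → ⟦ z ⟧ℤ *ₚ x) (≡.sym (1^≡1 e)))) eq))) ⟩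
    K *ₚ (Q *ₚ f +ₚ r) -ₚ K *ₚ (Q *ₚ f)    ≈⟨ solve 3 (λ K y r → K :* (y :+ r) :- K :* y := K :* r) P.refl K (Q *ₚ f) r ⟩
    K *ₚ r                                 ∎
  y≋0 : u -ₚ K *ₚ Q ≋ []
  y≋0 = small-multiple lf (λ ()) (λ i m≤i → ≡.trans (Kr≋ .at i)
    (≡.trans (⟦⟧ℤ-*-coeff k r i) (≡.trans (≡.cong (ℤ._*_ k) (s i m≤i)) (ℤ.*-zeroʳ k))))
  r≋0 : r ≋ []
  r≋0 = Lead⇒Regular (Lead-⟦⟧ℤ k) k≢0 r (P.trans (P.sym Kr≋) (P.trans (P.*-congʳ {f} y≋0) (P.zeroˡ f)))

Monic-quotient : ∀ {f g m n} → Monic g m → Monic (f *ₚ g) n → ∃ λ k → Monic f k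
Monic-quotient {f} {g} lg lfg with leadView f
... | inj₁ f≋0 = ⊥-elim (1≢0 (≡.trans (≡.sym (lfg .top)) (P.trans (P.*-congʳ {g} f≋0) (P.zeroˡ g) .at _)))
... | inj₂ (k , a , lf , a≢0) = k , ≡.subst (Lead f k) (≡.trans (≡.sym (ℤ.*-identityʳ a)) a≡1) lf
  where
  a≡1 : a ℤ.* + 1 ≡ + 1
  a≡1 = proj₂ (Lead-unique (Lead-* f g lf lg) lfg (i*j≢0 a≢0 (λ ())) (λ ()))

++0 : ∀ p → p ≋ p ∷ʳ + 0
++0 [] .at zero = ≡.refl
++0 [] .at (suc i) = ≡.refl
++0 (a ∷ p) .at zero = ≡.refl
++0 (a ∷ p) .at (suc i) = ++0 p .at i

data Stripped : Poly → Set where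
  empty : Stripped []
  nonempty : ∀ t a → a ≢ + 0 → Stripped (t ∷ʳ a)

strip-reverse : ∀ r → reverse (dropWhile (λ x → x ℤ.≟ + 0) r) ≋ reverse r × Stripped (reverse (dropWhile (λ x → x ℤ.≟ + 0) r))
strip-reverse [] = P.refl , empty
strip-reverse (a ∷ r) with a ℤ.≟ + 0
... | yes ≡.refl = P.trans (proj₁ (strip-reverse r)) (P.trans (++0 (reverse r)) (P.reflexive (≡.sym (List.unfold-reverse (+ 0) r))))
                 , proj₂ (strip-reverse r)
... | no  a≢0 rewrite List.unfold-reverse a r = P.refl , nonempty (reverse r) a a≢0

strip≋ : ∀ p → strip p ≋ p
strip≋ p = P.trans (proj₁ (strip-reverse (reverse p))) (P.reflexive (List.reverse-involutive p))

strip-Stripped : ∀ p → Stripped (strip p)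
strip-Stripped p = proj₂ (strip-reverse (reverse p))

Lead-∷ʳ : ∀ t a → Lead (t ∷ʳ a) (length t) a
Lead-∷ʳ [] a = lead ≡.refl λ { (suc i) _ → ≡.refl }
Lead-∷ʳ (b ∷ t) a = let lead e d = Lead-∷ʳ t a in lead e λ { (suc i) (s≤s lt) → d i lt }

lastCoeff-∷ʳ : ∀ t a → lastCoeff (t ∷ʳ a) ≡ a
lastCoeff-∷ʳ [] a = ≡.refl
lastCoeff-∷ʳ (b ∷ []) a = ≡.refl
lastCoeff-∷ʳ (b ∷ c ∷ t) a = lastCoeff-∷ʳ (c ∷ t) a

Lead-monomial : ∀ j a → Lead (replicate j (+ 0) ++ (a ∷ [])) j a
Lead-monomial j a = ≡.subst (λ k → Lead (replicate j (+ 0) ∷ʳ a) k a) (List.length-replicate j) (Lead-∷ʳ (replicate j (+ 0)) a)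

strip-lead : ∀ p → strip p ≡ [] ⊎ (∃₂ λ k a → length (strip p) ≡ suc k × lastCoeff (strip p) ≡ a × Lead p k a × a ≢ + 0)
strip-lead p with strip p | strip≋ p | strip-Stripped p
... | .[]         | _  | empty            = inj₁ ≡.refl
... | .(t ∷ʳ a)   | e  | nonempty t a a≢0 =
  inj₂ (length t , a , ≡.trans (List.length-++ t) (ℕ.+-comm (length t) 1) , lastCoeff-∷ʳ t a , Lead-resp e (Lead-∷ʳ t a) , a≢0)

length-strip : ∀ {d m} → Monic d m → length (strip d) ≡ suc m
length-strip {d} {m} ld with strip-lead d
... | inj₁ d'≡[] = ⊥-elim (1≢0 (≡.trans (≡.sym (ld .top)) (≡.trans (≡.sym (strip≋ d .at m)) (≡.cong (λ z → coeff z m) d'≡[]))))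
... | inj₂ (k , a , eq , _ , la , a≢0) = ≡.trans eq (≡.cong suc (proj₁ (Lead-unique la ld a≢0 (λ ()))))

private
  quotₚ-small : ∀ f p d → length (strip p) < length (strip d) → quotₚ (suc f) p d ≡ []
  quotₚ-small f p d lt rewrite dec-true (length (strip p) ℕ.<? length (strip d)) lt = ≡.refl

  leadingTerm : Poly → Poly → Poly
  leadingTerm p d = replicate (length (strip p) ∸ length (strip d)) (+ 0) ++ (lastCoeff (strip p) ∷ [])

  quotₚ-large : ∀ f p d → ¬ length (strip p) < length (strip d) →
                quotₚ (suc f) p d ≡ leadingTerm p d +ₚ quotₚ f (strip p -ₚ leadingTerm p d *ₚ strip d) (strip d)
  quotₚ-large f p d ≮ rewrite dec-false (length (strip p) ℕ.<? length (strip d)) ≮ = ≡.refl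

-- The degree of `p` is below `fuel`, each round lowers it, and the remainder stays a multiple of
-- `d`. A nonzero multiple cannot have smaller degree than `d`, so the loop stops only at zero.
quotₚ-exact : ∀ fuel {p d m} → Monic d m → PD._∣_ d p → DegBelow p fuel → quotₚ fuel p d *ₚ d ≋ p
quotₚ-exact zero _ _ dp = P.sym (DegBelow-0 dp)
quotₚ-exact (suc f) {p} {d} {m} ld (c PD., cd≋p) dp with strip-lead p
... | inj₁ p'≡[] =
  P.trans (P.reflexive (≡.cong (_*ₚ d) (quotₚ-small f p d
      (≡.subst₂ _<_ (≡.sym (≡.cong length p'≡[])) (≡.sym (length-strip ld)) (s≤s z≤n)))))
    (P.trans (P.reflexive (≡.sym p'≡[])) (strip≋ p))
... | inj₂ (k , a , length-p' , last-p' , lp , a≢0) with k ℕ.<? m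
...   | yes k<m = ⊥-elim (a≢0 (≡.trans (≡.sym (lp .top)) (P.trans (P.sym cd≋p) (P.trans (P.*-congʳ {d} c≋0) (P.zeroˡ d)) .at k)))
  where
  c≋0 : c ≋ []
  c≋0 = small-multiple ld (λ ()) (DegBelow-resp (P.sym cd≋p) (λ i le → lp .above i (ℕ.≤-trans k<m le)))
...   | no  k≮m = begin
    quotₚ (suc f) p d *ₚ d       ≡⟨ ≡.cong (_*ₚ d) (quotₚ-large f p d λ lt → k≮m (ℕ.s<s⁻¹ (≡.subst₂ _<_ length-p' (length-strip ld) lt))) ⟩
    (t +ₚ quotₚ f p'' d') *ₚ d   ≈⟨ P.*-congˡ {t +ₚ quotₚ f p'' d'} (P.sym d'≋d) ⟩
    (t +ₚ quotₚ f p'' d') *ₚ d'  ≈⟨ P.distribʳ d' t (quotₚ f p'' d') ⟩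
    t *ₚ d' +ₚ quotₚ f p'' d' *ₚ d'  ≈⟨ P.+-congˡ {t *ₚ d'} (quotₚ-exact f (Lead-resp (P.sym d'≋d) ld) (c -ₚ t PD., multiple) small) ⟩
    t *ₚ d' +ₚ p''               ≈⟨ solve 2 (λ u p → u :+ (p :- u) := p) P.refl (t *ₚ d') (strip p) ⟩
    strip p                      ≈⟨ strip≋ p ⟩
    p                            ∎
  where
  d' = strip d
  d'≋d = strip≋ d
  t = leadingTerm p d
  p'' = strip p -ₚ t *ₚ d'
  lead-t : Lead t (k ∸ m) a
  lead-t = ≡.subst₂ (λ j b → Lead (replicate j (+ 0) ++ (b ∷ [])) (k ∸ m) a)
    (≡.sym (≡.cong₂ _∸_ length-p' (length-strip ld))) (≡.sym last-p') (Lead-monomial (k ∸ m) a)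
  lead-td' : Lead (t *ₚ d') k a
  lead-td' = ≡.subst₂ (Lead (t *ₚ d')) (ℕ.m∸n+n≡m (ℕ.≮⇒≥ k≮m)) (ℤ.*-identityʳ a)
    (Lead-* t d' lead-t (Lead-resp (P.sym d'≋d) ld))
  lead-p' : Lead (strip p) k a
  lead-p' = Lead-resp (P.sym (strip≋ p)) lp
  k≤f : k ≤ f
  k≤f with k ℕ.≤? f
  ... | yes k≤f = k≤f
  ... | no  k≰f = ⊥-elim (a≢0 (≡.trans (≡.sym (lp .top)) (dp k (ℕ.≰⇒> k≰f))))
  small : DegBelow p'' f
  small i f≤i = DegBelow-pred p'' (DegBelow-- {strip p} {t *ₚ d'} (lead-p' .above) (lead-td' .above))
    (≡.trans (coeff-- (strip p) (t *ₚ d') k) (≡.trans (≡.cong₂ ℤ._-_ (lead-p' .top) (lead-td' .top)) (ℤ.+-inverseʳ a)))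
    i (ℕ.≤-trans k≤f f≤i)
  multiple : (c -ₚ t) *ₚ d' ≋ p''
  multiple = begin
    (c -ₚ t) *ₚ d'        ≈⟨ solve 3 (λ c t d → (c :- t) :* d := c :* d :- t :* d) P.refl c t d' ⟩
    c *ₚ d' -ₚ t *ₚ d'    ≈⟨ P.+-congʳ { -ₚ (t *ₚ d') } (P.trans (P.*-congˡ {c} d'≋d) (P.trans cd≋p (P.sym (strip≋ p)))) ⟩
    p''                   ∎

-- Cyclotomic polynomials

q : Poly
q = X^ 1

q*≋ : ∀ p → q *ₚ p ≋ + 0 ∷ p
q*≋ p .at i = ≡.trans (coeff-+ (+ 0 ·ₚ p) (+ 0 ∷ 1ₚ *ₚ p) i)
  (≡.trans (≡.cong (ℤ._+ coeff (+ 0 ∷ 1ₚ *ₚ p) i) (≡.trans (coeff-· (+ 0) p i) (ℤ.*-zeroˡ (coeff p i))))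
    (≡.trans (ℤ.+-identityˡ _) (rest i)))
  where
  rest : ∀ i → coeff (+ 0 ∷ 1ₚ *ₚ p) i ≡ coeff (+ 0 ∷ p) i
  rest zero = ≡.refl
  rest (suc i) = P.*-identityˡ p .at i

X^≋ : ∀ k → X^ k ≋ q PS.^ k
X^≋ zero = P.refl
X^≋ (suc k) = P.trans (P.sym (q*≋ (X^ k))) (P.*-congˡ {q} (X^≋ k))

X^-1≋ : ∀ n → X^ n -ₚ 1ₚ ≋ PC.xⁿ-1 q n
X^-1≋ n = P.+-congʳ { -ₚ 1ₚ } (X^≋ n)

Monic-xⁿ-1 : ∀ n → Monic (PC.xⁿ-1 q (suc n)) (suc n)
Monic-xⁿ-1 n = Lead-resp (X^-1≋ (suc n)) (lead
  (≡.trans (coeff-- (X^ (suc n)) 1ₚ (suc n)) (≡.cong (ℤ._+ + 0) (Lead-X^ (suc n) .top)))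
  (DegBelow-- {X^ (suc n)} {1ₚ} (Lead-X^ (suc n) .above) λ { (suc i) _ → ≡.refl }))

xⁿ-1-regular : ∀ n → PS.Regular (PC.xⁿ-1 q (suc n))
xⁿ-1-regular n = Lead⇒Regular (Monic-xⁿ-1 n) λ ()

HasMonic : Poly → Set
HasMonic p = ∃ λ m → Monic p m

HasMonic-1 : HasMonic 1ₚ
HasMonic-1 = 0 , Lead-1ₚ

HasMonic-* : ∀ {p r} → HasMonic p → HasMonic r → HasMonic (p *ₚ r)
HasMonic-* {p} {r} (_ , lp) (_ , lr) = _ , Lead-* p r lp lr

HasMonic-∏ : ∀ n {f} → (∀ k → k < n → HasMonic (f k)) → HasMonic (PS.∏ n f)
HasMonic-∏ zero mf = HasMonic-1
HasMonic-∏ (suc n) mf = HasMonic-* (HasMonic-∏ n λ k k<n → mf k (ℕ.m<n⇒m<1+n k<n)) (mf n ℕ.≤-refl)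

HasMonic-^ : ∀ {f} n → HasMonic f → HasMonic (f PS.^ n)
HasMonic-^ zero mf = HasMonic-1
HasMonic-^ (suc n) mf = HasMonic-* mf (HasMonic-^ n mf)

-- Stated for arbitrary `f` and `g` because `applyUpTo` shifts its function at every step of the
-- induction.
foldr-zip : ∀ n m (f : ℕ → Poly) (g : ℕ → ℕ) →
            foldr (λ pd acc → if does (proj₂ pd ∣? n) then proj₁ pd *ₚ acc else acc) 1ₚ (zip (applyUpTo f m) (applyUpTo g m))
            ≋ PS.∏ m (λ i → if does (g i ∣? n) then f i else 1ₚ)
foldr-zip n zero f g = P.refl
foldr-zip n (suc m) f g = P.trans (step (does (g 0 ∣? n)) (foldr-zip n m (λ i → f (suc i)) (λ i → g (suc i))))
  (P.sym (PS.∏-head m (λ i → if does (g i ∣? n) then f i else 1ₚ)))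
  where
  step : ∀ b {x y} → x ≋ y → (if b then f 0 *ₚ x else x) ≋ (if b then f 0 else 1ₚ) *ₚ y
  step true  x≋y = P.*-congˡ {f 0} x≋y
  step false x≋y = P.trans x≋y (P.sym (P.*-identityˡ _))

cycList≡ : ∀ m → cycList m ≡ applyUpTo (λ i → Φ (suc i)) m
cycList≡ zero = ≡.refl
cycList≡ (suc m) = ≡.trans (≡.cong (_∷ʳ Φ (suc m)) (cycList≡ m)) (List.applyUpTo-∷ʳ (λ i → Φ (suc i)) m)

private
  -- The fuel m + 2 in `newCyc` exceeds the degree m + 1 of the dividend, as `quotₚ-exact` requires.
  newCyc-exact : ∀ m prev Π k → Monic Π k → PD._∣_ Π (PC.xⁿ-1 q (suc m)) →
                 foldr (λ pd acc → if does (proj₂ pd ∣? suc m) then proj₁ pd *ₚ acc else acc) 1ₚ (zip prev (applyUpTo suc m)) ≋ Π →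
                 newCyc m prev *ₚ Π ≋ PC.xⁿ-1 q (suc m)
  newCyc-exact m prev Π k monic Π∣ eq = P.trans (P.*-congˡ {newCyc m prev} (P.sym eq))
    (P.trans (quotₚ-exact (suc (suc m)) (Lead-resp (P.sym eq) monic)
        (PD.∣-respˡ (P.sym eq) (PD.∣-resp (P.sym (X^-1≋ (suc m))) Π∣))
        (Lead-resp (P.sym (X^-1≋ (suc m))) (Monic-xⁿ-1 m) .above))
      (X^-1≋ (suc m)))

-- The two claims need a joint strong induction: exactness of the division uses earlier
-- factorisations together with saturation, which comes from monicity, and the exact quotient of two
-- monic polynomials is monic.
Φ-correct : ∀ m → PC.Factorisation q Φ m × HasMonic (Φ (suc m))
Φ-correct = <-rec _ λ m rec →
  let F = λ e e<m → proj₁ (rec {e} e<m)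
      monic = λ e e<m → proj₂ (rec {e} e<m)
      k , proper-monic = HasMonic-∏ m λ e e<m →
        PC.divisorFactor-elim q Φ HasMonic (suc m) (suc e) (λ _ → monic e e<m) (λ _ → HasMonic-1)
      eq = newCyc-exact m (cycList m) (PC.properProduct q Φ m) k proper-monic
        (PC.properProduct-∣ q Φ xⁿ-1-regular m F λ e e<m → Monic⇒Saturated (proj₂ (monic e e<m)))
        (≡.subst (λ l → foldr (λ pd acc → if does (proj₂ pd ∣? suc m) then proj₁ pd *ₚ acc else acc) 1ₚ (zip l (applyUpTo suc m)) ≋ PC.properProduct q Φ m)
          (≡.sym (cycList≡ m)) (foldr-zip (suc m) m (λ i → Φ (suc i)) suc))
  in eq , Monic-quotient {Φ (suc m)} {PC.properProduct q Φ m} proper-monic (Lead-resp (P.sym eq) (Monic-xⁿ-1 m))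

-- Gauss's lemma and reduced fractions

ContentDivisible : ℤ → Poly → Set
ContentDivisible p f = ∀ i → p ℤ∣.∣ coeff f i

content-divide : ∀ {p} f → ContentDivisible p f → ∃ λ g → f ≋ ⟦ p ⟧ℤ *ₚ g
content-divide {p} f p∣f = quotients f p∣f , coeffwise λ i → ≡.trans (quotients-coeff f p∣f i) (≡.sym (⟦⟧ℤ-*-coeff p (quotients f p∣f) i))
  where
  quotients : ∀ f → ContentDivisible p f → Poly
  quotients [] _ = []
  quotients (a ∷ f) p∣f = ℤ∣._∣_.quotient (p∣f 0) ∷ quotients f (λ i → p∣f (suc i))
  quotients-coeff : ∀ f p∣f i → coeff f i ≡ p ℤ.* coeff (quotients f p∣f) i
  quotients-coeff [] _ i = ≡.sym (ℤ.*-zeroʳ p)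
  quotients-coeff (a ∷ f) p∣f zero = ≡.trans (ℤ∣._∣_.equality (p∣f 0)) (ℤ.*-comm (ℤ∣._∣_.quotient (p∣f 0)) p)
  quotients-coeff (a ∷ f) p∣f (suc i) = quotients-coeff f (λ i → p∣f (suc i)) i

prime-∣-* : ∀ {p} → Prime p → ∀ a b → + p ℤ∣.∣ a ℤ.* b → + p ℤ∣.∣ a ⊎ + p ℤ∣.∣ b
prime-∣-* pr a b p∣ab with euclidsLemma ℤ.∣ a ∣ ℤ.∣ b ∣ pr (≡.subst (_ ℕ.∣_) (ℤ.abs-* a b) (ℤ∣.∣⇒∣ᵤ p∣ab))
... | inj₁ p∣a = inj₁ (ℤ∣.∣ᵤ⇒∣ p∣a)
... | inj₂ p∣b = inj₂ (ℤ∣.∣ᵤ⇒∣ p∣b)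

gauss-prime : ∀ {p} → Prime p → ∀ f g → ContentDivisible (+ p) (f *ₚ g) → ContentDivisible (+ p) f ⊎ ContentDivisible (+ p) g
gauss-prime pr [] g _ = inj₁ λ i → ℤ∣.divides (+ 0) ≡.refl
gauss-prime pr (a ∷ f) [] _ = inj₂ λ i → ℤ∣.divides (+ 0) ≡.refl
gauss-prime {p} pr (a ∷ f) (b ∷ g) p∣fg =
  [ (λ p∣a → Sum.map₁ (λ { p∣f zero → p∣a ; p∣f (suc i) → p∣f i }) (gauss-prime pr f (b ∷ g) (p∣f*bg p∣a)))
  , (λ p∣b → Sum.map₂ (λ { p∣g zero → p∣b ; p∣g (suc i) → p∣g i }) (gauss-prime pr (a ∷ f) g (p∣af*g p∣b)))
  ]′ (prime-∣-* pr a b (≡.subst (+ p ℤ∣.∣_) (ℤ.+-identityʳ (a ℤ.* b)) (p∣fg 0)))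
  where
  p∣f*bg : + p ℤ∣.∣ a → ContentDivisible (+ p) (f *ₚ (b ∷ g))
  p∣f*bg p∣a i = ℤ∣.∣m+n∣m⇒∣n
    (≡.subst (+ p ℤ∣.∣_) (coeff-+ (a ·ₚ (b ∷ g)) (+ 0 ∷ f *ₚ (b ∷ g)) (suc i)) (p∣fg (suc i)))
    (≡.subst (+ p ℤ∣.∣_) (≡.sym (coeff-· a (b ∷ g) (suc i))) (ℤ∣.∣m⇒∣m*n (coeff g i) p∣a))
  p∣af*g : + p ℤ∣.∣ b → ContentDivisible (+ p) ((a ∷ f) *ₚ g)
  p∣af*g p∣b i = ℤ∣.∣m+n∣m⇒∣n
    (≡.subst (+ p ℤ∣.∣_) (≡.trans (*ₚ-∷ (a ∷ f) b g .at (suc i)) (coeff-+ (b ·ₚ (a ∷ f)) (+ 0 ∷ (a ∷ f) *ₚ g) (suc i))) (p∣fg (suc i)))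
    (≡.subst (+ p ℤ∣.∣_) (≡.sym (coeff-· b (a ∷ f) (suc i))) (ℤ∣.∣m⇒∣m*n (coeff f i) p∣b))

-- Here `part` is `g` with enough of its integer content removed to divide `E` over ℤ; it may still
-- have content.
record PrimitiveFactor (E g : Poly) : Set where
  constructor primitiveFactor
  field
    {scalar} : ℤ
    {part cofactor} : Poly
    scalar≢0 : scalar ≢ + 0
    scaled : g ≋ ⟦ scalar ⟧ℤ *ₚ part
    factors : E ≋ cofactor *ₚ part

private
  ⟦⟧ℤ-regular : ∀ {k} → k ≢ + 0 → PS.Regular ⟦ k ⟧ℤ
  ⟦⟧ℤ-regular {k} = Lead⇒Regular (Lead-⟦⟧ℤ k)

  prime≢0 : ∀ {p} → Prime p → + p ≢ + 0
  prime≢0 pr ≡.refl with prime⇒nonZero pr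
  ... | ()

  ⟦pk⟧≋ : ∀ p k E → ⟦ + (p ℕ.* k) ⟧ℤ *ₚ E ≋ ⟦ + p ⟧ℤ *ₚ (⟦ + k ⟧ℤ *ₚ E)
  ⟦pk⟧≋ p k E = begin
    ⟦ + (p ℕ.* k) ⟧ℤ *ₚ E           ≡⟨ ≡.cong (λ k → ⟦ k ⟧ℤ *ₚ E) (ℤ.pos-* p k) ⟩
    ⟦ + p ℤ.* + k ⟧ℤ *ₚ E           ≈⟨ P.*-congʳ {E} (PS.⟦⟧ℤ-* (+ p) (+ k)) ⟩
    ⟦ + p ⟧ℤ *ₚ ⟦ + k ⟧ℤ *ₚ E       ≈⟨ P.*-assoc ⟦ + p ⟧ℤ ⟦ + k ⟧ℤ E ⟩
    ⟦ + p ⟧ℤ *ₚ (⟦ + k ⟧ℤ *ₚ E)     ∎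

  -- Each prime of the constant divides the content of `h` or of `g`. It is cancelled there, and in
  -- the second case recorded in `scalar`.
  gauss-primes : ∀ {ps} → All Prime ps → ∀ {E h g} → ⟦ + product ps ⟧ℤ *ₚ E ≋ h *ₚ g → PrimitiveFactor E g
  gauss-primes [] {E} {h} {g} eq =
    primitiveFactor {scalar = + 1} {g} {h} (λ ()) (P.sym (P.*-identityˡ g)) (P.trans (P.sym (P.*-identityˡ E)) eq)
  gauss-primes {p ∷ ps} (pr ∷ prs) {E} {h} {g} eq = [ h-case , g-case ]′ (gauss-prime pr h g p∣hg)
    where
    Π = ⟦ + product ps ⟧ℤ
    pΠE≋ : ⟦ + p ⟧ℤ *ₚ (Π *ₚ E) ≋ h *ₚ g
    pΠE≋ = P.trans (P.sym (⟦pk⟧≋ p (product ps) E)) eq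
    p∣hg : ContentDivisible (+ p) (h *ₚ g)
    p∣hg i = ℤ∣.divides (coeff (Π *ₚ E) i)
      (≡.trans (P.sym pΠE≋ .at i) (≡.trans (⟦⟧ℤ-*-coeff (+ p) (Π *ₚ E) i) (ℤ.*-comm (+ p) _)))
    cancel-p : ∀ {y z} → ⟦ + p ⟧ℤ *ₚ y ≋ ⟦ + p ⟧ℤ *ₚ z → y ≋ z
    cancel-p = PS.Regular-cancel {⟦ + p ⟧ℤ} (⟦⟧ℤ-regular (prime≢0 pr))
    h-case : ContentDivisible (+ p) h → PrimitiveFactor E g
    h-case p∣h with content-divide h p∣h
    ... | h' , h≋ = gauss-primes prs {E} {h'} {g} (cancel-p (begin
      ⟦ + p ⟧ℤ *ₚ (Π *ₚ E)      ≈⟨ pΠE≋ ⟩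
      h *ₚ g                    ≈⟨ P.*-congʳ {g} h≋ ⟩
      ⟦ + p ⟧ℤ *ₚ h' *ₚ g       ≈⟨ P.*-assoc ⟦ + p ⟧ℤ h' g ⟩
      ⟦ + p ⟧ℤ *ₚ (h' *ₚ g)     ∎))
    g-case : ContentDivisible (+ p) g → PrimitiveFactor E g
    g-case p∣g with content-divide g p∣g
    ... | g' , g≋ = rescale g' g≋ (gauss-primes prs {E} {h} {g'} (cancel-p (begin
      ⟦ + p ⟧ℤ *ₚ (Π *ₚ E)      ≈⟨ pΠE≋ ⟩
      h *ₚ g                    ≈⟨ P.*-congˡ {h} g≋ ⟩
      h *ₚ (⟦ + p ⟧ℤ *ₚ g')     ≈⟨ solve 3 (λ h p g → h :* (p :* g) := p :* (h :* g)) P.refl h ⟦ + p ⟧ℤ g' ⟩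
      ⟦ + p ⟧ℤ *ₚ (h *ₚ g')     ∎)))
      where
      rescale : ∀ g' → g ≋ ⟦ + p ⟧ℤ *ₚ g' → PrimitiveFactor E g' → PrimitiveFactor E g
      rescale g' g≋ (primitiveFactor {k} {part} {cofactor} k≢0 g'≋ E≋) =
        primitiveFactor {scalar = + p ℤ.* k} {part} {cofactor} (i*j≢0 (prime≢0 pr) k≢0) (begin
          g                                ≈⟨ g≋ ⟩
          ⟦ + p ⟧ℤ *ₚ g'                   ≈⟨ P.*-congˡ {⟦ + p ⟧ℤ} g'≋ ⟩
          ⟦ + p ⟧ℤ *ₚ (⟦ k ⟧ℤ *ₚ part)     ≈⟨ P.*-assoc ⟦ + p ⟧ℤ ⟦ k ⟧ℤ part ⟨
          ⟦ + p ⟧ℤ *ₚ ⟦ k ⟧ℤ *ₚ part       ≈⟨ P.*-congʳ {part} (PS.⟦⟧ℤ-* (+ p) k) ⟨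
          ⟦ + p ℤ.* k ⟧ℤ *ₚ part           ∎) E≋

gauss : ∀ {c E h g} → c ≢ + 0 → ⟦ c ⟧ℤ *ₚ E ≋ h *ₚ g → PrimitiveFactor E g
gauss {+ zero} c≢0 eq = ⊥-elim (c≢0 ≡.refl)
gauss {+ suc n} {E} {h} {g} _ eq = gauss-primes factorsPrime {E} {h} {g}
    (P.trans (P.reflexive (≡.cong (λ m → ⟦ + m ⟧ℤ *ₚ E) (≡.sym isFactorisation))) eq)
  where open PrimeFactorisation (factorise (suc n))
gauss { -[1+ n ] } {E} {h} {g} _ eq = gauss { + suc n } {E} { -ₚ h } {g} (λ ()) (begin
  ⟦ + suc n ⟧ℤ *ₚ E         ≈⟨ solve 2 (λ c e → c :* e := :- ((:- c) :* e)) P.refl ⟦ + suc n ⟧ℤ E ⟩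
  -ₚ (⟦ -[1+ n ] ⟧ℤ *ₚ E)   ≈⟨ P.-‿cong eq ⟩
  -ₚ (h *ₚ g)               ≈⟨ solve 2 (λ h g → :- (h :* g) := (:- h) :* g) P.refl h g ⟩
  -ₚ h *ₚ g                 ∎)

-- Greatest common divisors over ℚ and lowest terms over ℤ

-- A gcd over ℚ with denominators cleared: the linear combination is exact, whereas divisibility of
-- `A` and `B` holds only after scaling.
record PseudoGCD (A B : Poly) : Set where
  constructor pseudoGCD
  field
    {gcdₚ u v α β} : Poly
    {scalar} : ℤ
    scalar≢0 : scalar ≢ + 0
    bezout : u *ₚ A +ₚ v *ₚ B ≋ gcdₚ
    divides-A : ⟦ scalar ⟧ℤ *ₚ A ≋ α *ₚ gcdₚ
    divides-B : ⟦ scalar ⟧ℤ *ₚ B ≋ β *ₚ gcdₚ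

^≢0 : ∀ {a} e → a ≢ + 0 → a ℤ.^ e ≢ + 0
^≢0 zero a≢0 ()
^≢0 (suc e) a≢0 = i*j≢0 a≢0 (^≢0 e a≢0)

pseudoEuclid : ∀ fuel A B → DegBelow B fuel → PseudoGCD A B
pseudoEuclid fuel A B dB with leadView B
... | inj₁ B≋0 = pseudoGCD {gcdₚ = A} {1ₚ} {[]} {1ₚ} {[]} {+ 1} (λ ())
  (P.trans (P.+-identityʳ (1ₚ *ₚ A)) (P.*-identityˡ A)) P.refl (P.trans (P.*-congˡ {1ₚ} B≋0) (P.zeroʳ 1ₚ))
pseudoEuclid zero A B dB | inj₂ (m , a , lB , a≢0) = ⊥-elim (a≢0 (≡.trans (≡.sym (lB .top)) (dB m z≤n)))
pseudoEuclid (suc f) A B dB | inj₂ (m , a , lB , a≢0)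
  with pseudoDivide B lB (length A) A (λ i le → DegBelow-length A i (ℕ.≤-trans (ℕ.m≤n+m _ m) le))
... | pseudoDivision e Q r eq small
  with pseudoEuclid f B r (λ i f≤i → small i (ℕ.≤-trans m≤f f≤i))
  where
  m≤f : m ≤ f
  m≤f with m ℕ.≤? f
  ... | yes m≤f = m≤f
  ... | no  m≰f = ⊥-elim (a≢0 (≡.trans (≡.sym (lB .top)) (dB m (ℕ.≰⇒> m≰f))))
... | pseudoGCD {g} {u} {v} {α} {β} {c} c≢0 uB+vr≋g cB≋αg cr≋βg =
  pseudoGCD {gcdₚ = g} {v *ₚ K} {u -ₚ v *ₚ Q} {Q *ₚ α +ₚ β} {K *ₚ α} {c ℤ.* a ℤ.^ e} (i*j≢0 c≢0 (^≢0 e a≢0))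
    (begin
      v *ₚ K *ₚ A +ₚ (u -ₚ v *ₚ Q) *ₚ B
        ≈⟨ solve 6 (λ v K A u Q B → v :* K :* A :+ (u :- v :* Q) :* B := u :* B :+ v :* (K :* A :- Q :* B)) P.refl v K A u Q B ⟩
      u *ₚ B +ₚ v *ₚ (K *ₚ A -ₚ Q *ₚ B)            ≈⟨ P.+-congˡ {u *ₚ B} (P.*-congˡ {v} (P.+-congʳ { -ₚ (Q *ₚ B) } eq)) ⟩
      u *ₚ B +ₚ v *ₚ (Q *ₚ B +ₚ r -ₚ Q *ₚ B)
        ≈⟨ solve 4 (λ x v y r → x :+ v :* (y :+ r :- y) := x :+ v :* r) P.refl (u *ₚ B) v (Q *ₚ B) r ⟩
      u *ₚ B +ₚ v *ₚ r                             ≈⟨ uB+vr≋g ⟩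
      g                                            ∎)
    (begin
      ⟦ c ℤ.* a ℤ.^ e ⟧ℤ *ₚ A                      ≈⟨ P.*-congʳ {A} (PS.⟦⟧ℤ-* c (a ℤ.^ e)) ⟩
      ⟦ c ⟧ℤ *ₚ K *ₚ A                             ≈⟨ P.*-assoc ⟦ c ⟧ℤ K A ⟩
      ⟦ c ⟧ℤ *ₚ (K *ₚ A)                           ≈⟨ P.*-congˡ {⟦ c ⟧ℤ} eq ⟩
      ⟦ c ⟧ℤ *ₚ (Q *ₚ B +ₚ r)
        ≈⟨ solve 4 (λ c Q B r → c :* (Q :* B :+ r) := Q :* (c :* B) :+ c :* r) P.refl ⟦ c ⟧ℤ Q B r ⟩
      Q *ₚ (⟦ c ⟧ℤ *ₚ B) +ₚ ⟦ c ⟧ℤ *ₚ r            ≈⟨ P.+-cong (P.*-congˡ {Q} cB≋αg) cr≋βg ⟩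
      Q *ₚ (α *ₚ g) +ₚ β *ₚ g
        ≈⟨ solve 4 (λ Q α g β → Q :* (α :* g) :+ β :* g := (Q :* α :+ β) :* g) P.refl Q α g β ⟩
      (Q *ₚ α +ₚ β) *ₚ g                           ∎)
    (begin
      ⟦ c ℤ.* a ℤ.^ e ⟧ℤ *ₚ B                      ≈⟨ P.*-congʳ {B} (PS.⟦⟧ℤ-* c (a ℤ.^ e)) ⟩
      ⟦ c ⟧ℤ *ₚ K *ₚ B
        ≈⟨ solve 3 (λ c K B → c :* K :* B := K :* (c :* B)) P.refl ⟦ c ⟧ℤ K B ⟩
      K *ₚ (⟦ c ⟧ℤ *ₚ B)                           ≈⟨ P.*-congˡ {K} cB≋αg ⟩
      K *ₚ (α *ₚ g)                                ≈⟨ P.*-assoc K α g ⟨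
      K *ₚ α *ₚ g                                  ∎)
  where K = ⟦ a ℤ.^ e ⟧ℤ

unit-product : ∀ a b → a ℤ.* b ≡ + 1 → b ≡ + 1 ⊎ b ≡ -[1+ 0 ]
unit-product a b ab≡1 with b | ℕ.m*n≡1⇒n≡1 ℤ.∣ a ∣ ℤ.∣ b ∣ (≡.trans (≡.sym (ℤ.abs-* a b)) (≡.cong ℤ.∣_∣ ab≡1))
... | + .1       | ≡.refl = inj₁ ≡.refl
... | -[1+ .0 ]  | ≡.refl = inj₂ ≡.refl

Lead-neg : ∀ {p m a} → Lead p m a → Lead (-ₚ p) m (ℤ.- a)
Lead-neg {p} {m} (lead t d) = lead (≡.trans (coeff-neg p m) (≡.cong ℤ.-_ t)) (λ i lt → ≡.trans (coeff-neg p i) (≡.cong ℤ.-_ (d i lt)))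

-- The leading coefficients are integers with product 1, so that of `g` is 1 or -1.
monic-factor : ∀ f g → HasMonic (f *ₚ g) → HasMonic g ⊎ HasMonic (-ₚ g)
monic-factor f g (n , lfg) with leadView f | leadView g
... | inj₁ f≋0 | _ = ⊥-elim (1≢0 (≡.trans (≡.sym (lfg .top)) (P.trans (P.*-congʳ {g} f≋0) (P.zeroˡ g) .at n)))
... | inj₂ _ | inj₁ g≋0 = ⊥-elim (1≢0 (≡.trans (≡.sym (lfg .top)) (P.trans (P.*-congˡ {f} g≋0) (P.zeroʳ f) .at n)))
... | inj₂ (k , a , lf , a≢0) | inj₂ (m , b , lg , b≢0)
  with unit-product a b (proj₂ (Lead-unique (Lead-* f g lf lg) lfg (i*j≢0 a≢0 b≢0) λ ()))
...   | inj₁ ≡.refl = inj₁ (m , lg)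
...   | inj₂ ≡.refl = inj₂ (m , Lead-neg lg)

HasMonic-resp : ∀ {p r} → p ≋ r → HasMonic p → HasMonic r
HasMonic-resp p≋r (m , lp) = m , Lead-resp p≋r lp

record Reduction (M E : Poly) : Set where
  constructor reduction
  field
    {common M' E'} : Poly
    common-monic : HasMonic common
    M≋ : M ≋ M' *ₚ common
    E≋ : E ≋ E' *ₚ common
    coprime : PD.Comaximal M' E'

monic-reduction : ∀ {M E} (G : PseudoGCD M E) → let open PseudoGCD G in
  ∀ part cofactor k → k ≢ + 0 → HasMonic part → gcdₚ ≋ ⟦ k ⟧ℤ *ₚ part → E ≋ cofactor *ₚ part → Reduction M E
monic-reduction {M} {E} (pseudoGCD {g} {u} {v} {α} {β} {c} c≢0 bezout cM≋ cE≋) part cofactor k k≢0 mp@(_ , lp) g≋ E≋ =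
  reduction {common = part} {M'} {cofactor} mp (P.sym M'part≋M) E≋
    (PD.comaximal {constant = k} {u} {v} k≢0
    (PS.Regular-cancel {part} (Lead⇒Regular lp λ ()) (begin
      part *ₚ (u *ₚ M' +ₚ v *ₚ cofactor)
        ≈⟨ solve 5 (λ p u m v c → p :* (u :* m :+ v :* c) := u :* (m :* p) :+ v :* (c :* p)) P.refl part u M' v cofactor ⟩
      u *ₚ (M' *ₚ part) +ₚ v *ₚ (cofactor *ₚ part)   ≈⟨ P.+-cong (P.*-congˡ {u} M'part≋M) (P.*-congˡ {v} (P.sym E≋)) ⟩
      u *ₚ M +ₚ v *ₚ E                               ≈⟨ bezout ⟩
      g                                              ≈⟨ g≋ ⟩
      ⟦ k ⟧ℤ *ₚ part                                 ≈⟨ P.*-comm ⟦ k ⟧ℤ part ⟩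
      part *ₚ ⟦ k ⟧ℤ                                 ∎)))
  where
  part∣M : PD._∣_ part M
  part∣M = Monic⇒Saturated lp c M c≢0 (α *ₚ ⟦ k ⟧ℤ PD., (begin
    α *ₚ ⟦ k ⟧ℤ *ₚ part       ≈⟨ P.*-assoc α ⟦ k ⟧ℤ part ⟩
    α *ₚ (⟦ k ⟧ℤ *ₚ part)     ≈⟨ P.*-congˡ {α} g≋ ⟨
    α *ₚ g                    ≈⟨ cM≋ ⟨
    ⟦ c ⟧ℤ *ₚ M               ∎))
  M' : Poly
  M' = PD._∣_.quotient part∣M
  M'part≋M : M' *ₚ part ≋ M
  M'part≋M = PD._∣_.equality part∣M

-- By `gauss` the gcd over ℚ has an integer-reduced part dividing `E` over ℤ. As a factor of a monic
-- polynomial this part is monic up to sign, and being saturated it then divides `M` over ℤ as well.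
reduce : ∀ M E → HasMonic E → Reduction M E
reduce M E mE = normalise (pseudoEuclid (length E) M E (DegBelow-length E))
  where
  fromFactor : (G : PseudoGCD M E) → PrimitiveFactor E (PseudoGCD.gcdₚ G) → Reduction M E
  fromFactor G (primitiveFactor {k} {part} {cofactor} k≢0 g≋ E≋) =
    [ (λ mp → monic-reduction G part cofactor k k≢0 mp g≋ E≋)
    , (λ mp → monic-reduction G (-ₚ part) (-ₚ cofactor) (ℤ.- k) (λ -k≡0 → k≢0 (ℤ.neg-injective -k≡0)) mp
        (P.trans g≋ (P.trans (solve 2 (λ k p → k :* p := (:- k) :* (:- p)) P.refl ⟦ k ⟧ℤ part) (P.*-congʳ { -ₚ part } (P.sym (PS.⟦⟧ℤ-neg k)))))
        (P.trans E≋ (solve 2 (λ k p → k :* p := (:- k) :* (:- p)) P.refl cofactor part)))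
    ]′ (monic-factor cofactor part (HasMonic-resp E≋ mE))
  normalise : PseudoGCD M E → Reduction M E
  normalise G@(pseudoGCD {g} {β = β} {c} c≢0 _ _ cE≋) = fromFactor G (gauss {c} {E} {β} {g} c≢0 cE≋)

-- A common divisor divides a nonzero integer, hence is constant. It also divides the monic `D`,
-- which leaves only 1 and -1 and rules out integer common factors.
Comaximal⇒CoprimeN : ∀ {N D} → PD.Comaximal N D → HasMonic D → CoprimeN N D
Comaximal⇒CoprimeN {N} {D} (PD.comaximal {k} {u} {v} k≢0 eq) mD g (a , ag≈N) (b , bg≈D) =
  [ (λ mg → inj₁ (≋⇒≈ₚ (one g mg g∣k)))
  , (λ mg → inj₂ (≋⇒≈ₚ (P.trans (solve 1 (λ g → g := :- (:- g)) P.refl g)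
      (P.-‿cong (one (-ₚ g) mg (PD.∣-respˡ P.refl (PD.∣-trans (-ₚ 1ₚ PD., solve 1 (λ g → (:- con (+ 1)) :* (:- g) := g) P.refl g) g∣k)))))))
  ]′ (monic-factor b g (HasMonic-resp (P.sym (≈ₚ⇒≋ (b *ₚ g) D bg≈D)) mD))
  where
  g∣k : PD._∣_ g ⟦ k ⟧ℤ
  g∣k = PD.∣-resp eq (PD.∣-+ (PD.∣-*ˡ u (a PD., ≈ₚ⇒≋ (a *ₚ g) N ag≈N)) (PD.∣-*ˡ v (b PD., ≈ₚ⇒≋ (b *ₚ g) D bg≈D)))
  one : ∀ h → HasMonic h → PD._∣_ h ⟦ k ⟧ℤ → h ≋ 1ₚ
  one h (m , lh) (w PD., wh≋k) with leadView w
  ... | inj₁ w≋0 = ⊥-elim (k≢0 (≡.trans (≡.sym (Lead-⟦⟧ℤ k .top)) (P.trans (P.sym wh≋k) (P.trans (P.*-congʳ {h} w≋0) (P.zeroˡ h)) .at 0)))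
  ... | inj₂ (j , c , lw , c≢0) with Lead-unique (Lead-resp wh≋k (Lead-* w h lw lh)) (Lead-⟦⟧ℤ k) (i*j≢0 c≢0 λ ()) k≢0
  ...   | j+m≡0 , _ with ℕ.m+n≡0⇒n≡0 j j+m≡0
  ...     | ≡.refl = coeffwise λ { zero → lh .top ; (suc i) → lh .above (suc i) (s≤s z≤n) }

-- The hypothesis says A - B = P M / E. Only M / E is reduced, to M' / E'; since `P` is comaximal
-- with `E`, the fraction P M' / E' is in lowest terms and its numerator shows the factor `P`.
≡ᵣ-intro : ∀ A B E M P → HasMonic E → PD.Comaximal P E →
           E *ₚ (num A *ₚ den B -ₚ num B *ₚ den A) ≋ P *ₚ M *ₚ den A *ₚ den B →
           A ≡ᵣ B [mod P ]
≡ᵣ-intro A B E M P mE P⊥E eq = conclude (reduce M E mE)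
  where
  Δ = num A *ₚ den B -ₚ num B *ₚ den A
  conclude : Reduction M E → A ≡ᵣ B [mod P ]
  conclude (reduction {g} {M'} {E'} (_ , lg) M≋ E≋ M'⊥E') =
    P *ₚ M' , E' , (λ E'≈0 → 1≢0 (≡.trans (≡.sym (proj₂ E'-monic .top)) (IsZeroₚ⇒coeff E'≈0 _)))
    , Comaximal⇒CoprimeN (PD.Comaximal-sym (PD.Comaximal-* E'⊥P (PD.Comaximal-sym M'⊥E'))) E'-monic
    , ≋⇒≈ₚ (PS.Regular-cancel {g} (Lead⇒Regular lg λ ()) (begin
        g *ₚ (P *ₚ M' *ₚ den A *ₚ den B)
          ≈⟨ solve 5 (λ g p m a b → g :* (p :* m :* a :* b) := p :* (m :* g) :* a :* b) P.refl g P M' (den A) (den B) ⟩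
        P *ₚ (M' *ₚ g) *ₚ den A *ₚ den B    ≈⟨ P.*-congʳ {den B} (P.*-congʳ {den A} (P.*-congˡ {P} M≋)) ⟨
        P *ₚ M *ₚ den A *ₚ den B            ≈⟨ eq ⟨
        E *ₚ Δ                              ≈⟨ P.*-congʳ {Δ} E≋ ⟩
        E' *ₚ g *ₚ Δ                        ≈⟨ solve 3 (λ e g d → e :* g :* d := g :* (e :* d)) P.refl E' g Δ ⟩
        g *ₚ (E' *ₚ Δ)                      ∎))
    , (M' , ≋⇒≈ₚ (P.*-comm M' P))
    where
    E'-monic : HasMonic E'
    E'-monic = Monic-quotient {E'} {g} lg (proj₂ (HasMonic-resp E≋ mE))
    E'⊥P : PD.Comaximal E' P
    E'⊥P = PD.Comaximal-sym (PD.Comaximal-∣ (PD.∣-resp (P.sym E≋) (PD.∣-factorˡ E' g)) P⊥E)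

-- The sums of the theorem as fractions

foldr-∑ : ∀ n (f : ℕ → Poly) (g : ℕ → ℕ) → foldr (λ i acc → f i +ₚ acc) 0ₚ (applyUpTo g n) ≋ PS.∑ n (λ i → f (g i))
foldr-∑ zero f g = P.refl
foldr-∑ (suc n) f g = P.trans (P.+-congˡ {f (g 0)} (foldr-∑ n f (λ i → g (suc i)))) (P.sym (PS.∑-head n (λ i → f (g i))))

foldr-∏ : ∀ n (f : ℕ → Poly) (g : ℕ → ℕ) → foldr (λ i acc → f i *ₚ acc) 1ₚ (applyUpTo g n) ≋ PS.∏ n (λ i → f (g i))
foldr-∏ zero f g = P.refl
foldr-∏ (suc n) f g = P.trans (P.*-congˡ {f (g 0)} (foldr-∏ n f (λ i → g (suc i)))) (P.sym (PS.∏-head n (λ i → f (g i))))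

[n]ₚ≋geom : ∀ n → [ n ]ₚ ≋ PQ.geom q n
[n]ₚ≋geom n = P.trans (foldr-∑ n X^ (λ i → i)) (PS.∑-cong n λ k _ → X^≋ k)

private
  1-X^≋ : ∀ {i j} → i ≡ j → 1ₚ -ₚ X^ i ≋ 1ₚ -ₚ q PS.^ j
  1-X^≋ {i} ≡.refl = P.+-congˡ {1ₚ} (P.-‿cong (X^≋ i))

qPoch-odd : ∀ k → qPoch 1 2 k ≋ PB.oddProduct q k
qPoch-odd k = P.trans (foldr-∏ k (λ j → 1ₚ -ₚ X^ (1 ℕ.+ 2 ℕ.* j)) (λ i → i)) (PS.∏-cong k λ j _ →
  P.trans (1-X^≋ (≡.cong (λ x → suc (j ℕ.+ x)) (ℕ.+-identityʳ j))) (P.sym (BlockSums.oddFactor≈ polyRing q j)))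

qPoch-even : ∀ k → qPoch 2 2 k ≋ PB.evenProduct q k
qPoch-even k = P.trans (foldr-∏ k (λ j → 1ₚ -ₚ X^ (2 ℕ.+ 2 ℕ.* j)) (λ i → i)) (PS.∏-cong k λ j _ →
  P.trans (1-X^≋ (exponent j)) (P.sym (BlockSums.evenFactor≈ polyRing q j)))
  where
  exponent : ∀ j → 2 ℕ.+ 2 ℕ.* j ≡ suc j ℕ.+ suc j
  exponent = solve-∀

signₚ-suc : ∀ k → signₚ (suc k) ≋ -ₚ signₚ k
signₚ-suc zero = P.refl
signₚ-suc (suc zero) = P.refl
signₚ-suc (suc (suc k)) = signₚ-suc k

sign-X^≋τ : ∀ k → signₚ k *ₚ X^ (k ℕ.* k ℕ.+ k) ≋ PQ.τ q k
sign-X^≋τ zero = P.*-identityˡ 1ₚ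
sign-X^≋τ (suc k) = begin
  signₚ (suc k) *ₚ X^ (suc k ℕ.* suc k ℕ.+ suc k)
    ≈⟨ P.*-cong (signₚ-suc k) (P.trans (X^≋ (suc k ℕ.* suc k ℕ.+ suc k)) (P.trans (PS.^-congʳ q (exponent k)) (PS.^-homo-* q (suc k ℕ.+ suc k) (k ℕ.* k ℕ.+ k)))) ⟩
  -ₚ signₚ k *ₚ (q PS.^ (suc k ℕ.+ suc k) *ₚ q PS.^ (k ℕ.* k ℕ.+ k))
    ≈⟨ P.*-congˡ { -ₚ signₚ k } (P.*-cong (P.sym (BlockSums.[q²]^≈ polyRing q (suc k))) (P.sym (X^≋ (k ℕ.* k ℕ.+ k)))) ⟩
  -ₚ signₚ k *ₚ ((q *ₚ q) PS.^ suc k *ₚ X^ (k ℕ.* k ℕ.+ k))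
    ≈⟨ solve 3 (λ s y x → (:- s) :* (y :* x) := :- (y :* (s :* x))) P.refl (signₚ k) ((q *ₚ q) PS.^ suc k) (X^ (k ℕ.* k ℕ.+ k)) ⟩
  -ₚ ((q *ₚ q) PS.^ suc k *ₚ (signₚ k *ₚ X^ (k ℕ.* k ℕ.+ k)))
    ≈⟨ P.-‿cong (P.*-congˡ {(q *ₚ q) PS.^ suc k} (sign-X^≋τ k)) ⟩
  PQ.τ q (suc k) ∎
  where
  exponent : ∀ k → suc k ℕ.* suc k ℕ.+ suc k ≡ (suc k ℕ.+ suc k) ℕ.+ (k ℕ.* k ℕ.+ k)
  exponent = solve-∀

infix 4 _≐_/_
_≐_/_ : RatF → Poly → Poly → Set
r ≐ M / E = num r *ₚ E ≋ M *ₚ den r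

-- In `_+ᵣ_` denominators pile up as products; measuring every term against one fixed `E` lets the
-- numerators add.
≐-sum : ∀ n (f : ℕ → RatF) (M : ℕ → Poly) E (g : ℕ → ℕ) → (∀ i → i < n → f (g i) ≐ M (g i) / E) →
        foldr (λ k acc → f k +ᵣ acc) (0ₚ /ᵣ 1ₚ) (applyUpTo g n) ≐ PS.∑ n (λ i → M (g i)) / E
≐-sum zero f M E g f≐ = P.refl
≐-sum (suc n) f M E g f≐ = begin
  (a *ₚ d +ₚ c *ₚ b) *ₚ E                    ≈⟨ solve 5 (λ a b c d e → (a :* d :+ c :* b) :* e := (a :* e) :* d :+ (c :* e) :* b) P.refl a b c d E ⟩
  a *ₚ E *ₚ d +ₚ c *ₚ E *ₚ b
    ≈⟨ P.+-cong (P.*-congʳ {d} (f≐ 0 (s≤s z≤n))) (P.*-congʳ {b} (≐-sum n f M E (λ i → g (suc i)) λ i i<n → f≐ (suc i) (s≤s i<n))) ⟩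
  M₀ *ₚ b *ₚ d +ₚ S *ₚ d *ₚ b                ≈⟨ solve 4 (λ m s b d → m :* b :* d :+ s :* d :* b := (m :+ s) :* (b :* d)) P.refl M₀ S b d ⟩
  (M₀ +ₚ S) *ₚ (b *ₚ d)                      ≈⟨ P.*-congʳ {b *ₚ d} (PS.∑-head n (λ i → M (g i))) ⟨
  PS.∑ (suc n) (λ i → M (g i)) *ₚ (b *ₚ d)   ∎
  where
  rest = foldr (λ k acc → f k +ᵣ acc) (0ₚ /ᵣ 1ₚ) (applyUpTo (λ i → g (suc i)) n)
  a = num (f (g 0)) ; b = den (f (g 0)) ; c = num rest ; d = den rest
  M₀ = M (g 0) ; S = PS.∑ n (λ i → M (g (suc i)))

1-qⁱ-regular : ∀ i → PS.Regular (1ₚ -ₚ q PS.^ suc i)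
1-qⁱ-regular i = Lead⇒Regular (Lead-resp (solve 1 (λ x → :- (x :- con (+ 1)) := con (+ 1) :- x) P.refl (q PS.^ suc i)) (Lead-neg (Monic-xⁿ-1 i))) λ ()

HasMonic-1+qⁱ : ∀ i → HasMonic (1ₚ +ₚ q PS.^ suc i)
HasMonic-1+qⁱ i = suc i , Lead-resp (P.+-congˡ {1ₚ} (X^≋ (suc i))) (lead (Lead-X^ i .top) λ { (suc j) (s≤s lt) → Lead-X^ i .above j lt })

HasMonic-X^ : ∀ m → HasMonic (q PS.^ m)
HasMonic-X^ m = m , Lead-resp (X^≋ m) (Lead-X^ m)

module _ (N : ℕ) where

  private
    n = suc (N ℕ.+ N)

    b : ℕ → Poly
    b = PB.scaledRatio q 1-qⁱ-regular (N ℕ.+ N)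

    W : Poly
    W = PB.plusProduct q (N ℕ.+ N)

    ratio : ∀ k → k ≤ N ℕ.+ N → qPoch 1 2 k *ₚ (W *ₚ W) ≋ b k *ₚ qPoch 2 2 k
    ratio k k≤ = P.trans (P.*-congʳ {W *ₚ W} (qPoch-odd k))
      (P.trans (P.sym (PB.scaledRatio-value q 1-qⁱ-regular (N ℕ.+ N) k k≤)) (P.*-congˡ {b k} (P.sym (qPoch-even k))))

  -- The ratio C_k is `b k` divided by W², whence the exponent 10 here and 6 in `rhsTerm-≐`.
  lhsTerm-≐ : ∀ k → k ≤ N ℕ.+ N → lhsTerm k ≐ PQ.summand q b k / W PS.^ 10
  lhsTerm-≐ k k≤ = begin
    s *ₚ g *ₚ o PS.^ 5 *ₚ x *ₚ W PS.^ 10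
      ≈⟨ solve 5 (λ s g o x w → s :* g :* o :^ 5 :* x :* w :^ 10 := (s :* x) :* g :* (o :* (w :* w)) :^ 5) P.refl s g o x W ⟩
    (s *ₚ x) *ₚ g *ₚ (o *ₚ (W *ₚ W)) PS.^ 5
      ≈⟨ P.*-cong (P.*-cong (sign-X^≋τ k) ([n]ₚ≋geom (4 ℕ.* k ℕ.+ 1))) (PS.^-congˡ 5 (ratio k k≤)) ⟩
    PQ.τ q k *ₚ PQ.geom q (4 ℕ.* k ℕ.+ 1) *ₚ (b k *ₚ e) PS.^ 5
      ≈⟨ solve 4 (λ t g b e → t :* g :* (b :* e) :^ 5 := t :* g :* b :^ 5 :* e :^ 5) P.refl (PQ.τ q k) (PQ.geom q (4 ℕ.* k ℕ.+ 1)) (b k) e ⟩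
    PQ.summand q b k *ₚ e PS.^ 5 ∎
    where
    s = signₚ k ; g = [ 4 ℕ.* k ℕ.+ 1 ]ₚ ; o = qPoch 1 2 k ; x = X^ (k ℕ.* k ℕ.+ k) ; e = qPoch 2 2 k

  rhsTerm-≐ : ∀ k → k ≤ N ℕ.+ N → rhsTerm k ≐ b k PS.^ 3 *ₚ (q *ₚ q) PS.^ k / W PS.^ 6
  rhsTerm-≐ k k≤ = begin
    o PS.^ 3 *ₚ X^ (2 ℕ.* k) *ₚ W PS.^ 6
      ≈⟨ solve 3 (λ o x w → o :^ 3 :* x :* w :^ 6 := (o :* (w :* w)) :^ 3 :* x) P.refl o (X^ (2 ℕ.* k)) W ⟩
    (o *ₚ (W *ₚ W)) PS.^ 3 *ₚ X^ (2 ℕ.* k)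
      ≈⟨ P.*-cong (PS.^-congˡ 3 (ratio k k≤)) (P.trans (X^≋ (2 ℕ.* k))
           (P.trans (PS.^-congʳ q (≡.cong (k ℕ.+_) (ℕ.+-identityʳ k))) (P.sym (BlockSums.[q²]^≈ polyRing q k)))) ⟩
    (b k *ₚ e) PS.^ 3 *ₚ (q *ₚ q) PS.^ k
      ≈⟨ solve 3 (λ b e x → (b :* e) :^ 3 :* x := b :^ 3 :* x :* e :^ 3) P.refl (b k) e ((q *ₚ q) PS.^ k) ⟩
    b k PS.^ 3 *ₚ (q *ₚ q) PS.^ k *ₚ e PS.^ 3 ∎
    where
    o = qPoch 1 2 k ; e = qPoch 2 2 k

  rhsHalf : RatF
  rhsHalf = polyᵣ [ n ]ₚ *ᵣ (1ₚ /ᵣ X^ N) *ᵣ sumᵣ (suc N) rhsTerm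

  private
    E : Poly
    E = q PS.^ N *ₚ W PS.^ 10

    b₀≋ : b 0 ≋ W *ₚ W
    b₀≋ = P.trans (P.sym (P.*-identityʳ (b 0))) (P.trans (PB.scaledRatio-value q 1-qⁱ-regular (N ℕ.+ N) 0 z≤n) (P.*-identityˡ (W *ₚ W)))

    difference : ∀ m → m ≤ n → let A = sumᵣ m lhsTerm ; B = rhsHalf in
                 E *ₚ (num A *ₚ den B -ₚ num B *ₚ den A) ≋ PQ.defect q N b m *ₚ den A *ₚ den B
    difference m m≤n = begin
      E *ₚ (a *ₚ (1ₚ *ₚ X^ N *ₚ d) -ₚ G *ₚ 1ₚ *ₚ c *ₚ e)
        ≈⟨ P.*-congˡ {E} (P.+-cong (P.*-congˡ {a} (P.*-congʳ {d} (P.*-congˡ {1ₚ} (X^≋ N))))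
                                   (P.-‿cong (P.*-congʳ {e} (P.*-congʳ {c} (P.*-congʳ {1ₚ} ([n]ₚ≋geom n)))))) ⟩
      E *ₚ (a *ₚ (1ₚ *ₚ y *ₚ d) -ₚ g *ₚ 1ₚ *ₚ c *ₚ e)
        -- The surplus W⁴ of W ^ 10 over W ^ 6 is `b 0 * b 0`, the factor that `cubicSum` carries.
        ≈⟨ solve 7 (λ y w a d g c e → y :* w :^ 10 :* (a :* (con (+ 1) :* y :* d) :- g :* con (+ 1) :* c :* e)
             := y :* (a :* w :^ 10) :* (y :* d) :- g :* ((w :* w) :* (w :* w)) :* (c :* w :^ 6) :* (y :* e)) P.refl y W a d g c e ⟩
      y *ₚ (a *ₚ W PS.^ 10) *ₚ (y *ₚ d) -ₚ g *ₚ ((W *ₚ W) *ₚ (W *ₚ W)) *ₚ (c *ₚ W PS.^ 6) *ₚ (y *ₚ e)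
        ≈⟨ P.+-cong (P.*-congʳ {y *ₚ d} (P.*-congˡ {y} a≐))
             (P.-‿cong (P.*-congʳ {y *ₚ e} (P.*-cong (P.*-congˡ {g} (P.*-cong (P.sym b₀≋) (P.sym b₀≋))) c≐))) ⟩
      y *ₚ (S *ₚ e) *ₚ (y *ₚ d) -ₚ g *ₚ (b 0 *ₚ b 0) *ₚ (C *ₚ d) *ₚ (y *ₚ e)
        ≈⟨ solve 7 (λ y s e d g b c → y :* (s :* e) :* (y :* d) :- g :* b :* (c :* d) :* (y :* e)
             := (y :* s :- g :* b :* c) :* e :* (con (+ 1) :* y :* d)) P.refl y S e d g (b 0 *ₚ b 0) C ⟩
      PQ.defect q N b m *ₚ e *ₚ (1ₚ *ₚ y *ₚ d)
        ≈⟨ P.*-congˡ {PQ.defect q N b m *ₚ e} (P.*-congʳ {d} (P.*-congˡ {1ₚ} (P.sym (X^≋ N)))) ⟩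
      PQ.defect q N b m *ₚ e *ₚ (1ₚ *ₚ X^ N *ₚ d) ∎
      where
      a = num (sumᵣ m lhsTerm) ; e = den (sumᵣ m lhsTerm)
      c = num (sumᵣ (suc N) rhsTerm) ; d = den (sumᵣ (suc N) rhsTerm)
      G = [ n ]ₚ ; g = PQ.geom q n ; y = q PS.^ N
      S = PS.∑ m (PQ.summand q b)
      C = PS.∑ (suc N) (λ k → b k PS.^ 3 *ₚ (q *ₚ q) PS.^ k)
      a≐ : a *ₚ W PS.^ 10 ≋ S *ₚ e
      a≐ = ≐-sum m lhsTerm (PQ.summand q b) (W PS.^ 10) (λ i → i) λ i i<m → lhsTerm-≐ i (ℕ.s≤s⁻¹ (ℕ.<-≤-trans i<m m≤n))
      c≐ : c *ₚ W PS.^ 6 ≋ C *ₚ d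
      c≐ = ≐-sum (suc N) rhsTerm (λ k → b k PS.^ 3 *ₚ (q *ₚ q) PS.^ k) (W PS.^ 6) (λ i → i)
        λ i i<1+N → rhsTerm-≐ i (ℕ.≤-trans (ℕ.s≤s⁻¹ i<1+N) (ℕ.m≤m+n N N))

    E-monic : HasMonic E
    E-monic = HasMonic-* (HasMonic-X^ N) (HasMonic-^ 10 (HasMonic-∏ (N ℕ.+ N) λ i _ → HasMonic-1+qⁱ i))

    E-comaximal : PD.Comaximal E (PC.xⁿ-1 q n)
    E-comaximal = PD.Comaximal-sym (PD.Comaximal-* (PD.Comaximal-^ N (PX.xⁿ-1-comaximal-x q (N ℕ.+ N)))
      (PD.Comaximal-^ 10 (PD.Comaximal-∏ (N ℕ.+ N) λ i _ → PX.xⁿ-1-comaximal-1+xʲ q N (suc i))))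

    b-rec : ∀ k → suc k < n → PQ.evenFactor q k *ₚ b (suc k) ≋ PQ.oddFactor q k *ₚ b k
    b-rec k lt = PB.scaledRatio-rec q 1-qⁱ-regular (N ℕ.+ N) k (ℕ.s<s⁻¹ lt)

    Φ-saturated : ∀ m e → PD.Saturated (Φ (suc m) PS.^ e)
    Φ-saturated m e = Monic⇒Saturated (proj₂ (HasMonic-^ e (proj₂ (Φ-correct m))))

    modulus = PQ.geom q n *ₚ Φ n *ₚ Φ n

    modulus≋ : [ n ]ₚ *ₚ Φ n *ₚ Φ n ≋ modulus
    modulus≋ = P.*-congʳ {Φ n} (P.*-congʳ {Φ n} ([n]ₚ≋geom n))

    modulus-∣ : PD._∣_ modulus (PQ.defect q N b n) × PD._∣_ modulus (PQ.defect q N b (suc N))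
    modulus-∣ with N ℕ.≟ 0
    ... | yes ≡.refl = zero-case , zero-case
      where
      zero-case : PD._∣_ modulus (PQ.defect q 0 b 1)
      zero-case = PD.∣-resp (P.sym (Supercongruence.defect-zero polyRing q b)) PD.∣-0
    ... | no N≢0 = Supercongruence.modulus-divides-defects polyRing q b Φ (λ m → proj₁ (Φ-correct m)) Φ-saturated xⁿ-1-regular
      N b-rec (ℕ.n≢0⇒n>0 N≢0)

    P⊥E : PD.Comaximal ([ n ]ₚ *ₚ Φ n *ₚ Φ n) E
    P⊥E = PD.Comaximal-sym (PD.Comaximal-* (PD.Comaximal-* (PD.Comaximal-∣ [n]∣ E-comaximal) E⊥Φ) E⊥Φ)
      where
      [n]∣ : PD._∣_ [ n ]ₚ (PC.xⁿ-1 q n)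
      [n]∣ = PD.∣-respˡ (P.sym ([n]ₚ≋geom n)) (PX.geom-∣ q n)
      E⊥Φ : PD.Comaximal E (Φ n)
      E⊥Φ = PD.Comaximal-∣ (PD.∣-resp (proj₁ (Φ-correct (N ℕ.+ N))) (PD.∣-factorˡ (Φ n) _)) E-comaximal

    congruence : ∀ m → m ≤ n → PD._∣_ modulus (PQ.defect q N b m) → sumᵣ m lhsTerm ≡ᵣ rhsHalf [mod [ n ]ₚ *ₚ Φ n *ₚ Φ n ]
    congruence m m≤n (M PD., eq) = ≡ᵣ-intro (sumᵣ m lhsTerm) rhsHalf E M ([ n ]ₚ *ₚ Φ n *ₚ Φ n) E-monic P⊥E
      (P.trans (difference m m≤n) (P.*-congʳ {den rhsHalf} (P.*-congʳ {den (sumᵣ m lhsTerm)}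
        (P.trans (P.sym eq) (P.trans (P.*-comm M modulus) (P.*-congʳ {M} (P.sym modulus≋)))))))

  congruences : (sumᵣ n lhsTerm ≡ᵣ rhsHalf [mod [ n ]ₚ *ₚ Φ n *ₚ Φ n ])
                × (sumᵣ (suc N) lhsTerm ≡ᵣ rhsHalf [mod [ n ]ₚ *ₚ Φ n *ₚ Φ n ])
  congruences = congruence n ℕ.≤-refl (proj₁ modulus-∣) , congruence (suc N) (s≤s (ℕ.m≤m+n N N)) (proj₂ modulus-∣)

half-double : ∀ N → (N ℕ.+ N) / 2 ≡ N
half-double N = ≡.trans (≡.cong (_/ 2) (double N)) (ℕ.m*n/n≡m N 2)
  where
  double : ∀ N → N ℕ.+ N ≡ N ℕ.* 2
  double = solve-∀

double%2 : ∀ N → (N ℕ.+ N) % 2 ≡ 0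
double%2 N = ≡.trans (≡.cong (_% 2) (double N)) (ℕ.m*n%n≡0 N 2)
  where
  double : ∀ N → N ℕ.+ N ≡ N ℕ.* 2
  double = solve-∀

theorem2p2 : (n : ℕ) → n % 2 ≡ 1 →
    (sumᵣ n lhsTerm ≡ᵣ rhs n [mod [ n ]ₚ *ₚ Φ n *ₚ Φ n ])
    × (sumᵣ (suc ((n ∸ 1) / 2)) lhsTerm ≡ᵣ rhs n [mod [ n ]ₚ *ₚ Φ n *ₚ Φ n ])
theorem2p2 n n%2≡1 with parity n
... | inj₁ (N , ≡.refl) = ⊥-elim (ℕ.0≢1+n (≡.trans (≡.sym (double%2 N)) n%2≡1))
-- For n = 2N + 1 the term `n ∸ 1` computes to `N ℕ.+ N`; only its half has to be replaced by `N`,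
-- in the exponent and in the summation bounds.
... | inj₂ (N , ≡.refl) = ≡.subst
  (λ h → let n = suc (N ℕ.+ N) ; B = polyᵣ [ n ]ₚ *ᵣ (1ₚ /ᵣ X^ h) *ᵣ sumᵣ (suc h) rhsTerm in
    (sumᵣ n lhsTerm ≡ᵣ B [mod [ n ]ₚ *ₚ Φ n *ₚ Φ n ]) × (sumᵣ (suc h) lhsTerm ≡ᵣ B [mod [ n ]ₚ *ₚ Φ n *ₚ Φ n ]))
  (≡.sym (half-double N)) (congruences N)
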